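{- Let $d\ge1$. For every nonzero normalized state $H$ and any pair $(a,r)$ with $H_{a,r}>0$ (an occupied pivot class), $$\Phi(H)=\sum_{u=0}^{r} I_a(u)\sum_{\nu\in\mathcal{A}(H,a,r,u)}\Bigl(\prod_{b,s}W_{b,s}(\nu)\Bigr)\Phi(H^{\nu}).$$ Together with $\Phi(0)=1$, this recurrence counts every invariant completion exactly once.
   Context: Fix an integer $d\ge1$. A normalized state is a finitely supported array $H=(H_{a,r})_{a\ge1,\,1\le r\le d}$ of nonnegative integers. A labeled realization of $H$ is a finite set $V$ with a permutation $\sigma$ and a function $\rho:V\to\{1,\dots,d\}$ constant on cycles of $\sigma$, such that exactly $H_{a,r}$ cycles have length $a$ and value $r$ (fixed points are cycles of length 1). An invariant completion is a $\sigma$-invariant set $E$ of unordered pairs of distinct elements of $V$ such that each $v\in V$ lies in exactly $\rho(v)$ pairs of $E$. $\Phi(H)$ denotes the number of invariant completions of one fixed labeled realization of $H$ (this number depends only on $H$); $\Phi(0)=1$. For $a\ge1$ put $$P_a(x)=(1+x^2)^{\lfloor (a-1)/2\rfloor}(1+x)^{\varepsilon_a},\qquad \varepsilon_a=1\text{ if }a\text{ is even},\ \varepsilon_a=0\text{ if }a\text{ is odd},$$ and $I_a(u)=[x^u]P_a(x)$. Given $H$ and $(a,r)$ with $H_{a,r}>0$, let $h_{b,s}=H_{b,s}-1$ if $(b,s)=(a,r)$ and $h_{b,s}=H_{b,s}$ otherwise. For $b\ge1$ and $1\le s\le d$ let $g_{ab}=\gcd(a,b)$, $\alpha_{ab}=b/g_{ab}$,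 $\beta_{ab}=a/g_{ab}$, and $$K_{a,r;b,s}=\min\{g_{ab},\lfloor r/\alpha_{ab}\rfloor,\lfloor s/\beta_{ab}\rfloor\}.$$ An allocation is a family $\nu=(\nu_{b,s,k})$ of nonnegative integers, $b\ge1$, $1\le s\le d$, $0\le k\le K_{a,r;b,s}$. $\mathcal{A}(H,a,r,u)$ is the set of allocations satisfying $$\sum_{k=0}^{K_{a,r;b,s}}\nu_{b,s,k}=h_{b,s}\ \text{ for all }(b,s),\qquad u+\sum_{b,s}\sum_{k=0}^{K_{a,r;b,s}}k\,\alpha_{ab}\,\nu_{b,s,k}=r.$$ The weights are $$W_{b,s}(\nu)=\frac{h_{b,s}!}{\prod_{k=0}^{K_{a,r;b,s}}\nu_{b,s,k}!}\prod_{k=0}^{K_{a,r;b,s}}\binom{g_{ab}}{k}^{\nu_{b,s,k}}$$ (equal to $1$ when $h_{b,s}=0$), and the next state $H^\nu$ is defined by $$H^\nu_{b,t}=\sum_{s=1}^{d}\ \sum_{\substack{0\le k\le K_{a,r;b,s}\\ s-k\beta_{ab}=t}}\nu_{b,s,k},\qquad b\ge1,\ 1\le t\le d$$ (cycles whose new residual degree is $0$ are dropped). -}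

module Defs where

open import Data.Bool.Base using (Bool; true; false; if_then_else_)
import Data.Bool.Properties as Bool
open import Data.Empty using (⊥-elim)
open import Data.Fin.Base
  using (Fin; zero; suc; toℕ; fromℕ; fromℕ<; inject₁; splitAt; join; _↑ˡ_; _↑ʳ_)
import Data.Fin.Properties as Fin
open import Data.Fin.Permutation using (Permutation′; _⟨$⟩ʳ_; permutation)
import Data.Fin.Permutation as Perm
open import Data.Fin.Relation.Unary.Top using (view; ‵fromℕ; ‵inject₁)
open import Data.Fin.Subset using (Subset; ∣_∣; ⊤; ⊥) renaming (_∈_ to _∈ₛ_)
open import Data.Fin.Subset.Properties using (∣⊥∣≡0; ∣⊤∣≡n; ∈⊤; ∉⊥; Empty-unique; ⊆-antisym)
open import Data.List.Base as List
  using (List; []; _∷_; map; concatMap; filter; length; upTo; _++_)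
import Data.List.Membership.Propositional as List
import Data.List.Membership.Propositional.Properties as List
open import Data.List.Properties using (length-map; length-++)
open import Data.List.Relation.Unary.Any using (here)
import Data.List.Relation.Unary.All as All
open import Data.List.Relation.Unary.AllPairs.Core using ([]; _∷_)
open import Data.List.Relation.Unary.Unique.Propositional using (Unique)
import Data.List.Relation.Unary.Unique.Propositional.Properties as Unique
open import Data.Nat.Base
open import Data.Nat.Combinatorics using (_C_)
open import Data.Nat.Divisibility using (_∣?_)
open import Data.Nat.DivMod using (_/_)
open import Data.Nat.GCD using (gcd; m/gcd[m,n]≢0; n/gcd[m,n]≢0; gcd[m,n]≡0⇒m≡0)
open import Data.Nat.GeneralisedArithmetic using (iterate)
open import Data.Nat.ListAction using (sum)
open import Data.Nat.Properties as ℕ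
  using (_≟_; _<?_; +-0-commutativeMonoid; *-1-commutativeMonoid; _!≢0; m*n≢0)
open import Data.Product.Base using (Σ; ∃; _×_; _,_; proj₁; proj₂)
open import Data.Sum.Base using (_⊎_; inj₁; inj₂; [_,_]′)
import Data.Sum.Base as Sum
open import Data.Vec.Base as Vec using (Vec; []; _∷_)
import Data.Vec.Properties as Vec
open import Function.Base using (_∘_; case_of_)
open import Function.Bundles using (_⇔_; mk⇔; Equivalence)
open import Relation.Binary.PropositionalEquality
open import Relation.Nullary using (¬_; Dec; yes; no; does)
open import Relation.Nullary.Decidable using (_×-dec_; dec-true; dec-false)
open import Relation.Nullary.Negation using (contradiction)

open import Algebra.Properties.CommutativeMonoid.Sum +-0-commutativeMonoid public
  using () renaming (sum to ∑)
open import Algebra.Properties.CommutativeMonoid.Sum *-1-commutativeMonoid public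
  using () renaming (sum to ∏)
import Algebra.Properties.CommutativeMonoid.Sum +-0-commutativeMonoid as Sumℕ

-- Every dependent function whose value at i is taken from the i-th list;
-- each is listed once up to pointwise equality when the lists have no
-- repetitions.
families : ∀ {n} {A : Fin n → Set} → (∀ i → List (A i)) → List (∀ i → A i)
families {zero}          xs = (λ ()) ∷ []
families {suc n} {A = A} xs =
  concatMap (λ x → map (cons x) (families (xs ∘ suc))) (xs zero)
  where
  cons : A zero → (∀ i → A (suc i)) → ∀ i → A i
  cons x f zero    = x
  cons x f (suc i) = f i

HasCardinality : {A : Set} → (A → Set) → ℕ → Set
HasCardinality {A} P n =
  Σ (List A) λ xs → Unique xs × (∀ x → (x List.∈ xs) ⇔ P x) × length xs ≡ n

-- Lengths and degrees start at 1: the indices b : Fin m and r : Fin d stand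
-- for the length len b and the degree deg r.

len : ∀ {m} → Fin m → ℕ
len b = suc (toℕ b)

deg : ∀ {d} → Fin d → ℕ
deg r = suc (toℕ r)

-- Finite support is witnessed by a bound: no length exceeds it.
record State (d : ℕ) : Set where
  field
    bound : ℕ
    mult  : Fin bound → Fin d → ℕ

open State public

entry : ∀ {d} → State d → ℕ → Fin d → ℕ
entry H zero    r = 0
entry H (suc i) r with i <? bound H
... | yes i<m = mult H (fromℕ< i<m) r
... | no  _   = 0

IsZero : ∀ {d} → State d → Set
IsZero H = ∀ b r → mult H b r ≡ 0

Reaches : ∀ {n} → Permutation′ n → Fin n → Fin n → Set
Reaches σ v w = ∃ λ k → iterate (σ ⟨$⟩ʳ_) v k ≡ w

IsCycle : ∀ {n} → Permutation′ n → Subset n → Set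
IsCycle σ c = ∃ λ v → ∀ w → (w ∈ₛ c) ⇔ Reaches σ v w

record Labeling (d : ℕ) : Set where
  field
    size       : ℕ
    σ          : Permutation′ size
    ρ          : Fin size → Fin d
    ρ-constant : ∀ c → IsCycle σ c → ∀ v w → v ∈ₛ c → w ∈ₛ c → ρ v ≡ ρ w

open Labeling public

IsCycleOf : ∀ {d} (L : Labeling d) → ℕ → Fin d → Subset (size L) → Set
IsCycleOf L a r c = IsCycle (σ L) c × ∣ c ∣ ≡ a × (∀ v → v ∈ₛ c → ρ L v ≡ r)

Realizes : ∀ {d} → Labeling d → (ℕ → Fin d → ℕ) → Set
Realizes L N = ∀ a r → HasCardinality (IsCycleOf L a r) (N a r)

Realization : ∀ {d} → State d → Set
Realization {d} H = Σ (Labeling d) λ L → Realizes L (entry H)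

-- A set of unordered pairs of distinct elements is given by its symmetric
-- and irreflexive indicator.
IsCompletion : ∀ {d} (L : Labeling d) → (Fin (size L) → Fin (size L) → Bool) → Set
IsCompletion L E =
    (∀ v w → E v w ≡ E w v)
  × (∀ v → E v v ≡ false)
  × (∀ v w → E (σ L ⟨$⟩ʳ v) (σ L ⟨$⟩ʳ w) ≡ E v w)
  × (∀ v → ∑ (λ w → if E v w then 1 else 0) ≡ deg (ρ L v))

isCompletion? : ∀ {d} (L : Labeling d) E → Dec (IsCompletion L E)
isCompletion? L E =
        Fin.all? (λ v → Fin.all? λ w → E v w Bool.≟ E w v)
  ×-dec Fin.all? (λ v → E v v Bool.≟ false)
  ×-dec Fin.all? (λ v → Fin.all? λ w →
          E (σ L ⟨$⟩ʳ v) (σ L ⟨$⟩ʳ w) Bool.≟ E v w)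
  ×-dec Fin.all? (λ v → ∑ (λ w → if E v w then 1 else 0) ≟ deg (ρ L v))

completions : ∀ {d} (L : Labeling d) → List (Fin (size L) → Fin (size L) → Bool)
completions L =
  filter (isCompletion? L) (families λ v → families λ w → true ∷ false ∷ [])

-- Coefficients in order of increasing degree.
Poly : Set
Poly = List ℕ

infixl 6 _+ₚ_
infixl 7 _*ₚ_
infixr 8 _^ₚ_

_+ₚ_ : Poly → Poly → Poly
[]      +ₚ q       = q
(x ∷ p) +ₚ []      = x ∷ p
(x ∷ p) +ₚ (y ∷ q) = x + y ∷ p +ₚ q

_*ₚ_ : Poly → Poly → Poly
[]      *ₚ q = []
(x ∷ p) *ₚ q = map (x *_) q +ₚ (0 ∷ p *ₚ q)

_^ₚ_ : Poly → ℕ → Poly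
p ^ₚ zero  = 1 ∷ []
p ^ₚ suc n = p *ₚ p ^ₚ n

coeff : Poly → ℕ → ℕ
coeff []      u       = 0
coeff (x ∷ p) zero    = x
coeff (x ∷ p) (suc u) = coeff p u

ε : ℕ → ℕ
ε a = if does (2 ∣? a) then 1 else 0

P : ℕ → Poly
P a = (1 ∷ 0 ∷ 1 ∷ []) ^ₚ ((a ∸ 1) / 2) *ₚ (1 ∷ 1 ∷ []) ^ₚ ε a

I : ℕ → ℕ → ℕ
I a u = coeff (P a) u

instance
  gcd-nonZero : ∀ {a b} .{{_ : NonZero a}} → NonZero (gcd a b)
  gcd-nonZero {a@(suc _)} {b} = ≢-nonZero λ eq → case gcd[m,n]≡0⇒m≡0 {a} {b} eq of λ ()

module _ (a b : ℕ) .{{_ : NonZero a}} .{{_ : NonZero b}} where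

  α : ℕ
  α = b / gcd a b

  β : ℕ
  β = a / gcd a b

  K : ℕ → ℕ → ℕ
  K r s = gcd a b ⊓ (r / α) {{≢-nonZero (n/gcd[m,n]≢0 a b)}}
                  ⊓ (s / β) {{≢-nonZero (m/gcd[m,n]≢0 a b)}}

∏-nonZero : ∀ {n} (f : Fin n → ℕ) → (∀ i → NonZero (f i)) → NonZero (∏ f)
∏-nonZero {zero}  f f≢0 = _
∏-nonZero {suc n} f f≢0 =
  m*n≢0 (f zero) (∏ (f ∘ suc)) {{f≢0 zero}} {{∏-nonZero (f ∘ suc) (f≢0 ∘ suc)}}

-- The division is exact when the numbers ν k sum to h.
weight : (g h : ℕ) {n : ℕ} → (Fin n → ℕ) → ℕ
weight g h ν =
  ((h !) / ∏ (λ k → ν k !)) {{∏-nonZero (λ k → ν k !) (λ k → ν k !≢0)}}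
  * ∏ (λ k → (g C toℕ k) ^ ν k)

module Pivot {d} (H : State d) (a : Fin (bound H)) (r : Fin d) where

  h : Fin (bound H) → Fin d → ℕ
  h b s = if does ((b Fin.≟ a) ×-dec (s Fin.≟ r)) then mult H b s ∸ 1 else mult H b s

  -- Beyond the bound h vanishes, so an allocation vanishes there too.
  Allocation : Set
  Allocation = ∀ (b : Fin (bound H)) (s : Fin d) →
               Fin (suc (K (len a) (len b) (deg r) (deg s))) → ℕ

  IsAllocation : ℕ → Allocation → Set
  IsAllocation u ν =
      (∀ b s → ∑ (ν b s) ≡ h b s)
    × u + ∑ (λ b → ∑ λ s → ∑ λ k → toℕ k * α (len a) (len b) * ν b s k) ≡ deg r

  isAllocation? : ∀ u ν → Dec (IsAllocation u ν)
  isAllocation? u ν = Fin.all? (λ b → Fin.all? λ s → ∑ (ν b s) ≟ h b s) ×-dec (_ ≟ deg r)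

  -- Every ν b s k is at most h b s.
  allocations : ℕ → List Allocation
  allocations u =
    filter (isAllocation? u)
      (families λ b → families λ s → families λ k → upTo (suc (h b s)))

  W : Allocation → Fin (bound H) → Fin d → ℕ
  W ν b s = weight (gcd (len a) (len b)) (h b s) (ν b s)

  next : Allocation → State d
  next ν .bound    = bound H
  next ν .mult b t = ∑ λ s → ∑ λ k →
    if does (deg s ∸ toℕ k * β (len a) (len b) ≟ deg t) then ν b s k else 0

  -- The right-hand side of the recurrence, with F in the place of Φ.
  expansion : (State d → ℕ) → ℕ
  expansion F = ∑ λ (u : Fin (suc (deg r))) →
    I (len a) (toℕ u) *
    sum (map (λ ν → ∏ (λ b → ∏ λ s → W ν b s) * F (next ν)) (allocations (toℕ u)))

open Pivot public using (expansion)

private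
  Realizable : ∀ {d} → (ℕ → Fin d → ℕ) → Set
  Realizable N = ∃ λ L → Realizes L N

  iterate-+ : ∀ {A : Set} (f : A → A) x j k →
              iterate f x (j + k) ≡ iterate f (iterate f x j) k
  iterate-+ f x zero    k = refl
  iterate-+ f x (suc j) k = iterate-+ f (f x) j k

  reaches-trans : ∀ {n} (σ : Permutation′ n) {u v w} →
                  Reaches σ u v → Reaches σ v w → Reaches σ u w
  reaches-trans σ {u} (j , refl) (k , q) = j + k , trans (iterate-+ (σ ⟨$⟩ʳ_) u j k) q

  base∈ : ∀ {n} (σ : Permutation′ n) {c} ((v , _) : IsCycle σ c) → v ∈ₛ c
  base∈ σ (v , f) = Equivalence.from (f v) (0 , refl)

  emptyLabeling : ∀ {d} → Labeling d
  emptyLabeling .size = 0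
  emptyLabeling .σ    = Perm.id
  emptyLabeling .ρ    ()
  emptyLabeling .ρ-constant c (() , _)

  empty-realizes : ∀ {d} → Realizes (emptyLabeling {d}) (λ _ _ → 0)
  empty-realizes a r = [] , [] , (λ c → mk⇔ (λ ()) λ { ((() , _) , _) }) , refl

  pred↻ : ∀ {n} → Fin (suc n) → Fin (suc n)
  pred↻ zero    = fromℕ _
  pred↻ (suc i) = inject₁ i

  succ↻ : ∀ {n} → Fin (suc n) → Fin (suc n)
  succ↻ i with view i
  ... | ‵fromℕ     = zero
  ... | ‵inject₁ j = suc j

  pred-succ : ∀ {n} (i : Fin (suc n)) → pred↻ (succ↻ i) ≡ i
  pred-succ i with view i
  ... | ‵fromℕ     = refl
  ... | ‵inject₁ j = refl

  succ-fromℕ : ∀ n → succ↻ (fromℕ n) ≡ zero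
  succ-fromℕ n with fromℕ n | view (fromℕ n) | Fin.toℕ-fromℕ n
  ... | _ | ‵fromℕ     | _ = refl
  ... | _ | ‵inject₁ j | e = contradiction (trans (sym (Fin.toℕ-inject₁ j)) e) (ℕ.<⇒≢ (Fin.toℕ<n j))

  succ-inject₁ : ∀ {n} (j : Fin n) → succ↻ (inject₁ j) ≡ suc j
  succ-inject₁ {n} j with inject₁ j | view (inject₁ j) | Fin.toℕ-inject₁ j
  ... | _ | ‵inject₁ i | e =
        cong suc (Fin.toℕ-injective (trans (sym (Fin.toℕ-inject₁ i)) e))
  ... | _ | ‵fromℕ     | e =
        contradiction (trans (sym e) (Fin.toℕ-fromℕ n)) (ℕ.<⇒≢ (Fin.toℕ<n j))

  succ-pred : ∀ {n} (i : Fin (suc n)) → succ↻ (pred↻ i) ≡ i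
  succ-pred zero    = succ-fromℕ _
  succ-pred (suc i) = succ-inject₁ i

  rotation : ∀ n → Permutation′ (suc n)
  rotation n = permutation pred↻ succ↻ pred-succ succ-pred

  toZero : ∀ {n} k (i : Fin (suc n)) → toℕ i ≡ k → iterate pred↻ i k ≡ zero
  toZero zero    zero    e = refl
  toZero (suc k) (suc i) e =
    toZero k (inject₁ i) (trans (Fin.toℕ-inject₁ i) (ℕ.suc-injective e))

  fromTop : ∀ {n} k (i : Fin (suc n)) → toℕ i + k ≡ n → iterate pred↻ (fromℕ n) k ≡ i
  fromTop {n} zero i e =
    Fin.toℕ-injective (trans (Fin.toℕ-fromℕ n) (trans (sym e) (ℕ.+-identityʳ _)))
  fromTop {n} (suc k) i e with view i
  ... | ‵fromℕ     = contradiction e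
        (ℕ.m≢1+m+n n ∘ sym ∘ trans (sym (trans (cong (_+ suc k) (Fin.toℕ-fromℕ n)) (ℕ.+-suc n k))))
  ... | ‵inject₁ j = trans (cong (iterate pred↻ (fromℕ n)) (ℕ.+-comm 1 k))
        (trans (iterate-+ pred↻ (fromℕ n) k 1)
               (cong pred↻ (fromTop k (suc j)
                 (trans (sym (ℕ.+-suc (toℕ j) k))
                        (trans (cong (_+ suc k) (sym (Fin.toℕ-inject₁ j))) e)))))

  rotation-reaches : ∀ {n} (v w : Fin (suc n)) → Reaches (rotation n) v w
  rotation-reaches {n} v w =
    reaches-trans (rotation n) (toℕ v , toZero _ v refl)
      (reaches-trans (rotation n) (1 , refl)
        (n ∸ toℕ w , fromTop _ w (ℕ.m+[n∸m]≡n (ℕ.≤-pred (Fin.toℕ<n w)))))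

  rotation-cycle : ∀ {n} → IsCycle (rotation n) ⊤
  rotation-cycle = zero , λ w → mk⇔ (λ _ → rotation-reaches zero w) (λ _ → ∈⊤)

  rotation-cycle! : ∀ {n} {c} → IsCycle (rotation n) c → c ≡ ⊤
  rotation-cycle! (v , f) =
    ⊆-antisym (λ _ → ∈⊤) (λ {w} _ → Equivalence.from (f w) (rotation-reaches v w))

  cycleLabeling : ∀ {d} → ℕ → Fin d → Labeling d
  cycleLabeling n r .size = suc n
  cycleLabeling n r .σ    = rotation n
  cycleLabeling n r .ρ    = λ _ → r
  cycleLabeling n r .ρ-constant = λ _ _ _ _ _ _ → refl

  𝟙 : ∀ {Q : Set} → Dec Q → ℕ
  𝟙 q? = if does q? then 1 else 0

  𝟙-yes : ∀ {Q : Set} (q? : Dec Q) → Q → 𝟙 q? ≡ 1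
  𝟙-yes q? q = cong (if_then 1 else 0) (dec-true q? q)

  𝟙-no : ∀ {Q : Set} (q? : Dec Q) → ¬ Q → 𝟙 q? ≡ 0
  𝟙-no q? ¬q = cong (if_then 1 else 0) (dec-false q? ¬q)

  single : ∀ {d} → ℕ → Fin d → ℕ → Fin d → ℕ
  single n r a s = 𝟙 ((suc n ≟ a) ×-dec (r Fin.≟ s))

  cycle-realizes : ∀ {d} n (r : Fin d) → Realizes (cycleLabeling n r) (single n r)
  cycle-realizes n r a s = go ((suc n ≟ a) ×-dec (r Fin.≟ s))
    where
    go : (q? : Dec (suc n ≡ a × r ≡ s)) → HasCardinality (IsCycleOf (cycleLabeling n r) a s) (𝟙 q?)
    go (yes (refl , refl)) =
      ⊤ ∷ [] , All.[] ∷ [] ,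
      (λ c → mk⇔ (λ { (here refl) → rotation-cycle , ∣⊤∣≡n (suc n) , λ _ _ → refl })
                 (λ (p , _) → here (rotation-cycle! p))) ,
      refl
    go (no ¬q) =
      [] , [] ,
      (λ c → mk⇔ (λ ()) λ (p , q , f) → contradiction
        (trans (sym (trans (cong ∣_∣ (rotation-cycle! p)) (∣⊤∣≡n (suc n)))) q , f _ (base∈ (rotation n) p)) ¬q) ,
      refl

  module Union {d} (L₁ L₂ : Labeling d) where

    m n : ℕ
    m = size L₁
    n = size L₂

    to from : Fin (m + n) → Fin (m + n)
    to   x = join m n (Sum.map (σ L₁ ⟨$⟩ʳ_) (σ L₂ ⟨$⟩ʳ_) (splitAt m x))
    from x = join m n (Sum.map (σ L₁ Perm.⟨$⟩ˡ_) (σ L₂ Perm.⟨$⟩ˡ_) (splitAt m x))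

    to-from : ∀ x → to (from x) ≡ x
    to-from x rewrite Fin.splitAt-join m n (Sum.map (σ L₁ Perm.⟨$⟩ˡ_) (σ L₂ Perm.⟨$⟩ˡ_) (splitAt m x))
      with splitAt m x in eq
    ... | inj₁ i = trans (cong (_↑ˡ n) (Perm.inverseʳ (σ L₁))) (Fin.splitAt⁻¹-↑ˡ eq)
    ... | inj₂ j = trans (cong (m ↑ʳ_) (Perm.inverseʳ (σ L₂))) (Fin.splitAt⁻¹-↑ʳ eq)

    from-to : ∀ x → from (to x) ≡ x
    from-to x rewrite Fin.splitAt-join m n (Sum.map (σ L₁ ⟨$⟩ʳ_) (σ L₂ ⟨$⟩ʳ_) (splitAt m x))
      with splitAt m x in eq
    ... | inj₁ i = trans (cong (_↑ˡ n) (Perm.inverseˡ (σ L₁))) (Fin.splitAt⁻¹-↑ˡ eq)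
    ... | inj₂ j = trans (cong (m ↑ʳ_) (Perm.inverseˡ (σ L₂))) (Fin.splitAt⁻¹-↑ʳ eq)

    τ : Permutation′ (m + n)
    τ = permutation to from to-from from-to

    data Side : Fin (m + n) → Set where
      left  : ∀ i → Side (i ↑ˡ n)
      right : ∀ j → Side (m ↑ʳ j)

    side : ∀ x → Side x
    side x with splitAt m x in eq
    ... | inj₁ i = subst Side (Fin.splitAt⁻¹-↑ˡ eq) (left i)
    ... | inj₂ j = subst Side (Fin.splitAt⁻¹-↑ʳ eq) (right j)

    disjoint : ∀ {i j} → i ↑ˡ n ≢ m ↑ʳ j
    disjoint {i} {j} e with () ←
      trans (sym (Fin.splitAt-↑ˡ m i n)) (trans (cong (splitAt m) e) (Fin.splitAt-↑ʳ m n j))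

    iterate-left : ∀ i k → iterate to (i ↑ˡ n) k ≡ iterate (σ L₁ ⟨$⟩ʳ_) i k ↑ˡ n
    iterate-left i zero    = refl
    iterate-left i (suc k) rewrite Fin.splitAt-↑ˡ m i n = iterate-left _ k

    iterate-right : ∀ j k → iterate to (m ↑ʳ j) k ≡ m ↑ʳ iterate (σ L₂ ⟨$⟩ʳ_) j k
    iterate-right j zero    = refl
    iterate-right j (suc k) rewrite Fin.splitAt-↑ʳ m n j = iterate-right _ k

    reaches-left : ∀ {i i′} → Reaches τ (i ↑ˡ n) (i′ ↑ˡ n) ⇔ Reaches (σ L₁) i i′
    reaches-left {i} = mk⇔
      (λ (k , e) → k , Fin.↑ˡ-injective n _ _ (trans (sym (iterate-left i k)) e))
      (λ (k , e) → k , trans (iterate-left i k) (cong (_↑ˡ n) e))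

    reaches-right : ∀ {j j′} → Reaches τ (m ↑ʳ j) (m ↑ʳ j′) ⇔ Reaches (σ L₂) j j′
    reaches-right {j} = mk⇔
      (λ (k , e) → k , Fin.↑ʳ-injective m _ _ (trans (sym (iterate-right j k)) e))
      (λ (k , e) → k , trans (iterate-right j k) (cong (m ↑ʳ_) e))

    ∈-left : ∀ {c₁ : Subset m} {c₂ : Subset n} {i} → (i ↑ˡ n ∈ₛ c₁ Vec.++ c₂) ⇔ (i ∈ₛ c₁)
    ∈-left {c₁} {c₂} {i} = mk⇔
      (λ p → Vec.lookup⇒[]= i c₁ (trans (sym (Vec.lookup-++ˡ c₁ c₂ i)) (Vec.[]=⇒lookup p)))
      (λ p → Vec.lookup⇒[]= (i ↑ˡ n) (c₁ Vec.++ c₂)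
               (trans (Vec.lookup-++ˡ c₁ c₂ i) (Vec.[]=⇒lookup p)))

    ∈-right : ∀ {c₁ : Subset m} {c₂ : Subset n} {j} → (m ↑ʳ j ∈ₛ c₁ Vec.++ c₂) ⇔ (j ∈ₛ c₂)
    ∈-right {c₁} {c₂} {j} = mk⇔
      (λ p → Vec.lookup⇒[]= j c₂ (trans (sym (Vec.lookup-++ʳ c₁ c₂ j)) (Vec.[]=⇒lookup p)))
      (λ p → Vec.lookup⇒[]= (m ↑ʳ j) (c₁ Vec.++ c₂)
               (trans (Vec.lookup-++ʳ c₁ c₂ j) (Vec.[]=⇒lookup p)))

    open Equivalence renaming (to to ⇒; from to ⇐)

    cycle-left : ∀ {c₁} → IsCycle (σ L₁) c₁ → IsCycle τ (c₁ Vec.++ ⊥)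
    cycle-left {c₁} (v , f) = v ↑ˡ n , λ w → go w (side w)
      where
      go : ∀ w → Side w → (w ∈ₛ c₁ Vec.++ ⊥) ⇔ Reaches τ (v ↑ˡ n) w
      go _ (left i)  = mk⇔ (⇐ reaches-left ∘ ⇒ (f i) ∘ ⇒ (∈-left {c₁}))
                           (⇐ (∈-left {c₁}) ∘ ⇐ (f i) ∘ ⇒ reaches-left)
      go _ (right j) = mk⇔ (⊥-elim ∘ ∉⊥ ∘ ⇒ (∈-right {c₁}))
                           (λ (k , e) → contradiction (trans (sym (iterate-left v k)) e) disjoint)

    cycle-right : ∀ {c₂} → IsCycle (σ L₂) c₂ → IsCycle τ (⊥ Vec.++ c₂)
    cycle-right {c₂} (v , f) = m ↑ʳ v , λ w → go w (side w)
      where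
      go : ∀ w → Side w → (w ∈ₛ ⊥ {m} Vec.++ c₂) ⇔ Reaches τ (m ↑ʳ v) w
      go _ (right j) = mk⇔ (⇐ reaches-right ∘ ⇒ (f j) ∘ ⇒ (∈-right {⊥}))
                           (⇐ (∈-right {⊥}) ∘ ⇐ (f j) ∘ ⇒ reaches-right)
      go _ (left i)  = mk⇔ (⊥-elim ∘ ∉⊥ ∘ ⇒ (∈-left {⊥}))
                           (λ (k , e) → contradiction (trans (sym e) (iterate-right v k)) disjoint)

    data CycleOf : Subset (m + n) → Set where
      left  : ∀ {c₁} → IsCycle (σ L₁) c₁ → CycleOf (c₁ Vec.++ ⊥)
      right : ∀ {c₂} → IsCycle (σ L₂) c₂ → CycleOf (⊥ Vec.++ c₂)

    cycleOf : ∀ {c} → IsCycle τ c → CycleOf c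
    cycleOf {c} (v , f) with Vec.splitAt m c | side v
    ... | c₁ , c₂ , refl | left i =
          subst (CycleOf ∘ (c₁ Vec.++_)) (sym (Empty-unique c₂-empty)) (left (i , λ w → mk⇔
            (⇒ reaches-left ∘ ⇒ (f (w ↑ˡ n)) ∘ ⇐ (∈-left {c₁}))
            (⇒ (∈-left {c₁}) ∘ ⇐ (f (w ↑ˡ n)) ∘ ⇐ reaches-left)))
      where
      c₂-empty : ¬ ∃ (_∈ₛ c₂)
      c₂-empty (j , j∈) with k , e ← ⇒ (f (m ↑ʳ j)) (⇐ (∈-right {c₁}) j∈) =
        disjoint (trans (sym (iterate-left i k)) e)
    ... | c₁ , c₂ , refl | right j =
          subst (CycleOf ∘ (Vec._++ c₂)) (sym (Empty-unique c₁-empty)) (right (j , λ w → mk⇔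
            (⇒ reaches-right ∘ ⇒ (f (m ↑ʳ w)) ∘ ⇐ (∈-right {c₁}))
            (⇒ (∈-right {c₁}) ∘ ⇐ (f (m ↑ʳ w)) ∘ ⇐ reaches-right)))
      where
      c₁-empty : ¬ ∃ (_∈ₛ c₁)
      c₁-empty (i , i∈) with k , e ← ⇒ (f (i ↑ˡ n)) (⇐ (∈-left {c₁}) i∈) =
        disjoint (trans (sym e) (iterate-right j k))

    ϱ : Fin (m + n) → Fin d
    ϱ = [ ρ L₁ , ρ L₂ ]′ ∘ splitAt m

    ϱ-left : ∀ i → ϱ (i ↑ˡ n) ≡ ρ L₁ i
    ϱ-left i = cong [ ρ L₁ , ρ L₂ ]′ (Fin.splitAt-↑ˡ m i n)

    ϱ-right : ∀ j → ϱ (m ↑ʳ j) ≡ ρ L₂ j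
    ϱ-right j = cong [ ρ L₁ , ρ L₂ ]′ (Fin.splitAt-↑ʳ m n j)

    all-left : ∀ {c₁ r} → (∀ v → v ∈ₛ c₁ → ρ L₁ v ≡ r) → ∀ v → v ∈ₛ c₁ Vec.++ ⊥ → ϱ v ≡ r
    all-left {c₁} f v v∈ with side v
    ... | left i  = trans (ϱ-left i) (f i (⇒ (∈-left {c₁}) v∈))
    ... | right j = ⊥-elim (∉⊥ (⇒ (∈-right {c₁}) v∈))

    all-right : ∀ {c₂ r} → (∀ v → v ∈ₛ c₂ → ρ L₂ v ≡ r) → ∀ v → v ∈ₛ ⊥ {m} Vec.++ c₂ → ϱ v ≡ r
    all-right {c₂} f v v∈ with side v
    ... | left i  = ⊥-elim (∉⊥ (⇒ (∈-left {⊥}) v∈))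
    ... | right j = trans (ϱ-right j) (f j (⇒ (∈-right {⊥}) v∈))

    ϱ-constant : ∀ c → IsCycle τ c → ∀ v w → v ∈ₛ c → w ∈ₛ c → ϱ v ≡ ϱ w
    ϱ-constant c p v w v∈ w∈ with cycleOf p
    ... | left  {c₁} q = trans (all-left {c₁} g v v∈) (sym (all-left {c₁} g w w∈))
      where
      g : ∀ x → x ∈ₛ c₁ → ρ L₁ x ≡ ρ L₁ (proj₁ q)
      g x x∈ = ρ-constant L₁ c₁ q x _ x∈ (base∈ (σ L₁) q)
    ... | right {c₂} q = trans (all-right {c₂} g v v∈) (sym (all-right {c₂} g w w∈))
      where
      g : ∀ x → x ∈ₛ c₂ → ρ L₂ x ≡ ρ L₂ (proj₁ q)
      g x x∈ = ρ-constant L₂ c₂ q x _ x∈ (base∈ (σ L₂) q)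

    union : Labeling d
    union .size       = m + n
    union .σ          = τ
    union .ρ          = ϱ
    union .ρ-constant = ϱ-constant

    ∣++∣ : ∀ {k l} (c₁ : Subset k) (c₂ : Subset l) → ∣ c₁ Vec.++ c₂ ∣ ≡ ∣ c₁ ∣ + ∣ c₂ ∣
    ∣++∣ []           c₂ = refl
    ∣++∣ (true  ∷ c₁) c₂ = cong suc (∣++∣ c₁ c₂)
    ∣++∣ (false ∷ c₁) c₂ = ∣++∣ c₁ c₂

    ∣left∣ : ∀ (c₁ : Subset m) → ∣ c₁ Vec.++ ⊥ {n} ∣ ≡ ∣ c₁ ∣
    ∣left∣ c₁ = trans (∣++∣ c₁ ⊥) (trans (cong (∣ c₁ ∣ +_) (∣⊥∣≡0 n)) (ℕ.+-identityʳ _))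

    ∣right∣ : ∀ (c₂ : Subset n) → ∣ ⊥ {m} Vec.++ c₂ ∣ ≡ ∣ c₂ ∣
    ∣right∣ c₂ = trans (∣++∣ (⊥ {m}) c₂) (cong (_+ ∣ c₂ ∣) (∣⊥∣≡0 m))

    ofLeft : ∀ {a r c₁} → IsCycleOf L₁ a r c₁ → IsCycleOf union a r (c₁ Vec.++ ⊥)
    ofLeft {c₁ = c₁} (p , q , f) = cycle-left p , trans (∣left∣ c₁) q , all-left {c₁} f

    ofRight : ∀ {a r c₂} → IsCycleOf L₂ a r c₂ → IsCycleOf union a r (⊥ Vec.++ c₂)
    ofRight {c₂ = c₂} (p , q , f) = cycle-right p , trans (∣right∣ c₂) q , all-right {c₂} f

    union-realizes : ∀ {N₁ N₂} → Realizes L₁ N₁ → Realizes L₂ N₂ →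
                     Realizes union (λ a r → N₁ a r + N₂ a r)
    union-realizes R₁ R₂ a r with R₁ a r | R₂ a r
    ... | xs , xs! , xs∈ , ∣xs∣ | ys , ys! , ys∈ , ∣ys∣ =
          zs ,
          Unique.++⁺ (Unique.map⁺ (λ e → Vec.++-injectiveˡ _ _ e) xs!)
                     (Unique.map⁺ (λ e → Vec.++-injectiveʳ ⊥ ⊥ e) ys!)
                     apart ,
          (λ c → mk⇔ (sound c) (λ (p , q , f) → complete c (cycleOf p) q f)) ,
          trans (length-++ (map (Vec._++ ⊥) xs))
            (cong₂ _+_ (trans (length-map _ xs) ∣xs∣) (trans (length-map _ ys) ∣ys∣))
      where
      zs : List (Subset (m + n))
      zs = map (Vec._++ ⊥) xs ++ map (⊥ Vec.++_) ys

      apart : ∀ {c} → ¬ (c List.∈ map (Vec._++ ⊥) xs × c List.∈ map (⊥ Vec.++_) ys)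
      apart (p , q) with List.∈-map⁻ (Vec._++ ⊥) p | List.∈-map⁻ (⊥ Vec.++_) q
      ... | c₁ , c₁∈ , refl | c₂ , c₂∈ , e
        with refl ← Vec.++-injectiveˡ c₁ ⊥ e = ∉⊥ (base∈ (σ L₁) (proj₁ (⇒ (xs∈ _) c₁∈)))

      sound : ∀ c → c List.∈ zs → IsCycleOf union a r c
      sound c c∈ with List.∈-++⁻ (map (Vec._++ ⊥) xs) c∈
      ... | inj₁ p with c₁ , c₁∈ , refl ← List.∈-map⁻ (Vec._++ ⊥) p = ofLeft (⇒ (xs∈ c₁) c₁∈)
      ... | inj₂ p with c₂ , c₂∈ , refl ← List.∈-map⁻ (⊥ Vec.++_) p = ofRight (⇒ (ys∈ c₂) c₂∈)

      complete : ∀ c → CycleOf c → ∣ c ∣ ≡ a → (∀ v → v ∈ₛ c → ϱ v ≡ r) → c List.∈ zs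
      complete _ (left {c₁} p) q f = List.∈-++⁺ˡ (List.∈-map⁺ (Vec._++ ⊥) (⇐ (xs∈ c₁)
        (p , trans (sym (∣left∣ c₁)) q ,
         λ v v∈ → trans (sym (ϱ-left v)) (f _ (⇐ (∈-left {c₁}) v∈)))))
      complete _ (right {c₂} p) q f = List.∈-++⁺ʳ (map (Vec._++ ⊥) xs)
        (List.∈-map⁺ (⊥ Vec.++_) (⇐ (ys∈ c₂)
          (p , trans (sym (∣right∣ c₂)) q ,
           λ v v∈ → trans (sym (ϱ-right v)) (f _ (⇐ (∈-right {⊥}) v∈)))))

  realizable-∑ : ∀ {d n} {N : Fin n → ℕ → Fin d → ℕ} → (∀ i → Realizable (N i)) →
                 Realizable (λ a r → ∑ λ i → N i a r)
  realizable-∑ {n = zero}  R = emptyLabeling , empty-realizes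
  realizable-∑ {n = suc n} R with R zero | realizable-∑ (R ∘ suc)
  ... | L₁ , R₁ | L₂ , R₂ = Union.union L₁ L₂ , Union.union-realizes L₁ L₂ R₁ R₂

  ∑-zero : ∀ {n} (f : Fin n → ℕ) → (∀ i → f i ≡ 0) → ∑ f ≡ 0
  ∑-zero {zero}  f f≡0 = refl
  ∑-zero {suc n} f f≡0 = cong₂ _+_ (f≡0 zero) (∑-zero (f ∘ suc) (f≡0 ∘ suc))

  ∑-one : ∀ n → ∑ {n} (λ _ → 1) ≡ n
  ∑-one zero    = refl
  ∑-one (suc n) = cong suc (∑-one n)

  ∑-only : ∀ {n} (f : Fin n → ℕ) i → (∀ j → j ≢ i → f j ≡ 0) → ∑ f ≡ f i
  ∑-only f zero    f≡0 =
    trans (cong (f zero +_) (∑-zero (f ∘ suc) (λ j → f≡0 (suc j) λ ()))) (ℕ.+-identityʳ _)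
  ∑-only f (suc i) f≡0 =
    cong₂ _+_ (f≡0 zero λ ()) (∑-only (f ∘ suc) i λ j j≢i → f≡0 (suc j) (j≢i ∘ Fin.suc-injective))

  module _ {d} (H : State d) where

    total : ℕ → Fin d → ℕ
    total a r = ∑ λ b → ∑ λ s → ∑ {mult H b s} λ _ → single (toℕ b) s a r

    single-yes : ∀ i (r : Fin d) → single i r (suc i) r ≡ 1
    single-yes i r = 𝟙-yes ((suc i ≟ suc i) ×-dec (r Fin.≟ r)) (refl , refl)

    single-no : ∀ i (s : Fin d) a r → suc i ≢ a ⊎ s ≢ r → single i s a r ≡ 0
    single-no i s a r p = 𝟙-no ((suc i ≟ a) ×-dec (s Fin.≟ r))
      λ (e , e′) → [ contradiction e , contradiction e′ ]′ p

    row-zero : ∀ b a r → suc (toℕ b) ≢ a →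
               ∑ (λ s → ∑ {mult H b s} λ _ → single (toℕ b) s a r) ≡ 0
    row-zero b a r p = ∑-zero _ λ s → ∑-zero {mult H b s} _ λ _ → single-no (toℕ b) s a r (inj₁ p)

    total-entry : ∀ a r → total a r ≡ entry H a r
    total-entry zero    r = ∑-zero _ λ b → row-zero b 0 r λ ()
    total-entry (suc i) r with i <? bound H
    ... | no i≮m = ∑-zero _ λ b → row-zero b (suc i) r λ e →
          i≮m (subst (_< bound H) (ℕ.suc-injective e) (Fin.toℕ<n b))
    ... | yes i<m = begin
      total (suc i) r
        ≡⟨ ∑-only _ b₀ (λ b b≢ → row-zero b (suc i) r λ e → b≢ (Fin.toℕ-injective
             (trans (ℕ.suc-injective e) (sym b₀≡i)))) ⟩
      ∑ (λ s → ∑ {mult H b₀ s} λ _ → single (toℕ b₀) s (suc i) r)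
        ≡⟨ ∑-only _ r (λ s s≢ → ∑-zero {mult H b₀ s} _ λ _ → single-no (toℕ b₀) s (suc i) r (inj₂ s≢)) ⟩
      ∑ {mult H b₀ r} (λ _ → single (toℕ b₀) r (suc i) r)
        ≡⟨ cong (λ x → ∑ {mult H b₀ r} (λ _ → x))
             (trans (cong (λ j → single j r (suc i) r) b₀≡i) (single-yes i r)) ⟩
      ∑ {mult H b₀ r} (λ _ → 1)
        ≡⟨ ∑-one _ ⟩
      mult H b₀ r ∎
      where
      open ≡-Reasoning
      b₀ = fromℕ< i<m
      b₀≡i : toℕ b₀ ≡ i
      b₀≡i = Fin.toℕ-fromℕ< i<m

realization : ∀ {d} (H : State d) → Realization H
realization H with realizable-∑ (λ b → realizable-∑ λ s → realizable-∑ {n = mult H b s} λ _ →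
                     cycleLabeling (toℕ b) s , cycle-realizes (toℕ b) s)
... | L , R = L , λ a r → subst (HasCardinality (IsCycleOf L a r)) (total-entry H a r) (R a r)

Φ : ∀ {d} → State d → ℕ
Φ H = length (completions (proj₁ (realization H)))

{-# OPTIONS --safe #-}

-- Let the cycles of a labeling be C₁, …, Cₙ with base points. An invariant
-- graph is given by its sets of differences: on a cycle of length a a subset of
-- ℤ/a ∖ {0} closed under negation, between cycles of lengths a and b a subset of
-- ℤ/gcd(a,b), all chosen independently. A difference set of size k between them
-- contributes k b/gcd(a,b) and k a/gcd(a,b) to the degrees, so the number of
-- completions is a count of independent choices subject to one linear equation
-- per cycle. It depends only on the list of pairs (length, degree), in any
-- order; in particular not on the realization. Putting the pivot first and
-- summing over its choices leaves the same count for the other cycles with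
-- residual degrees, where cycles of residual degree 0 may be omitted. Grouping
-- the choices of k on equal cycles by their multiplicities ν gives multinomial
-- coefficients and thereby the recurrence.

module Submission where

open import Data.Bool.Base using (Bool; true; false; if_then_else_)
open import Data.Fin.Base using (Fin; zero; suc; toℕ; fromℕ<; opposite)
import Data.Fin.Properties as Fin
open import Data.Fin.Permutation using (Permutation′; _⟨$⟩ʳ_; reverse)
import Data.Fin.Permutation as Perm
open import Data.Fin.Subset using (Subset; ∣_∣) renaming (_∈_ to _∈ₛ_)
open import Data.Fin.Subset.Properties using (⊆-antisym)
open import Data.List.Base as List
  using (List; []; _∷_; map; concatMap; filter; length; _++_; cartesianProduct; cartesianProductWith; upTo; drop)
open import Data.List.Properties using (map-cong; map-∘; map-++; upTo-∷ʳ; length-++; length-drop)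
import Data.List.Membership.Propositional as List
open import Data.List.Membership.Propositional.Properties
  using (∈-∃++; ∈-++⁺ˡ; ∈-++⁺ʳ; ∈-++⁻; ∈-map⁺; ∈-concatMap⁺; ∈-filter⁺; ∈-filter⁻; ∈-cartesianProductWith⁺;
      ∈-cartesianProduct⁺)
open import Data.List.Relation.Unary.All as All using ([]; _∷_)
import Data.List.Relation.Unary.All.Properties as All
open import Data.List.Relation.Unary.AllPairs as AllPairs using (AllPairs; []; _∷_)
import Data.List.Relation.Unary.AllPairs.Properties as AllPairs
open import Data.List.Relation.Unary.Any using (here; there)
import Data.List.Relation.Unary.Any as Any
open import Data.List.Relation.Unary.Unique.Propositional using (Unique)
import Data.List.Relation.Unary.Unique.Propositional.Properties as Unique
open import Data.Nat.Base
open import Data.Nat.Combinatorics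
  using (_C_; nCk+nC[k+1]≡[n+1]C[k+1]; k>n⇒nCk≡0; nCk≡n!/k![n-k]!; k![n∸k]!∣n!)
open import Data.Nat.Divisibility
  using (_∣_; _∣?_; divides; m%n≡0⇒n∣m; ∣-refl; ∣m∣n⇒∣m+n; ∣m+n∣m⇒∣n)
open import Data.Nat.DivMod
open import Data.Nat.GCD
  using (gcd; gcd[m,n]∣m; gcd[m,n]∣n; gcd-GCD; gcd-comm; module Bézout; m/gcd[m,n]≢0; n/gcd[m,n]≢0)
open import Data.Nat.GeneralisedArithmetic using (iterate)
open import Data.Nat.Induction using (<-wellFounded)
open import Data.Nat.ListAction using (sum)
open import Data.Nat.ListAction.Properties using (sum-++)
open import Data.Nat.Properties as ℕ using (_≟_; _≤?_; _<?_; ≤-trans; _!≢0; m*n≢0)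
open import Data.Nat.Tactic.RingSolver using (solve-∀)
open import Data.Product.Base using (∃; _×_; _,_; proj₁; proj₂)
open import Data.Sum.Base using (_⊎_; inj₁; inj₂)
open import Data.Unit.Base using (tt) renaming (⊤ to Unit)
open import Data.Vec.Base as Vec using (Vec; []; _∷_; lookup; tabulate; zipWith; replicate)
open import Data.Vec.Properties
  using (≡-dec; ∷-injective; lookup-map; lookup-zipWith; lookup∘tabulate; tabulate∘lookup; tabulate-cong;
      lookup⇒[]=; []=⇒lookup)
open import Function.Base using (_∘_; id; flip; case_of_)
open import Function.Bundles using (_⇔_; mk⇔; Equivalence)
open import Induction.WellFounded using (Acc; acc)
open import Relation.Binary.Core using (Rel)
open import Relation.Binary.Definitions using (tri<; tri≈; tri>)
open import Relation.Binary.PropositionalEquality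
open import Relation.Nullary using (¬_; Dec; yes; no; does)
open import Relation.Nullary.Decidable using (_×-dec_; dec-true; dec-false)
open import Relation.Nullary.Negation using (contradiction)
open import Algebra.Properties.CommutativeMonoid.Sum ℕ.+-0-commutativeMonoid
  using (sum-cong-≗; ∑-comm; ∑-distrib-+; sum-permute)
open import Algebra.Properties.CommutativeMonoid.Sum ℕ.*-1-commutativeMonoid
  using () renaming (sum-cong-≗ to ∏-cong; ∑-distrib-+ to ∏-distrib-*)
open import Algebra.Properties.Semiring.Sum ℕ.+-*-semiring using (*-distribˡ-sum)
open import Defs

open ≡-Reasoning

-- Graphs, allocations and states are built from functions, and functions that agree pointwise need
-- not be equal terms. Lists of graphs are therefore compared through a relation to codes, which are
-- built from vectors, and functionals on allocations are compared only on functions that respect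
-- pointwise equality. Independence of the order of the cycles is not obtained by permuting the
-- entries of `count`. Every listing of the cycles of every realization yields `Coordinates`, so one
-- number of completions equals `count` for each listing, and the listing that starts with the pivot
-- may be chosen. `count` admits degree 0, which a state cannot express. Residual degrees thus keep
-- the same form until the zeros are omitted. That the recurrence counts each completion once is
-- expressed by uniqueness: its values are forced, because every allocation leads to a state with
-- fewer cycles.

private variable
  A B : Set
  Q : Set

-- Indicators and finite sums

𝟙 : Dec Q → ℕ
𝟙 q? = if does q? then 1 else 0

𝟙-yes : (q? : Dec Q) → Q → 𝟙 q? ≡ 1
𝟙-yes q? q = cong (if_then 1 else 0) (dec-true q? q)

𝟙-no : (q? : Dec Q) → ¬ Q → 𝟙 q? ≡ 0
𝟙-no q? ¬q = cong (if_then 1 else 0) (dec-false q? ¬q)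

𝟙-cong : {Q′ : Set} (q? : Dec Q) (q′? : Dec Q′) → (Q → Q′) → (Q′ → Q) → 𝟙 q? ≡ 𝟙 q′?
𝟙-cong (yes q) q′? f g = sym (𝟙-yes q′? (f q))
𝟙-cong (no ¬q) q′? f g = sym (𝟙-no q′? (¬q ∘ g))

bit : Bool → ℕ
bit b = if b then 1 else 0

∑-zero : ∀ {n} (f : Fin n → ℕ) → (∀ i → f i ≡ 0) → ∑ f ≡ 0
∑-zero {zero}  f f≡0 = refl
∑-zero {suc n} f f≡0 = cong₂ _+_ (f≡0 zero) (∑-zero (f ∘ suc) (f≡0 ∘ suc))

∑-constant : ∀ n c → ∑ {n} (λ _ → c) ≡ n * c
∑-constant zero    c = refl
∑-constant (suc n) c = cong (c +_) (∑-constant n c)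

∑-only : ∀ {n} (f : Fin n → ℕ) i → (∀ j → j ≢ i → f j ≡ 0) → ∑ f ≡ f i
∑-only f zero    f≡0 =
  trans (cong (f zero +_) (∑-zero (f ∘ suc) (λ j → f≡0 (suc j) λ ()))) (ℕ.+-identityʳ _)
∑-only f (suc i) f≡0 =
  cong₂ _+_ (f≡0 zero λ ()) (∑-only (f ∘ suc) i λ j j≢i → f≡0 (suc j) (j≢i ∘ Fin.suc-injective))

∑-truncate : ∀ {m n} (f : ℕ → ℕ) → m ≤ n → (∀ k → m ≤ k → f k ≡ 0) →
             ∑ {n} (f ∘ toℕ) ≡ ∑ {m} (f ∘ toℕ)
∑-truncate {n = n} f z≤n       f≡0 = ∑-zero {n} (f ∘ toℕ) (λ k → f≡0 (toℕ k) z≤n)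
∑-truncate         f (s≤s m≤n) f≡0 =
  cong (f 0 +_) (∑-truncate (f ∘ suc) m≤n (λ k → f≡0 (suc k) ∘ s≤s))

∑-++ : ∀ m n (f : ℕ → ℕ) → ∑ {m + n} (f ∘ toℕ) ≡ ∑ {m} (f ∘ toℕ) + ∑ {n} (f ∘ (m +_) ∘ toℕ)
∑-++ zero    n f = refl
∑-++ (suc m) n f = trans (cong (f 0 +_) (∑-++ m n (f ∘ suc))) (sym (ℕ.+-assoc (f 0) _ _))

∑-last : ∀ n (f : ℕ → ℕ) → ∑ {suc n} (f ∘ toℕ) ≡ ∑ {n} (f ∘ toℕ) + f n
∑-last zero    f = ℕ.+-comm (f 0) 0
∑-last (suc n) f = trans (cong (f 0 +_) (∑-last n (f ∘ suc))) (sym (ℕ.+-assoc (f 0) _ _))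

module _ (f : ℕ → ℕ) (g : ℕ) (periodic : ∀ z → f (g + z) ≡ f z) where

  -- Moving the window of length `g` by one place loses `f c` and gains `f (c + g)`, which are
  -- equal.
  ∑-shift : ∀ c → ∑ {g} (λ z → f (c + toℕ z)) ≡ ∑ {g} (f ∘ toℕ)
  ∑-shift zero    = refl
  ∑-shift (suc c) = trans (ℕ.+-cancelˡ-≡ (f c) _ _ eq) (∑-shift c)
    where
    eq : f c + ∑ {g} (λ z → f (suc c + toℕ z)) ≡ f c + ∑ {g} (λ z → f (c + toℕ z))
    eq = begin
      f c + ∑ {g} (λ z → f (suc c + toℕ z))
        ≡⟨ cong₂ _+_ (cong f (ℕ.+-identityʳ c)) (sum-cong-≗ {g} (λ z → cong f (ℕ.+-suc c (toℕ z)))) ⟨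
      ∑ {suc g} (λ z → f (c + toℕ z))
        ≡⟨ ∑-last g (λ z → f (c + z)) ⟩
      ∑ {g} (λ z → f (c + toℕ z)) + f (c + g)
        ≡⟨ ℕ.+-comm _ (f (c + g)) ⟩
      f (c + g) + ∑ {g} (λ z → f (c + toℕ z))
        ≡⟨ cong₂ _+_ (trans (cong f (ℕ.+-comm c g)) (periodic c)) refl ⟩
      f c + ∑ {g} (λ z → f (c + toℕ z)) ∎

  ∑-periods : ∀ m c → ∑ {m * g} (λ z → f (c + toℕ z)) ≡ m * ∑ {g} (f ∘ toℕ)
  ∑-periods zero    c = refl
  ∑-periods (suc m) c = begin
    ∑ {g + m * g} (λ z → f (c + toℕ z))
      ≡⟨ ∑-++ g (m * g) (λ z → f (c + z)) ⟩
    ∑ {g} (λ z → f (c + toℕ z)) + ∑ {m * g} (λ z → f (c + (g + toℕ z)))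
      ≡⟨ cong₂ _+_ (∑-shift c) (sum-cong-≗ {m * g} (λ z → cong f (sym (ℕ.+-assoc c g (toℕ z))))) ⟩
    ∑ {g} (f ∘ toℕ) + ∑ {m * g} (λ z → f (c + g + toℕ z))
      ≡⟨ cong (∑ {g} (f ∘ toℕ) +_) (∑-periods m (c + g)) ⟩
    ∑ {g} (f ∘ toℕ) + m * ∑ {g} (f ∘ toℕ) ∎

  periodic* : ∀ k z → f (k * g + z) ≡ f z
  periodic* zero    z = refl
  periodic* (suc k) z =
    trans (cong f (ℕ.+-assoc g (k * g) z)) (trans (periodic (k * g + z)) (periodic* k z))

∑-opposite : ∀ n (f : Fin n → ℕ) → ∑ (f ∘ opposite) ≡ ∑ f
∑-opposite n f = sym (sum-permute f reverse)

-- Modulo p + 1 the factor p is −1, so the sum runs over the periods backwards.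
∑-periods-backwards :
  ∀ (f : ℕ → ℕ) p → (∀ z → f (suc p + z) ≡ f z) → ∀ m c →
  ∑ {m * suc p} (λ y → f (c + toℕ y * p)) ≡ m * ∑ {suc p} (f ∘ toℕ)
∑-periods-backwards f p periodic m c = begin
  ∑ {m * suc p} (λ y → f (c + toℕ y * p))
    ≡⟨ ∑-periods (λ y → f (c + y * p)) (suc p) per m 0 ⟩
  m * ∑ {suc p} (λ y → f (c + toℕ y * p))
    ≡⟨ cong (m *_) (∑-opposite (suc p) (λ y → f (c + toℕ y * p))) ⟨
  m * ∑ {suc p} (λ y → f (c + toℕ (opposite y) * p))
    ≡⟨ cong (m *_) (sum-cong-≗ {suc p} backwards) ⟩
  m * ∑ {suc p} (λ y → f (suc c + toℕ y))
    ≡⟨ cong (m *_) (∑-shift f (suc p) periodic (suc c)) ⟩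
  m * ∑ {suc p} (f ∘ toℕ) ∎
  where
  per : ∀ z → f (c + (suc p + z) * p) ≡ f (c + z * p)
  per z = trans (cong f (eq c p z)) (periodic* f (suc p) periodic p (c + z * p))
    where
    eq : ∀ c p z → c + (suc p + z) * p ≡ p * suc p + (c + z * p)
    eq = solve-∀
  -- With `t = p ∸ y`, the product `t * p` is -t, which is `y + 1` modulo `suc p`. One period is
  -- added on the left so that the identity needs no subtraction.
  backwards : ∀ (y : Fin (suc p)) → f (c + toℕ (opposite y) * p) ≡ f (suc c + toℕ y)
  backwards y = begin
    f (c + toℕ (opposite y) * p)
      ≡⟨ cong₂ (λ t p → f (c + t * p)) (Fin.opposite-prop y) (sym p≡) ⟩
    f (c + t * (toℕ y + t))
      ≡⟨ periodic _ ⟨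
    f (suc p + (c + t * (toℕ y + t)))
      ≡⟨ cong f (subst (λ p → suc p + (c + t * (toℕ y + t)) ≡ t * suc p + (suc c + toℕ y))
           p≡ (eq c (toℕ y) t)) ⟩
    f (t * suc p + (suc c + toℕ y))
      ≡⟨ periodic* f (suc p) periodic t _ ⟩
    f (suc c + toℕ y) ∎
    where
    t = p ∸ toℕ y
    p≡ : toℕ y + t ≡ p
    p≡ = ℕ.m+[n∸m]≡n (Fin.toℕ≤pred[n] y)
    eq : ∀ c y t → suc (y + t) + (c + t * (y + t)) ≡ t * suc (y + t) + (suc c + y)
    eq = solve-∀

-- Sums over lists

∑ᴸ : List A → (A → ℕ) → ℕ
∑ᴸ xs f = sum (map f xs)

∑ᴸ-cong : ∀ (xs : List A) {f g : A → ℕ} → f ≗ g → ∑ᴸ xs f ≡ ∑ᴸ xs g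
∑ᴸ-cong xs f≗g = cong sum (map-cong f≗g xs)

∑ᴸ-++ : ∀ (xs ys : List A) f → ∑ᴸ (xs ++ ys) f ≡ ∑ᴸ xs f + ∑ᴸ ys f
∑ᴸ-++ xs ys f = trans (cong sum (map-++ f xs ys)) (sum-++ (map f xs) (map f ys))

∑ᴸ-map : ∀ (k : A → B) xs f → ∑ᴸ (map k xs) f ≡ ∑ᴸ xs (f ∘ k)
∑ᴸ-map k xs f = cong sum (sym (map-∘ xs))

∑ᴸ-concatMap : ∀ (k : A → List B) xs f → ∑ᴸ (concatMap k xs) f ≡ ∑ᴸ xs (λ x → ∑ᴸ (k x) f)
∑ᴸ-concatMap k []       f = refl
∑ᴸ-concatMap k (x ∷ xs) f =
  trans (∑ᴸ-++ (k x) (concatMap k xs) f) (cong (∑ᴸ (k x) f +_) (∑ᴸ-concatMap k xs f))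

∑ᴸ-cartesianProduct : ∀ (xs : List A) (ys : List B) f →
  ∑ᴸ (cartesianProduct xs ys) f ≡ ∑ᴸ xs (λ x → ∑ᴸ ys (λ y → f (x , y)))
∑ᴸ-cartesianProduct []       ys f = refl
∑ᴸ-cartesianProduct (x ∷ xs) ys f =
  trans (∑ᴸ-++ (map (x ,_) ys) (cartesianProduct xs ys) f)
    (cong₂ _+_ (∑ᴸ-map (x ,_) ys f) (∑ᴸ-cartesianProduct xs ys f))

∑ᴸ-*ˡ : ∀ c (xs : List A) f → ∑ᴸ xs (λ x → c * f x) ≡ c * ∑ᴸ xs f
∑ᴸ-*ˡ c []       f = sym (ℕ.*-zeroʳ c)
∑ᴸ-*ˡ c (x ∷ xs) f = trans (cong (c * f x +_) (∑ᴸ-*ˡ c xs f)) (sym (ℕ.*-distribˡ-+ c (f x) _))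

∑ᴸ-∑-comm : ∀ {n} (xs : List A) (f : A → Fin n → ℕ) →
            ∑ᴸ xs (λ x → ∑ (f x)) ≡ ∑ (λ i → ∑ᴸ xs (λ x → f x i))
∑ᴸ-∑-comm {n = n} []       f = sym (∑-zero {n} _ (λ _ → refl))
∑ᴸ-∑-comm         (x ∷ xs) f =
  trans (cong (∑ (f x) +_) (∑ᴸ-∑-comm xs f)) (sym (∑-distrib-+ (f x) _))

∑ᴸ-filter : ∀ {P : A → Set} (P? : ∀ x → Dec (P x)) xs f →
            ∑ᴸ (filter P? xs) f ≡ ∑ᴸ xs (λ x → 𝟙 (P? x) * f x)
∑ᴸ-filter P? []       f = refl
∑ᴸ-filter P? (x ∷ xs) f with P? x
... | yes _ = cong₂ _+_ (sym (ℕ.*-identityˡ (f x))) (∑ᴸ-filter P? xs f)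
... | no  _ = ∑ᴸ-filter P? xs f

length-filter : ∀ {P : A → Set} (P? : ∀ x → Dec (P x)) xs →
                length (filter P? xs) ≡ ∑ᴸ xs (λ x → 𝟙 (P? x))
length-filter P? []       = refl
length-filter P? (x ∷ xs) with P? x
... | yes _ = cong suc (length-filter P? xs)
... | no  _ = length-filter P? xs

∑ᴸ-upTo : ∀ n f → ∑ᴸ (upTo n) f ≡ ∑ {n} (f ∘ toℕ)
∑ᴸ-upTo zero    f = refl
∑ᴸ-upTo (suc n) f = begin
  ∑ᴸ (upTo (suc n)) f            ≡⟨ cong (λ xs → ∑ᴸ xs f) (upTo-∷ʳ n) ⟨
  ∑ᴸ (upTo n ++ n ∷ []) f        ≡⟨ ∑ᴸ-++ (upTo n) (n ∷ []) f ⟩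
  ∑ᴸ (upTo n) f + (f n + 0)      ≡⟨ cong₂ _+_ (∑ᴸ-upTo n f) (ℕ.+-identityʳ (f n)) ⟩
  ∑ {n} (f ∘ toℕ) + f n          ≡⟨ ∑-last n f ⟨
  ∑ {suc n} (f ∘ toℕ)            ∎

-- Invariant graphs on disjoint cycles

-- The residue of x − y modulo g.
diff : (g : ℕ) .{{_ : NonZero g}} → ℕ → ℕ → ℕ
diff g x y = (x + y * pred g) % g

diff-diag : ∀ g .{{_ : NonZero g}} x y → diff g (suc x) (suc y) ≡ diff g x y
diff-diag g@(suc p) x y =
  trans (cong (_% g) (eq p x y)) ([m+n]%n≡m%n (x + y * p) g)
  where
  eq : ∀ p x y → suc x + suc y * p ≡ x + y * p + suc p
  eq = solve-∀

diff-+ˡ : ∀ g .{{_ : NonZero g}} {a} → g ∣ a → ∀ x y → diff g (a + x) y ≡ diff g x y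
diff-+ˡ g {a} g∣a x y =
  trans (cong (_% g) (ℕ.+-assoc a x _)) (%-remove-+ˡ (x + y * pred g) g∣a)

diff-+ʳ : ∀ g .{{_ : NonZero g}} {a} → g ∣ a → ∀ x y → diff g x (a + y) ≡ diff g x y
diff-+ʳ g@(suc p) (divides k refl) x y =
  trans (cong (_% g) (eq p k x y)) ([m+kn]%n≡m%n (x + y * p) (k * p) g)
  where
  eq : ∀ p k x y → x + (k * suc p + y) * p ≡ x + y * p + k * p * suc p
  eq = solve-∀

diff-< : ∀ g .{{_ : NonZero g}} x y → diff g x y < g
diff-< g x y = m%n<n _ g

diff-0 : ∀ g .{{_ : NonZero g}} {x} → x < g → diff g x 0 ≡ x
diff-0 g x<g = trans (cong (_% g) (ℕ.+-identityʳ _)) (m<n⇒m%n≡m x<g)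

diff-self : ∀ g .{{_ : NonZero g}} x → diff g x x ≡ 0
diff-self g@(suc p) x = trans (cong (_% g) (sym (ℕ.*-suc x p))) (m*n%n≡0 x g)

-- Both residues are below `g` and their sum is divisible by `g`, which leaves only the sums 0 and
-- `g`.
diff-opposite : ∀ g .{{_ : NonZero g}} x y →
                (diff g x y ≡ 0 × diff g y x ≡ 0) ⊎ diff g x y + diff g y x ≡ g
diff-opposite g@(suc p) x y = go (m%n≡0⇒n∣m (diff g x y + diff g y x) g (begin
  (diff g x y + diff g y x) % g      ≡⟨ %-distribˡ-+ (x + y * p) (y + x * p) g ⟨
  (x + y * p + (y + x * p)) % g      ≡⟨ cong (_% g) (rearrange p x y) ⟩
  (x + y) * g % g                    ≡⟨ m*n%n≡0 (x + y) g ⟩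
  0                                  ∎))
  where
  rearrange : ∀ p x y → x + y * p + (y + x * p) ≡ (x + y) * suc p
  rearrange = solve-∀
  go : g ∣ diff g x y + diff g y x →
       (diff g x y ≡ 0 × diff g y x ≡ 0) ⊎ diff g x y + diff g y x ≡ g
  go (divides 0 eq) = inj₁ (ℕ.m+n≡0⇒m≡0 _ eq , ℕ.m+n≡0⇒n≡0 (diff g x y) eq)
  go (divides 1 eq) = inj₂ (trans eq (ℕ.+-identityʳ g))
  go (divides (suc (suc k)) eq) with () ← ℕ.<⇒≱ (ℕ.+-mono-< (diff-< g x y) (diff-< g y x))
    (subst (g + g ≤_) (sym eq) (ℕ.+-monoʳ-≤ g (ℕ.m≤m+n g (k * g))))

module _ (f : ℕ → ℕ) (g : ℕ) .{{_ : NonZero g}} where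

  private
    f% : ∑ {g} (λ z → f (toℕ z % g)) ≡ ∑ {g} (f ∘ toℕ)
    f% = sum-cong-≗ {g} (λ z → cong f (m<n⇒m%n≡m (Fin.toℕ<n z)))

    periodic : ∀ z → f ((g + z) % g) ≡ f (z % g)
    periodic z = cong f (%-remove-+ˡ z ∣-refl)

  ∑-diffˡ : ∀ m {n} → m * g ≡ n → ∀ y → ∑ {n} (λ x → f (diff g (toℕ x) y)) ≡ m * ∑ {g} (f ∘ toℕ)
  ∑-diffˡ m refl y = begin
    ∑ {m * g} (λ x → f (diff g (toℕ x) y))
      ≡⟨ sum-cong-≗ {m * g} (λ x → cong (λ t → f (t % g)) (ℕ.+-comm (toℕ x) _)) ⟩
    ∑ {m * g} (λ x → f ((y * pred g + toℕ x) % g))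
      ≡⟨ ∑-periods (λ z → f (z % g)) g periodic m (y * pred g) ⟩
    m * ∑ {g} (λ z → f (toℕ z % g))
      ≡⟨ cong (m *_) f% ⟩
    m * ∑ {g} (f ∘ toℕ) ∎

∑-diffʳ : ∀ f g .{{_ : NonZero g}} m {n} → m * g ≡ n → ∀ x →
          ∑ {n} (λ y → f (diff g x (toℕ y))) ≡ m * ∑ {g} (f ∘ toℕ)
∑-diffʳ f g@(suc p) m refl x =
  trans (∑-periods-backwards (λ z → f (z % g)) p (λ z → cong f (%-remove-+ˡ z ∣-refl)) m x)
        (cong (m *_) (sum-cong-≗ {g} (λ z → cong f (m<n⇒m%n≡m (Fin.toℕ<n z)))))

module _ {A : Set} (G : ℕ → ℕ → A) (diag : ∀ x y → G (suc x) (suc y) ≡ G x y) where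

  diag* : ∀ k x y → G (k + x) (k + y) ≡ G x y
  diag* zero    x y = refl
  diag* (suc k) x y = trans (diag _ _) (diag* k x y)

periodˡ* : ∀ {A : Set} (G : ℕ → ℕ → A) a → (∀ x y → G (a + x) y ≡ G x y) →
           ∀ k x y → G (k * a + x) y ≡ G x y
periodˡ* G a per zero    x y = refl
periodˡ* G a per (suc k) x y =
  trans (cong (λ t → G t y) (ℕ.+-assoc a (k * a) x)) (trans (per _ y) (periodˡ* G a per k x y))

module _ {A : Set} (G : ℕ → ℕ → A) (diag : ∀ x y → G (suc x) (suc y) ≡ G x y)
         (a b : ℕ) (perˡ : ∀ x y → G (a + x) y ≡ G x y) (perʳ : ∀ x y → G x (b + y) ≡ G x y) where

  -- Bézout: the gcd is a difference of multiples of `a` and `b`. Multiples of `a` are absorbed by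
  -- the first argument; a multiple of `b` is moved along the diagonal and absorbed by the second.
  gcd-periodˡ : ∀ x y → G (gcd a b + x) y ≡ G x y
  gcd-periodˡ x y with Bézout.identity (gcd-GCD a b)
  ... | Bézout.+- k l eq = begin
    G (g + x) y                   ≡⟨ diag* G diag (l * b) (g + x) y ⟨
    G (l * b + (g + x)) (l * b + y) ≡⟨ periodˡ* (flip G) b (flip perʳ) l y _ ⟩
    G (l * b + (g + x)) y         ≡⟨ cong (λ t → G t y) (trans (shuffle (l * b) g x) (cong (_+ x) eq)) ⟩
    G (k * a + x) y               ≡⟨ periodˡ* G a perˡ k x y ⟩
    G x y                         ∎
    where
    g = gcd a b
    shuffle : ∀ m g x → m + (g + x) ≡ g + m + x
    shuffle = solve-∀
  ... | Bézout.-+ k l eq = begin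
    G (g + x) y                   ≡⟨ periodˡ* G a perˡ k (g + x) y ⟨
    G (k * a + (g + x)) y         ≡⟨ cong (λ t → G t y) (trans (shuffle (k * a) g x) (cong (_+ x) eq)) ⟩
    G (l * b + x) y               ≡⟨ periodˡ* (flip G) b (flip perʳ) l y _ ⟨
    G (l * b + x) (l * b + y)     ≡⟨ diag* G diag (l * b) x y ⟩
    G x y                         ∎
    where
    g = gcd a b
    shuffle : ∀ m g x → m + (g + x) ≡ g + m + x
    shuffle = solve-∀

module _ {A : Set} (G : ℕ → ℕ → A) (diag : ∀ x y → G (suc x) (suc y) ≡ G x y)
         (g : ℕ) .{{_ : NonZero g}}
         (perˡ : ∀ x y → G (g + x) y ≡ G x y) (perʳ : ∀ x y → G x (g + y) ≡ G x y) where

  -- A shift of both arguments by `y * pred g` turns `y` into the multiple `y * g` of the period and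
  -- `x` into the number whose residue is `diff g x y`.
  by-diff : ∀ x y → G x y ≡ G (diff g x y) 0
  by-diff x y = begin
    G x y
      ≡⟨ diag* G diag (y * pred g) x y ⟨
    G (y * pred g + x) (y * pred g + y)
      ≡⟨ cong₂ G (ℕ.+-comm (y * pred g) x)
           (trans (sym (trans (cong (y *_) (sym (ℕ.suc-pred g))) (trans (ℕ.*-suc y (pred g)) (ℕ.+-comm y _))))
                  (sym (ℕ.+-identityʳ (y * g)))) ⟩
    G (x + y * pred g) (y * g + 0)
      ≡⟨ periodˡ* (flip G) g (flip perʳ) y 0 _ ⟩
    G (x + y * pred g) 0
      ≡⟨ cong (λ t → G t 0) (trans (m≡m%n+[m/n]*n (x + y * pred g) g) (ℕ.+-comm (diff g x y) _)) ⟩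
    G (((x + y * pred g) / g) * g + diff g x y) 0
      ≡⟨ periodˡ* G g perˡ ((x + y * pred g) / g) (diff g x y) 0 ⟩
    G (diff g x y) 0 ∎

nth : ∀ {n} → Vec Bool n → ℕ → Bool
nth []       z       = false
nth (x ∷ xs) zero    = x
nth (x ∷ xs) (suc z) = nth xs z

nth-tabulate : ∀ {n} (f : ℕ → Bool) {z} → z < n → nth {n} (tabulate (f ∘ toℕ)) z ≡ f z
nth-tabulate f {zero}  (s≤s z<n) = refl
nth-tabulate f {suc z} (s≤s z<n) = nth-tabulate (f ∘ suc) z<n

nth-injective : ∀ {n} (xs ys : Vec Bool n) → (∀ z → z < n → nth xs z ≡ nth ys z) → xs ≡ ys
nth-injective []       []       eq = refl
nth-injective (x ∷ xs) (y ∷ ys) eq =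
  cong₂ _∷_ (eq 0 z<s) (nth-injective xs ys (λ z z<n → eq (suc z) (s≤s z<n)))

∥_∥ : ∀ {n} → Vec Bool n → ℕ
∥_∥ {n} xs = ∑ {n} (λ z → bit (nth xs (toℕ z)))

-- Cycle lengths are stored as predecessors, so that positivity is built in and the gcd is nonzero
-- without a hypothesis.
gcd⁺ : ℕ → ℕ → ℕ
gcd⁺ p q = gcd (suc p) (suc q)

gcd⁺≢0 : ∀ p q → NonZero (gcd⁺ p q)
gcd⁺≢0 p q = gcd-nonZero {suc p} {suc q}

diff⁺ : (p q : ℕ) → ℕ → ℕ → ℕ
diff⁺ p q = diff (gcd⁺ p q) {{gcd⁺≢0 p q}}

-- A cycle of length p + 1 carries a set of differences closed under negation,
-- hence determined by its elements up to (p + 1) / 2, and a pair of cycles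
-- carries a set of differences modulo the gcd of the lengths. In adjacent the
-- arguments x and y number the points of the cycles i and j.

Loop : ℕ → Set
Loop p = Vec Bool ⌊ suc p /2⌋

Links : ∀ {n} → ℕ → Vec ℕ n → Set
Links p []       = Unit
Links p (q ∷ qs) = Vec Bool (gcd⁺ p q) × Links p qs

Code : ∀ {n} → Vec ℕ n → Set
Code []       = Unit
Code (p ∷ ps) = Loop p × Links p ps × Code ps

-- For a residue `z` this is the representative of the class of z and -z modulo `suc p` that is at
-- most half of `suc p`.
fold : ℕ → ℕ → ℕ
fold p z = z ⊓ (suc p ∸ z)

-- The prepended `false` stands for the difference 0 and excludes loops at a vertex; the entry `z`
-- of `xs` belongs to the difference `suc z`.
loop : ∀ {p} → Loop p → ℕ → Bool
loop {p} xs z = nth (false ∷ xs) (fold p z)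

link : ∀ {n p} (qs : Vec ℕ n) → Links p qs → ∀ j → Vec Bool (gcd⁺ p (lookup qs j))
link (q ∷ qs) (B , Bs) zero    = B
link (q ∷ qs) (B , Bs) (suc j) = link qs Bs j

adjacent : ∀ {n} (ps : Vec ℕ n) → Code ps → (i j : Fin n) → ℕ → ℕ → Bool
adjacent (p ∷ ps) (xs , Bs , c) zero    zero    x y = loop xs (diff (suc p) x y)
adjacent (p ∷ ps) (xs , Bs , c) zero    (suc j) x y = nth (link ps Bs j) (diff⁺ p (lookup ps j) x y)
adjacent (p ∷ ps) (xs , Bs , c) (suc i) zero    x y = nth (link ps Bs i) (diff⁺ p (lookup ps i) y x)
adjacent (p ∷ ps) (xs , Bs , c) (suc i) (suc j) x y = adjacent ps c i j x y

-- Points of a cycle are numbered by all of ℕ subject to periodicity, so that applying the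
-- permutation is always `suc` and never wraps around.
record IsInvariant {n} (ps : Vec ℕ n) (G : (i j : Fin n) → ℕ → ℕ → Bool) : Set where
  field
    symmetric   : ∀ i j x y → G i j x y ≡ G j i y x
    irreflexive : ∀ i x → G i i x x ≡ false
    diagonal    : ∀ i j x y → G i j (suc x) (suc y) ≡ G i j x y
    periodicˡ   : ∀ i j x y → G i j (suc (lookup ps i) + x) y ≡ G i j x y

  periodicʳ : ∀ i j x y → G i j x (suc (lookup ps j) + y) ≡ G i j x y
  periodicʳ i j x y = trans (symmetric i j _ _) (trans (periodicˡ j i y x) (symmetric j i y x))

open IsInvariant

fold-complement : ∀ p {z} → z ≤ suc p → fold p (suc p ∸ z) ≡ fold p z
fold-complement p {z} z≤ =
  trans (cong ((suc p ∸ z) ⊓_) (ℕ.m∸[m∸n]≡n z≤)) (ℕ.⊓-comm (suc p ∸ z) z)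

fold-diff-comm : ∀ p x y → fold p (diff (suc p) x y) ≡ fold p (diff (suc p) y x)
fold-diff-comm p x y with diff-opposite (suc p) x y
... | inj₁ (e , e′) = cong (fold p) (trans e (sym e′))
... | inj₂ e = trans (sym (fold-complement p (ℕ.<⇒≤ (diff-< (suc p) x y))))
  (cong (fold p) (trans (cong (_∸ diff (suc p) x y) (sym e)) (ℕ.m+n∸m≡n (diff (suc p) x y) _)))

fold-≤ : ∀ p z → fold p z ≤ ⌊ suc p /2⌋
fold-≤ p z = subst (_≤ ⌊ suc p /2⌋) (sym (ℕ.n≡⌊n+n/2⌋ (fold p z))) (ℕ.⌊n/2⌋-mono twice)
  where
  twice : fold p z + fold p z ≤ suc p
  twice with ℕ.≤-total z (suc p)
  ... | inj₁ z≤ = ≤-trans (ℕ.+-mono-≤ (ℕ.m⊓n≤m z _) (ℕ.m⊓n≤n z _)) (ℕ.≤-reflexive (ℕ.m+[n∸m]≡n z≤))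
  ... | inj₂ ≥z rewrite ℕ.m≤n⇒m∸n≡0 ≥z | ℕ.⊓-zeroʳ z = z≤n

fold-small : ∀ p {z} → z ≤ ⌊ suc p /2⌋ → fold p z ≡ z
fold-small p {z} z≤ = ℕ.m≤n⇒m⊓n≡m (ℕ.m+n≤o⇒m≤o∸n z (≤-trans (ℕ.+-mono-≤ z≤ z≤)
  (≤-trans (ℕ.+-monoʳ-≤ ⌊ suc p /2⌋ (ℕ.⌊n/2⌋≤⌈n/2⌉ (suc p))) (ℕ.≤-reflexive (ℕ.⌊n/2⌋+⌈n/2⌉≡n (suc p))))))

adjacent-invariant : ∀ {n} (ps : Vec ℕ n) c → IsInvariant ps (adjacent ps c)
adjacent-invariant ps c .symmetric = go ps c
  where
  go : ∀ {n} (ps : Vec ℕ n) c i j x y → adjacent ps c i j x y ≡ adjacent ps c j i y x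
  go (p ∷ ps) (xs , Bs , c) zero    zero    x y = cong (nth (false ∷ xs)) (fold-diff-comm p x y)
  go (p ∷ ps) (xs , Bs , c) zero    (suc j) x y = refl
  go (p ∷ ps) (xs , Bs , c) (suc i) zero    x y = refl
  go (p ∷ ps) (xs , Bs , c) (suc i) (suc j) x y = go ps c i j x y
adjacent-invariant ps c .irreflexive = go ps c
  where
  go : ∀ {n} (ps : Vec ℕ n) c i x → adjacent ps c i i x x ≡ false
  go (p ∷ ps) (xs , Bs , c) zero    x = cong (loop xs) (diff-self (suc p) x)
  go (p ∷ ps) (xs , Bs , c) (suc i) x = go ps c i x
adjacent-invariant ps c .diagonal = go ps c
  where
  go : ∀ {n} (ps : Vec ℕ n) c i j x y → adjacent ps c i j (suc x) (suc y) ≡ adjacent ps c i j x y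
  go (p ∷ ps) (xs , Bs , c) zero    zero    x y = cong (loop xs) (diff-diag (suc p) x y)
  go (p ∷ ps) (xs , Bs , c) zero    (suc j) x y = cong (nth (link ps Bs j))
      (diff-diag (gcd⁺ p (lookup ps j)) {{gcd⁺≢0 p (lookup ps j)}} x y)
  go (p ∷ ps) (xs , Bs , c) (suc i) zero    x y = cong (nth (link ps Bs i))
      (diff-diag (gcd⁺ p (lookup ps i)) {{gcd⁺≢0 p (lookup ps i)}} y x)
  go (p ∷ ps) (xs , Bs , c) (suc i) (suc j) x y = go ps c i j x y
adjacent-invariant ps c .periodicˡ = go ps c
  where
  go : ∀ {n} (ps : Vec ℕ n) c i j x y → adjacent ps c i j (suc (lookup ps i) + x) y ≡ adjacent ps c i j x y
  go (p ∷ ps) (xs , Bs , c) zero zero    x y = cong (loop xs) (diff-+ˡ (suc p) ∣-refl x y)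
  go (p ∷ ps) (xs , Bs , c) zero (suc j) x y = cong (nth (link ps Bs j))
    (diff-+ˡ (gcd⁺ p (lookup ps j)) {{gcd⁺≢0 p (lookup ps j)}} (gcd[m,n]∣m (suc p) (suc (lookup ps j))) x y)
  go (p ∷ ps) (xs , Bs , c) (suc i) zero x y = cong (nth (link ps Bs i))
    (diff-+ʳ (gcd⁺ p (lookup ps i)) {{gcd⁺≢0 p (lookup ps i)}} (gcd[m,n]∣n (suc p) (suc (lookup ps i))) y x)
  go (p ∷ ps) (xs , Bs , c) (suc i) (suc j) x y = go ps c i j x y

links-injective : ∀ {n p} (qs : Vec ℕ n) (Bs Bs′ : Links p qs) →
                  (∀ j → link qs Bs j ≡ link qs Bs′ j) → Bs ≡ Bs′
links-injective []       _        _          eq = refl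
links-injective (q ∷ qs) (B , Bs) (B′ , Bs′) eq =
  cong₂ _,_ (eq zero) (links-injective qs Bs Bs′ (eq ∘ suc))

-- Every bit of the code can be read off at `y = 0`, at `x = suc z` for the bit `z` of a loop and at
-- `x = z` for a link.
adjacent-injective : ∀ {n} (ps : Vec ℕ n) c c′ →
                     (∀ i j x y → adjacent ps c i j x y ≡ adjacent ps c′ i j x y) → c ≡ c′
adjacent-injective []       _              _                 eq = refl
adjacent-injective (p ∷ ps) (xs , Bs , c) (xs′ , Bs′ , c′) eq = cong₂ _,_
  (nth-injective xs xs′ loops)
  (cong₂ _,_ (links-injective ps Bs Bs′ λ j → nth-injective _ _ (links j))
             (adjacent-injective ps c c′ (λ i j → eq (suc i) (suc j))))
  where
  loop-at : ∀ (xs : Loop p) z → z < ⌊ suc p /2⌋ → loop xs (diff (suc p) (suc z) 0) ≡ nth xs z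
  loop-at xs z z< = trans
    (cong (loop xs) (diff-0 (suc p) (≤-trans (s≤s z<) (ℕ.⌊n/2⌋<n p))))
    (cong (nth (false ∷ xs)) (fold-small p z<))
  loops : ∀ z → z < ⌊ suc p /2⌋ → nth xs z ≡ nth xs′ z
  loops z z< = trans (sym (loop-at xs z z<)) (trans (eq zero zero (suc z) 0) (loop-at xs′ z z<))
  links : ∀ j z → z < gcd⁺ p (lookup ps j) → nth (link ps Bs j) z ≡ nth (link ps Bs′ j) z
  links j z z< = begin
    nth (link ps Bs j) z                ≡⟨ cong (nth (link ps Bs j)) (diff-0 g {{g≢0}} z<) ⟨
    nth (link ps Bs j) (diff⁺ p (lookup ps j) z 0)     ≡⟨ eq zero (suc j) z 0 ⟩
    nth (link ps Bs′ j) (diff⁺ p (lookup ps j) z 0)    ≡⟨ cong (nth (link ps Bs′ j)) (diff-0 g {{g≢0}} z<) ⟩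
    nth (link ps Bs′ j) z               ∎
    where
    g = gcd⁺ p (lookup ps j)
    g≢0 = gcd⁺≢0 p (lookup ps j)

tabulateLinks : ∀ {n} p (qs : Vec ℕ n) → (Fin n → ℕ → Bool) → Links p qs
tabulateLinks p []       f = tt
tabulateLinks p (q ∷ qs) f = tabulate (f zero ∘ toℕ) , tabulateLinks p qs (f ∘ suc)

link-tabulate : ∀ {n} p (qs : Vec ℕ n) f j {z} → z < gcd⁺ p (lookup qs j) →
                nth (link qs (tabulateLinks p qs f) j) z ≡ f j z
link-tabulate p (q ∷ qs) f zero    z< = nth-tabulate (f zero) z<
link-tabulate p (q ∷ qs) f (suc j) z< = link-tabulate p qs (f ∘ suc) j z<

-- The bits are the values of `G` at `y = 0`. They determine a block of two distinct cycles because
-- both lengths, hence their gcd, are periods, and a block of one cycle because symmetry identifies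
-- opposite differences.
adjacent-surjective : ∀ {n} (ps : Vec ℕ n) {G} → IsInvariant ps G →
                      ∃ λ c → ∀ i j x y → G i j x y ≡ adjacent ps c i j x y
adjacent-surjective []           inv = tt , λ ()
adjacent-surjective (p ∷ ps) {G} inv
  with c , eq ← adjacent-surjective ps {λ i j → G (suc i) (suc j)} (record
    { symmetric   = λ i j → inv .symmetric (suc i) (suc j)
    ; irreflexive = λ i → inv .irreflexive (suc i)
    ; diagonal    = λ i j → inv .diagonal (suc i) (suc j)
    ; periodicˡ   = λ i j → inv .periodicˡ (suc i) (suc j)
    }) = (xs , Bs , c) , λ where
      zero    zero    x y → loops x y
      zero    (suc j) x y → links j x y
      (suc i) zero    x y → trans (inv .symmetric (suc i) zero x y) (links i y x)
      (suc i) (suc j) x y → eq i j x y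
  where
  G₀ : ℕ → ℕ → Bool
  G₀ = G zero zero

  xs : Loop p
  xs = tabulate (λ z → G₀ (suc (toℕ z)) 0)

  Bs : Links p ps
  Bs = tabulateLinks p ps (λ j z → G zero (suc j) z 0)

  -- Symmetry replaces the difference z by -z, and adding one period makes this `suc p ∸ z`.
  folded : ∀ z → z ≤ suc p → G₀ z 0 ≡ G₀ (fold p z) 0
  folded z z≤ with ℕ.⊓-sel z (suc p ∸ z)
  ... | inj₁ e = cong (λ t → G₀ t 0) (sym e)
  ... | inj₂ e = begin
    G₀ z 0                          ≡⟨ inv .symmetric zero zero z 0 ⟩
    G₀ 0 z                          ≡⟨ inv .periodicˡ zero zero 0 z ⟨
    G₀ (suc p + 0) z                ≡⟨ cong₂ G₀ (trans (ℕ.+-identityʳ _) (sym (ℕ.m+[n∸m]≡n z≤)))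
        (sym (ℕ.+-identityʳ z)) ⟩
    G₀ (z + (suc p ∸ z)) (z + 0)    ≡⟨ diag* G₀ (inv .diagonal zero zero) z _ 0 ⟩
    G₀ (suc p ∸ z) 0                ≡⟨ cong (λ t → G₀ t 0) e ⟨
    G₀ (fold p z) 0                 ∎

  small : ∀ z → z ≤ ⌊ suc p /2⌋ → G₀ z 0 ≡ nth (false ∷ xs) z
  small zero    z≤ = inv .irreflexive zero 0
  small (suc z) z≤ = sym (nth-tabulate (λ z → G₀ (suc z) 0) z≤)

  loops : ∀ x y → G₀ x y ≡ loop xs (diff (suc p) x y)
  loops x y = begin
    G₀ x y                               ≡⟨ by-diff G₀ (inv .diagonal zero zero) (suc p)
                                              (inv .periodicˡ zero zero) (periodicʳ inv zero zero) x y ⟩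
    G₀ (diff (suc p) x y) 0              ≡⟨ folded _ (ℕ.<⇒≤ (diff-< (suc p) x y)) ⟩
    G₀ (fold p (diff (suc p) x y)) 0     ≡⟨ small _ (fold-≤ p _) ⟩
    loop xs (diff (suc p) x y)           ∎

  links : ∀ j x y → G zero (suc j) x y ≡ nth (link ps Bs j) (diff⁺ p (lookup ps j) x y)
  links j x y = begin
    G₁ x y             ≡⟨ by-diff G₁ diag g {{gcd⁺≢0 p q}} perˡ perʳ x y ⟩
    G₁ (diff⁺ p q x y) 0  ≡⟨ link-tabulate p ps _ j (diff-< g {{gcd⁺≢0 p q}} x y) ⟨
    nth (link ps Bs j) (diff⁺ p q x y) ∎
    where
    q = lookup ps j
    g = gcd⁺ p q
    G₁ = G zero (suc j)
    diag : ∀ x y → G₁ (suc x) (suc y) ≡ G₁ x y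
    diag = inv .diagonal zero (suc j)
    perˡ : ∀ x y → G₁ (g + x) y ≡ G₁ x y
    perˡ = gcd-periodˡ G₁ diag (suc p) (suc q) (inv .periodicˡ zero (suc j)) (periodicʳ inv zero (suc j))
    perʳ : ∀ x y → G₁ x (g + y) ≡ G₁ x y
    perʳ x y = subst (λ g → G₁ x (g + y) ≡ G₁ x y) (gcd-comm (suc q) (suc p))
      (gcd-periodˡ (flip G₁) (flip diag) (suc q) (suc p)
        (λ y x → periodicʳ inv zero (suc j) x y) (λ y x → inv .periodicˡ zero (suc j) x y) y x)

-- Degrees of a coded graph

sizes : ∀ {n p} (qs : Vec ℕ n) → Links p qs → Vec ℕ n
sizes []       _        = []
sizes (q ∷ qs) (B , Bs) = ∥ B ∥ ∷ sizes qs Bs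

rowDegree : ∀ {n} → ℕ → Vec ℕ n → Vec ℕ n → ℕ
rowDegree p []       []       = 0
rowDegree p (q ∷ qs) (k ∷ ks) = k * α (suc p) (suc q) + rowDegree p qs ks

columnDegrees : ∀ {n} → ℕ → Vec ℕ n → Vec ℕ n → Vec ℕ n
columnDegrees p []       []       = []
columnDegrees p (q ∷ qs) (k ∷ ks) = k * β (suc p) (suc q) ∷ columnDegrees p qs ks

loopDegree : ∀ {p} → Loop p → ℕ
loopDegree {p} xs = ∑ {suc p} (λ z → bit (loop xs (toℕ z)))

degrees : ∀ {n} (ps : Vec ℕ n) → Code ps → Vec ℕ n
degrees []       _             = []
degrees (p ∷ ps) (xs , Bs , c) =
  loopDegree xs + rowDegree p ps (sizes ps Bs) ∷
  zipWith _+_ (columnDegrees p ps (sizes ps Bs)) (degrees ps c)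

-- As `y` runs over the other cycle, its difference to `x` takes each residue modulo the gcd equally
-- often, namely `α` times. In `column-sum` the multiplicity is `β`.
row-sum : ∀ {n} p (qs : Vec ℕ n) (Bs : Links p qs) x →
  ∑ (λ j → ∑ {suc (lookup qs j)} λ y → bit (nth (link qs Bs j) (diff⁺ p (lookup qs j) x (toℕ y))))
  ≡ rowDegree p qs (sizes qs Bs)
row-sum p []       _        x = refl
row-sum p (q ∷ qs) (B , Bs) x = cong₂ _+_
  (trans (∑-diffʳ (bit ∘ nth B) (gcd⁺ p q) {{gcd⁺≢0 p q}} (α (suc p) (suc q))
      (m/n*n≡m {{gcd⁺≢0 p q}} (gcd[m,n]∣n (suc p) (suc q))) x)
         (ℕ.*-comm (α (suc p) (suc q)) ∥ B ∥))
  (row-sum p qs Bs x)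

column-sum : ∀ {n} p (qs : Vec ℕ n) (Bs : Links p qs) i y →
  ∑ {suc p} (λ x → bit (nth (link qs Bs i) (diff⁺ p (lookup qs i) (toℕ x) y)))
  ≡ lookup (columnDegrees p qs (sizes qs Bs)) i
column-sum p (q ∷ qs) (B , Bs) zero    y =
  trans (∑-diffˡ (bit ∘ nth B) (gcd⁺ p q) {{gcd⁺≢0 p q}} (β (suc p) (suc q))
      (m/n*n≡m {{gcd⁺≢0 p q}} (gcd[m,n]∣m (suc p) (suc q))) y)
        (ℕ.*-comm (β (suc p) (suc q)) ∥ B ∥)
column-sum p (q ∷ qs) (B , Bs) (suc i) y = column-sum p qs Bs i y

degree-adjacent : ∀ {n} (ps : Vec ℕ n) c i x →
  ∑ (λ j → ∑ {suc (lookup ps j)} λ y → bit (adjacent ps c i j x (toℕ y))) ≡ lookup (degrees ps c) i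
degree-adjacent (p ∷ ps) (xs , Bs , c) zero    x = cong₂ _+_
  (trans (∑-diffʳ (bit ∘ loop xs) (suc p) 1 (ℕ.+-identityʳ (suc p)) x) (ℕ.+-identityʳ _))
  (row-sum p ps Bs x)
degree-adjacent (p ∷ ps) (xs , Bs , c) (suc i) x = begin
  ∑ {suc p} (λ y → bit (nth (link ps Bs i) (diff⁺ p (lookup ps i) (toℕ y) x)))
    + ∑ (λ j → ∑ {suc (lookup ps j)} λ y → bit (adjacent ps c i j x (toℕ y)))
    ≡⟨ cong₂ _+_ (column-sum p ps Bs i x) (degree-adjacent ps c i x) ⟩
  lookup (columnDegrees p ps (sizes ps Bs)) i + lookup (degrees ps c) i
    ≡⟨ lookup-zipWith _+_ i (columnDegrees p ps (sizes ps Bs)) (degrees ps c) ⟨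
  lookup (zipWith _+_ (columnDegrees p ps (sizes ps Bs)) (degrees ps c)) i ∎

-- Completions as codes

-- Pigeonhole principle: no two entries of `xs` share a partner, so the partner of the first can be
-- deleted from `ys`. A relation takes the place of an injection because graphs are listed only up
-- to pointwise equality.
length-≤ : ∀ {A B : Set} (R : A → B → Set) {xs : List A} (ys : List B) →
           AllPairs (λ x x′ → ∀ y → R x y → ¬ R x′ y) xs →
           (∀ {x} → x List.∈ xs → ∃ λ y → y List.∈ ys × R x y) →
           length xs ≤ length ys
length-≤ R ys [] related = z≤n
length-≤ R ys (x# ∷ xs#) related with related (here refl)
... | y , y∈ , xRy with ys₁ , ys₂ , refl ← ∈-∃++ y∈ =
  ℕ.≤-trans (s≤s (length-≤ R (ys₁ ++ ys₂) xs# related′)) (ℕ.≤-reflexive (begin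
    suc (length (ys₁ ++ ys₂))         ≡⟨ cong suc (length-++ ys₁) ⟩
    suc (length ys₁ + length ys₂)     ≡⟨ ℕ.+-suc (length ys₁) (length ys₂) ⟨
    length ys₁ + suc (length ys₂)     ≡⟨ length-++ ys₁ ⟨
    length (ys₁ ++ y ∷ ys₂)           ∎))
  where
  avoids : ∀ {x′ y′} → ¬ R x′ y → R x′ y′ → y′ List.∈ ys₁ ++ y ∷ ys₂ → y′ List.∈ ys₁ ++ ys₂
  avoids ¬x′Ry x′Ry′ y′∈ with ∈-++⁻ ys₁ y′∈
  ... | inj₁ y′∈ys₁          = ∈-++⁺ˡ y′∈ys₁
  ... | inj₂ (here refl)     = contradiction x′Ry′ ¬x′Ry
  ... | inj₂ (there y′∈ys₂)  = ∈-++⁺ʳ ys₁ y′∈ys₂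
  related′ : ∀ {x′} → x′ List.∈ _ → ∃ λ y′ → y′ List.∈ ys₁ ++ ys₂ × R x′ y′
  related′ x′∈ with y′ , y′∈ , x′Ry′ ← related (there x′∈) =
    y′ , avoids (All.lookup x# x′∈ y xRy) x′Ry′ y′∈ , x′Ry′

-- The relation is a parameter because a graph is a family of families: at the outer level the
-- entries are rows, which are themselves compared pointwise.
families-distinct : ∀ {n} {A : Fin n → Set} (_≈_ : ∀ {i} → A i → A i → Set) (xs : ∀ i → List (A i)) →
                    (∀ i → AllPairs (λ x y → ¬ (x ≈ y)) (xs i)) →
                    AllPairs (λ f g → ¬ (∀ i → f i ≈ g i)) (families xs)
families-distinct {zero}  _≈_ xs xs# = [] ∷ []
families-distinct {suc n} _≈_ xs xs# = AllPairs.concat⁺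
  (All.map⁺ (All.universal (λ x → AllPairs.map⁺
    (AllPairs.map (λ f# eq → f# (eq ∘ suc)) (families-distinct _≈_ (xs ∘ suc) (xs# ∘ suc)))) (xs zero)))
  (AllPairs.map⁺ (AllPairs.map (λ x# → All.map⁺ (All.universal
    (λ f → All.map⁺ (All.universal (λ g eq → x# (eq zero)) _)) _)) (xs# zero)))

families-complete : ∀ {n} {A : Fin n → Set} (_≈_ : ∀ {i} → A i → A i → Set) (xs : ∀ i → List (A i))
                    (f : ∀ i → A i) → (∀ i → ∃ λ x → x List.∈ xs i × x ≈ f i) →
                    ∃ λ g → g List.∈ families xs × ∀ i → g i ≈ f i
families-complete {zero}  _≈_ xs f f∈ = _ , here refl , λ ()
families-complete {suc n} _≈_ xs f f∈
  with x , x∈ , x≈ ← f∈ zero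
  with g , g∈ , g≈ ← families-complete _≈_ (xs ∘ suc) (f ∘ suc) (f∈ ∘ suc) =
  _ , ∈-concatMap⁺ _ (Any.map (λ { refl → ∈-map⁺ _ g∈ }) x∈) , λ where
    zero    → x≈
    (suc i) → g≈ i

bools : List Bool
bools = true ∷ false ∷ []

bools-unique : Unique bools
bools-unique = ((λ ()) ∷ []) ∷ [] ∷ []

∈-bools : ∀ b → b List.∈ bools
∈-bools true  = here refl
∈-bools false = there (here refl)

bitVectors : ∀ n → List (Vec Bool n)
bitVectors zero    = [] ∷ []
bitVectors (suc n) = cartesianProductWith _∷_ bools (bitVectors n)

bitVectors-unique : ∀ n → Unique (bitVectors n)
bitVectors-unique zero    = [] ∷ []
bitVectors-unique (suc n) = Unique.cartesianProductWith⁺ _∷_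
  (λ { refl → refl , refl }) bools-unique (bitVectors-unique n)

∈-bitVectors : ∀ {n} (xs : Vec Bool n) → xs List.∈ bitVectors n
∈-bitVectors []       = here refl
∈-bitVectors (x ∷ xs) = ∈-cartesianProductWith⁺ _∷_ (∈-bools x) (∈-bitVectors xs)

allLinks : ∀ {n} p (qs : Vec ℕ n) → List (Links p qs)
allLinks p []       = tt ∷ []
allLinks p (q ∷ qs) = cartesianProduct (bitVectors (gcd⁺ p q)) (allLinks p qs)

allLinks-unique : ∀ {n} p (qs : Vec ℕ n) → Unique (allLinks p qs)
allLinks-unique p []       = [] ∷ []
allLinks-unique p (q ∷ qs) = Unique.cartesianProduct⁺ (bitVectors-unique (gcd⁺ p q)) (allLinks-unique p qs)

∈-allLinks : ∀ {n p} (qs : Vec ℕ n) (Bs : Links p qs) → Bs List.∈ allLinks p qs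
∈-allLinks []       tt       = here refl
∈-allLinks (q ∷ qs) (B , Bs) = ∈-cartesianProduct⁺ (∈-bitVectors B) (∈-allLinks qs Bs)

codes : ∀ {n} (ps : Vec ℕ n) → List (Code ps)
codes []       = tt ∷ []
codes (p ∷ ps) = cartesianProduct (bitVectors ⌊ suc p /2⌋) (cartesianProduct (allLinks p ps) (codes ps))

codes-unique : ∀ {n} (ps : Vec ℕ n) → Unique (codes ps)
codes-unique []       = [] ∷ []
codes-unique (p ∷ ps) = Unique.cartesianProduct⁺ (bitVectors-unique ⌊ suc p /2⌋)
  (Unique.cartesianProduct⁺ (allLinks-unique p ps) (codes-unique ps))

∈-codes : ∀ {n} (ps : Vec ℕ n) c → c List.∈ codes ps
∈-codes []       tt            = here refl
∈-codes (p ∷ ps) (xs , Bs , c) =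
  ∈-cartesianProduct⁺ (∈-bitVectors xs) (∈-cartesianProduct⁺ (∈-allLinks ps Bs) (∈-codes ps c))

_≟ᵥ_ : ∀ {n} (xs ys : Vec ℕ n) → Dec (xs ≡ ys)
_≟ᵥ_ = ≡-dec _≟_

-- The count without a realization. Unlike the degrees of a state, entries of `rs` may be 0, so
-- residual degrees are again admissible arguments.
count : ∀ {n} (ps rs : Vec ℕ n) → ℕ
count ps rs = length (filter (λ c → degrees ps c ≟ᵥ rs) (codes ps))

-- A labeling cut into cycles: point i x is reached in x steps from a base
-- point of the cycle i, whose length is lookup ps i + 1.
record Coordinates {d n} (L : Labeling d) (ps rs : Vec ℕ n) : Set where
  field
    point       : Fin n → ℕ → Fin (size L)
    point-suc   : ∀ i x → point i (suc x) ≡ σ L ⟨$⟩ʳ point i x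
    point-+     : ∀ i x → point i (suc (lookup ps i) + x) ≡ point i x
    degree      : ∀ i x → deg (ρ L (point i x)) ≡ lookup rs i
    index       : Fin (size L) → Fin n
    position    : Fin (size L) → ℕ
    position-<  : ∀ v → position v < suc (lookup ps (index v))
    surjective  : ∀ v → point (index v) (position v) ≡ v
    index-point : ∀ i {x} → x < suc (lookup ps i) → index (point i x) ≡ i
    position-point : ∀ i {x} → x < suc (lookup ps i) → position (point i x) ≡ x

  -- Double counting: `f v` is summed over all incidences of a point `v` with a coordinate pair, in
  -- both orders.
  ∑-point : ∀ (f : Fin (size L) → ℕ) →
            ∑ f ≡ ∑ (λ j → ∑ {suc (lookup ps j)} (λ y → f (point j (toℕ y))))
  ∑-point f = begin
    ∑ f
      ≡⟨ sum-cong-≗ (λ v → trans (∑-only (λ j → ∑ {suc (lookup ps j)} (term v j)) (index v) (off-index v))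
           (trans (∑-only (term v (index v)) (y₀ v) (off-position v)) (on v))) ⟨
    ∑ (λ v → ∑ λ j → ∑ {suc (lookup ps j)} (term v j))
      ≡⟨ ∑-comm (λ v j → ∑ {suc (lookup ps j)} (term v j)) ⟩
    ∑ (λ j → ∑ λ v → ∑ {suc (lookup ps j)} (term v j))
      ≡⟨ sum-cong-≗ (λ j → ∑-comm (λ v → term v j)) ⟩
    ∑ (λ j → ∑ {suc (lookup ps j)} λ y → ∑ λ v → term v j y)
      ≡⟨ sum-cong-≗ (λ j → sum-cong-≗ (λ y → trans
           (∑-only (λ v → term v j y) (point j (toℕ y)) (off-point j y)) (on-point j y))) ⟩
    ∑ (λ j → ∑ {suc (lookup ps j)} (λ y → f (point j (toℕ y)))) ∎
    where
    at? : ∀ v j (y : Fin (suc (lookup ps j))) → Dec (index v ≡ j × position v ≡ toℕ y)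
    at? v j y = (index v Fin.≟ j) ×-dec (position v ≟ toℕ y)
    term : ∀ v j → Fin (suc (lookup ps j)) → ℕ
    term v j y = 𝟙 (at? v j y) * f v
    y₀ : ∀ v → Fin (suc (lookup ps (index v)))
    y₀ v = fromℕ< (position-< v)
    y₀≡ : ∀ v → toℕ (y₀ v) ≡ position v
    y₀≡ v = Fin.toℕ-fromℕ< (position-< v)
    off-index : ∀ v j → j ≢ index v → ∑ (term v j) ≡ 0
    off-index v j j≢ = ∑-zero (term v j) (λ y → cong (_* f v) (𝟙-no (at? v j y) λ (e , _) → j≢ (sym e)))
    off-position : ∀ v y → y ≢ y₀ v → term v (index v) y ≡ 0
    off-position v y y≢ = cong (_* f v) (𝟙-no (at? v (index v) y)
      λ (_ , e) → y≢ (Fin.toℕ-injective (trans (sym e) (sym (y₀≡ v)))))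
    on : ∀ v → term v (index v) (y₀ v) ≡ f v
    on v = trans (cong (_* f v) (𝟙-yes (at? v (index v) (y₀ v)) (refl , sym (y₀≡ v)))) (ℕ.*-identityˡ (f v))
    off-point : ∀ j y v → v ≢ point j (toℕ y) → term v j y ≡ 0
    off-point j y v v≢ = cong (_* f v) (𝟙-no (at? v j y)
      λ { (refl , e) → v≢ (trans (sym (surjective v)) (cong (point (index v)) e)) })
    on-point : ∀ j y → term (point j (toℕ y)) j y ≡ f (point j (toℕ y))
    on-point j y = trans (cong (_* f (point j (toℕ y))) (𝟙-yes (at? (point j (toℕ y)) j y)
      (index-point j (Fin.toℕ<n y) , position-point j (Fin.toℕ<n y)))) (ℕ.*-identityˡ _)

module _ {d n} {L : Labeling d} {ps rs : Vec ℕ n} (coordinates : Coordinates L ps rs) where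

  open Coordinates coordinates

  Graph : Set
  Graph = Fin (size L) → Fin (size L) → Bool

  Encodes : Graph → Code ps → Set
  Encodes E c = ∀ i j x y → E (point i x) (point j y) ≡ adjacent ps c i j x y

  encode : ∀ {E} → IsCompletion L E → ∃ (Encodes E)
  encode {E} (sym-E , irr-E , inv-E , _) = adjacent-surjective ps λ where
    .symmetric   i j x y → sym-E (point i x) (point j y)
    .irreflexive i x     → irr-E (point i x)
    .diagonal    i j x y → trans (cong₂ E (point-suc i x) (point-suc j y)) (inv-E (point i x) (point j y))
    .periodicˡ   i j x y → cong (λ v → E v (point j y)) (point-+ i x)

  decode : Code ps → Graph
  decode c v w = adjacent ps c (index v) (index w) (position v) (position w)

  point-% : ∀ i x → point i x ≡ point i (x % suc (lookup ps i))
  point-% i x = trans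
    (cong (point i) (trans (m≡m%n+[m/n]*n x a) (ℕ.+-comm (x % a) _)))
    (periodˡ* {A = Fin (size L)} (λ x _ → point i x) a (λ x _ → point-+ i x) (x / a) (x % a) 0)
    where a = suc (lookup ps i)

  decode-point : ∀ c i j {x y} → x < suc (lookup ps i) → y < suc (lookup ps j) →
                 decode c (point i x) (point j y) ≡ adjacent ps c i j x y
  decode-point c i j x< y<
    rewrite index-point i x< | index-point j y< | position-point i x< | position-point j y< = refl

  decode-encodes : ∀ c → Encodes (decode c) c
  decode-encodes c i j x y = begin
    decode c (point i x) (point j y)                  ≡⟨ cong₂ (decode c) (point-% i x) (point-% j y) ⟩
    decode c (point i (x % a)) (point j (y % b))      ≡⟨ decode-point c i j (m%n<n x a) (m%n<n y b) ⟩
    adjacent ps c i j (x % a) (y % b)                 ≡⟨ periodˡ* (adjacent ps c i j) a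
                                                           (periodicˡ inv i j) (x / a) (x % a) (y % b) ⟨
    adjacent ps c i j (x / a * a + x % a) (y % b)     ≡⟨ periodˡ* (flip (adjacent ps c i j)) b
                                                           (flip (periodicʳ inv i j)) (y / b) (y % b) _ ⟨
    adjacent ps c i j (x / a * a + x % a) (y / b * b + y % b)
                                                      ≡⟨ cong₂ (adjacent ps c i j) (divMod x a) (divMod y b) ⟨
    adjacent ps c i j x y                             ∎
    where
    a = suc (lookup ps i)
    b = suc (lookup ps j)
    inv = adjacent-invariant ps c
    divMod : ∀ x a .{{_ : NonZero a}} → x ≡ x / a * a + x % a
    divMod x a = trans (m≡m%n+[m/n]*n x a) (ℕ.+-comm (x % a) _)

  module _ {E c} (E∼c : Encodes E c) where

    encodes-at : ∀ v w → E v w ≡ decode c v w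
    encodes-at v w = trans (cong₂ E (sym (surjective v)) (sym (surjective w))) (E∼c _ _ _ _)

    degree-at : ∀ i x → ∑ (λ w → bit (E (point i x) w)) ≡ lookup (degrees ps c) i
    degree-at i x = begin
      ∑ (λ w → bit (E (point i x) w))
        ≡⟨ ∑-point (λ w → bit (E (point i x) w)) ⟩
      ∑ (λ j → ∑ {suc (lookup ps j)} λ y → bit (E (point i x) (point j (toℕ y))))
        ≡⟨ sum-cong-≗ (λ j → sum-cong-≗ {suc (lookup ps j)} λ y → cong bit (E∼c i j x (toℕ y))) ⟩
      ∑ (λ j → ∑ {suc (lookup ps j)} λ y → bit (adjacent ps c i j x (toℕ y)))
        ≡⟨ degree-adjacent ps c i x ⟩
      lookup (degrees ps c) i ∎

    completion⇒degrees : IsCompletion L E → degrees ps c ≡ rs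
    completion⇒degrees (_ , _ , _ , deg-E) = begin
      degrees ps c                          ≡⟨ tabulate∘lookup (degrees ps c) ⟨
      tabulate (lookup (degrees ps c))      ≡⟨ tabulate-cong (λ i → trans (sym (degree-at i 0))
                                                 (trans (deg-E (point i 0)) (degree i 0))) ⟩
      tabulate (lookup rs)                  ≡⟨ tabulate∘lookup rs ⟩
      rs                                    ∎

    degrees⇒completion : degrees ps c ≡ rs → IsCompletion L E
    degrees⇒completion refl = at₂ (λ i x j y → trans (E∼c i j x y)
        (trans (symmetric inv i j x y) (sym (E∼c j i y x))))
      , at (λ i x → trans (E∼c i i x x) (irreflexive inv i x))
      , at₂ (λ i x j y → trans (cong₂ E (sym (point-suc i x)) (sym (point-suc j y)))
          (trans (E∼c i j (suc x) (suc y)) (trans (diagonal inv i j x y) (sym (E∼c i j x y)))))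
      , at (λ i x → trans (degree-at i x) (sym (degree i x)))
      where
      inv = adjacent-invariant ps c
      at : ∀ {P : Fin (size L) → Set} → (∀ i x → P (point i x)) → ∀ v → P v
      at {P} p v = subst P (surjective v) (p (index v) (position v))
      at₂ : ∀ {P : Fin (size L) → Fin (size L) → Set} →
            (∀ i x j y → P (point i x) (point j y)) → ∀ v w → P v w
      at₂ {P} p v w = subst₂ P (surjective v) (surjective w) (p (index v) (position v) (index w) (position w))

  -- `length-≤` is applied to `Encodes` in both directions: a code determines its graph pointwise,
  -- and a graph determines its code.
  length-completions : length (completions L) ≡ count ps rs
  length-completions = ℕ.≤-antisym
    (length-≤ Encodes _
      (AllPairs.map (λ E#E′ c E∼c E′∼c → E#E′ λ v w →
          trans (encodes-at E∼c v w) (sym (encodes-at E′∼c v w)))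
        (AllPairs.filter⁺ (isCompletion? L)
          (families-distinct (λ f g → ∀ w → f w ≡ g w) _ λ v →
            families-distinct _≡_ _ λ w → bools-unique)))
      λ {E} E∈ → let _ , E! = ∈-filter⁻ (isCompletion? L) {xs = graphs} E∈ ; c , E∼c = encode E! in
        c , ∈-filter⁺ (λ c → degrees ps c ≟ᵥ rs) (∈-codes ps c) (completion⇒degrees E∼c E!) , E∼c)
    (length-≤ (flip Encodes) _
      (AllPairs.map (λ c≢c′ E E∼c E∼c′ → c≢c′ (adjacent-injective ps _ _ λ i j x y →
          trans (sym (E∼c i j x y)) (E∼c′ i j x y)))
        (Unique.filter⁺ (λ c → degrees ps c ≟ᵥ rs) (codes-unique ps)))
      λ {c} c∈ → let _ , c! = ∈-filter⁻ (λ c → degrees ps c ≟ᵥ rs) {xs = codes ps} c∈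
                     -- `decode c` itself need not occur in the list; a listed graph that agrees
                     -- with it pointwise takes its place.
                     E , E∈ , E≗ = families-complete (λ f g → ∀ w → f w ≡ g w) _ (decode c) λ v →
                       families-complete _≡_ _ (decode c v) λ w → _ , ∈-bools _ , refl
                     E∼c = λ i j x y → trans (E≗ (point i x) (point j y)) (decode-encodes c i j x y) in
        E , ∈-filter⁺ (isCompletion? L) E∈ (degrees⇒completion E∼c c!) , E∼c)
    where
    graphs : List Graph
    graphs = families λ v → families λ w → bools

-- Cutting a labeling into cycles

open Equivalence renaming (to to ⇒; from to ⇐)

occurrences : ∀ {n d} → Vec ℕ n → Vec (Fin d) n → ℕ → Fin d → ℕ
occurrences []       []       p s = 0
occurrences (q ∷ ps) (t ∷ ss) p s = 𝟙 ((q ≟ p) ×-dec (t Fin.≟ s)) + occurrences ps ss p s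

drop-⊆ : ∀ {A : Set} k {xs : List A} {x} → x List.∈ drop k xs → x List.∈ xs
drop-⊆ zero             x∈ = x∈
drop-⊆ (suc k) {_ ∷ xs} x∈ = there (drop-⊆ k x∈)

-- Injectivity is asked only within a class `(p , s)`, since nothing here prevents lists of
-- different classes from sharing elements. For cycles the classes are disjoint, because a cycle has
-- one length and one degree.
record Assignment {A : Set} {n d} (xs : ℕ → Fin d → List A) (ps : Vec ℕ n) (ss : Vec (Fin d) n) : Set where
  field
    assign    : Fin n → A
    assign-∈  : ∀ i → assign i List.∈ xs (lookup ps i) (lookup ss i)
    covers    : ∀ p s {x} → x List.∈ xs p s → ∃ λ i → assign i ≡ x
    injective : ∀ i j → lookup ps i ≡ lookup ps j → lookup ss i ≡ lookup ss j →
                assign i ≡ assign j → i ≡ j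

open Assignment

-- The lists are consumed from the front: the first index takes the head of the list of its class,
-- and `drop` removes one entry from that list and none from the others.
assignment : ∀ {A : Set} {n d} (xs : ℕ → Fin d → List A) (ps : Vec ℕ n) (ss : Vec (Fin d) n) →
             (∀ p s → Unique (xs p s)) → (∀ p s → length (xs p s) ≡ occurrences ps ss p s) →
             Assignment xs ps ss
assignment xs [] [] xs! ∣xs∣ = record
  { assign = λ () ; assign-∈ = λ () ; injective = λ ()
  ; covers = λ p s x∈ → contradiction x∈ (empty (∣xs∣ p s)) }
  where
  empty : ∀ {A : Set} {xs : List A} → length xs ≡ 0 → ∀ {x} → ¬ x List.∈ xs
  empty {xs = []} _ ()
assignment {A} {d = d} xs (q ∷ ps) (t ∷ ss) xs! ∣xs∣ = go (xs q t) refl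
  (trans (∣xs∣ q t) (cong (_+ occurrences ps ss q t) (𝟙-yes (at? q t) (refl , refl))))
  where
  at? : ∀ p s → Dec (q ≡ p × t ≡ s)
  at? p s = (q ≟ p) ×-dec (t Fin.≟ s)
  xs′ : ℕ → Fin d → List A
  xs′ p s = drop (𝟙 (at? p s)) (xs p s)
  rest : Assignment xs′ ps ss
  rest = assignment xs′ ps ss (λ p s → Unique.drop⁺ (𝟙 (at? p s)) (xs! p s)) λ p s → begin
    length (xs′ p s)                                        ≡⟨ length-drop (𝟙 (at? p s)) (xs p s) ⟩
    length (xs p s) ∸ 𝟙 (at? p s)                           ≡⟨ cong (_∸ 𝟙 (at? p s)) (∣xs∣ p s) ⟩
    𝟙 (at? p s) + occurrences ps ss p s ∸ 𝟙 (at? p s)       ≡⟨ ℕ.m+n∸m≡n (𝟙 (at? p s)) _ ⟩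
    occurrences ps ss p s                                   ∎
  go : ∀ ys → xs q t ≡ ys → length ys ≡ suc (occurrences ps ss q t) → Assignment xs (q ∷ ps) (t ∷ ss)
  go (y ∷ ys) eq _ = record
    { assign = λ where
        zero    → y
        (suc i) → rest .assign i
    ; assign-∈ = λ where
        zero    → subst (y List.∈_) (sym eq) (here refl)
        (suc i) → drop-⊆ (𝟙 (at? (lookup ps i) (lookup ss i))) (rest .assign-∈ i)
    ; covers = cov
    ; injective = λ where
        zero    zero    _ _ _    → refl
        zero    (suc j) e e′ e″  → contradiction e″ (apart j e e′)
        (suc i) zero    e e′ e″  → contradiction (sym e″) (apart i (sym e) (sym e′))
        (suc i) (suc j) e e′ e″  → cong suc (rest .injective i j e e′ e″)
    }
    where
    xs′≡ys : xs′ q t ≡ ys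
    xs′≡ys = trans (cong (λ k → drop k (xs q t)) (𝟙-yes (at? q t) (refl , refl))) (cong (drop 1) eq)
    cov : ∀ p s {x} → x List.∈ xs p s → ∃ λ i → _
    cov p s {x} x∈ with at? p s in e
    ... | no  _ with i , e′ ← rest .covers p s
                  (subst (λ b? → x List.∈ drop (𝟙 b?) (xs p s)) (sym e) x∈) = suc i , e′
    ... | yes (refl , refl) with subst (x List.∈_) eq x∈
    ...   | here refl = zero , refl
    ...   | there x∈ys with i , e′ ← rest .covers q t (subst (x List.∈_) (sym xs′≡ys) x∈ys) = suc i , e′
    apart : ∀ j → q ≡ lookup ps j → t ≡ lookup ss j → y ≢ rest .assign j
    apart j e e′ refl with y# ∷ _ ← subst Unique eq (xs! q t) =
      All.lookup y# (subst (rest .assign j List.∈_) xs′≡ys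
        (subst₂ (λ p s → rest .assign j List.∈ xs′ p s) (sym e) (sym e′) (rest .assign-∈ j))) refl

iterate-+ : ∀ {A : Set} (f : A → A) x j k → iterate f x (j + k) ≡ iterate f (iterate f x j) k
iterate-+ f x zero    k = refl
iterate-+ f x (suc j) k = iterate-+ f (f x) j k

iterate-suc : ∀ {A : Set} (f : A → A) x k → iterate f x (suc k) ≡ f (iterate f x k)
iterate-suc f x zero    = refl
iterate-suc f x (suc k) = iterate-suc f (f x) k

least : ∀ {P : ℕ → Set} → (∀ k → Dec (P k)) → ∀ k → P k → ∃ λ m → P m × ∀ j → j < m → ¬ P j
least P? zero    p = 0 , p , λ _ ()
least P? (suc k) p with P? 0
... | yes p₀ = 0 , p₀ , λ _ ()
... | no ¬p₀ with m , pₘ , min ← least (P? ∘ suc) k p =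
  suc m , pₘ , λ { zero _ → ¬p₀ ; (suc j) (s≤s j<m) → min j j<m }

∣c∣≡∑ : ∀ {n} (c : Subset n) → ∣ c ∣ ≡ ∑ (bit ∘ lookup c)
∣c∣≡∑ []          = refl
∣c∣≡∑ (true  ∷ c) = cong suc (∣c∣≡∑ c)
∣c∣≡∑ (false ∷ c) = ∣c∣≡∑ c

module _ {n} (π : Permutation′ n) where

  infixl 8 _↷_
  _↷_ : Fin n → ℕ → Fin n
  v ↷ k = iterate (π ⟨$⟩ʳ_) v k

  ↷-injective : ∀ k {v w} → v ↷ k ≡ w ↷ k → v ≡ w
  ↷-injective zero    e = e
  ↷-injective (suc k) e = trans (sym (Perm.inverseˡ π))
    (trans (cong (π Perm.⟨$⟩ˡ_) (↷-injective k e)) (Perm.inverseˡ π))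

  ↷-cancel : ∀ v {j k} → j ≤ k → v ↷ j ≡ v ↷ k → v ↷ (k ∸ j) ≡ v
  ↷-cancel v {j} {k} j≤k e = ↷-injective j (trans (sym (iterate-+ (π ⟨$⟩ʳ_) v (k ∸ j) j))
    (trans (cong (v ↷_) (ℕ.m∸n+n≡m j≤k)) (sym e)))

  returns : ∀ v → ∃ λ k → v ↷ suc k ≡ v
  returns v with i , j , i<j , e ← Fin.pigeonhole (ℕ.n<1+n n) (λ i → v ↷ toℕ i)
    = pred (toℕ j ∸ toℕ i) , trans
        (cong (v ↷_) (ℕ.suc-pred (toℕ j ∸ toℕ i) {{>-nonZero (ℕ.m<n⇒0<n∸m i<j)}}))
        (↷-cancel v (ℕ.<⇒≤ i<j) e)

  module _ (v : Fin n) where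

    abstract

      private
        minimal : ∃ λ m → v ↷ suc m ≡ v × ∀ j → j < m → ¬ v ↷ suc j ≡ v
        minimal = least (λ k → v ↷ suc k Fin.≟ v) (proj₁ (returns v)) (proj₂ (returns v))

      -- One less than the length of the orbit, in agreement with lengths stored as predecessors.
      period : ℕ
      period = proj₁ minimal

      ↷-period : ∀ x → v ↷ (suc period + x) ≡ v ↷ x
      ↷-period x = trans (iterate-+ (π ⟨$⟩ʳ_) v (suc period) x) (cong (_↷ x) (proj₁ (proj₂ minimal)))

      ↷-% : ∀ k → v ↷ k ≡ v ↷ (k % suc period)
      ↷-% k = trans (cong (v ↷_) (trans (m≡m%n+[m/n]*n k (suc period)) (ℕ.+-comm (k % suc period) _)))
        (periodˡ* (λ x _ → v ↷ x) (suc period) (λ x _ → ↷-period x) (k / suc period) _ 0)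

      private
        ↷-< : ∀ {x y} → x < y → y < suc period → v ↷ x ≢ v ↷ y
        ↷-< {x} {y} x<y y< e = proj₂ (proj₂ minimal) (pred (y ∸ x))
          (subst (_≤ period) (sym (ℕ.suc-pred (y ∸ x) {{≢0}})) (ℕ.≤-trans (ℕ.m∸n≤m y x) (s≤s⁻¹ y<)))
          (trans (cong (v ↷_) (ℕ.suc-pred (y ∸ x) {{≢0}})) (↷-cancel v (ℕ.<⇒≤ x<y) e))
          where
          ≢0 : NonZero (y ∸ x)
          ≢0 = >-nonZero (ℕ.m<n⇒0<n∸m x<y)

      ↷-distinct : ∀ {x y} → x < suc period → y < suc period → v ↷ x ≡ v ↷ y → x ≡ y
      ↷-distinct {x} {y} x< y< e with ℕ.<-cmp x y
      ... | tri< x<y _ _ = contradiction e (↷-< x<y y<)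
      ... | tri≈ _ x≡y _ = x≡y
      ... | tri> _ _ y<x = contradiction (sym e) (↷-< y<x x<)

      reaches⇒< : ∀ {w} → Reaches π v w → ∃ λ x → x < suc period × v ↷ x ≡ w
      reaches⇒< (k , e) = k % suc period , m%n<n k (suc period) , trans (sym (↷-% k)) e

      reaches? : ∀ w → Dec (Reaches π v w)
      reaches? w with Fin.any? {suc period} (λ x → v ↷ toℕ x Fin.≟ w)
      ... | yes (x , e) = yes (toℕ x , e)
      ... | no ¬e = no λ r → let x , x< , e = reaches⇒< r in
        ¬e (fromℕ< x< , trans (cong (v ↷_) (Fin.toℕ-fromℕ< x<)) e)

      orbit : Subset n
      orbit = tabulate (λ w → does (reaches? w))

      ∈-orbit : ∀ w → (w ∈ₛ orbit) ⇔ Reaches π v w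
      ∈-orbit w = mk⇔
        (λ w∈ → case reaches? w of λ where
          (yes r) → r
          (no ¬r) → case trans (sym (dec-false (reaches? w) ¬r))
                         (trans (sym (lookup∘tabulate _ w)) ([]=⇒lookup w∈)) of λ ())
        (λ r → lookup⇒[]= w orbit (trans (lookup∘tabulate _ w) (dec-true (reaches? w) r)))

      orbit-cycle : IsCycle π orbit
      orbit-cycle = v , ∈-orbit

      -- The pairs of a point `w` and an exponent `x < suc period` leading from `v` to `w` are
      -- counted twice: each point of `c` has exactly one exponent, any other point none, and each
      -- exponent has exactly one point.
      ∣cycle∣ : ∀ c → (∀ w → (w ∈ₛ c) ⇔ Reaches π v w) → ∣ c ∣ ≡ suc period
      ∣cycle∣ c f = begin
        ∣ c ∣
          ≡⟨ ∣c∣≡∑ c ⟩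
        ∑ (bit ∘ lookup c)
          ≡⟨ sum-cong-≗ (λ w → hits w (lookup c w) refl) ⟩
        ∑ (λ w → ∑ {suc period} λ x → 𝟙 (v ↷ toℕ x Fin.≟ w))
          ≡⟨ ∑-comm {n} {suc period} (λ w x → 𝟙 (v ↷ toℕ x Fin.≟ w)) ⟩
        ∑ {suc period} (λ x → ∑ λ w → 𝟙 (v ↷ toℕ x Fin.≟ w))
          ≡⟨ sum-cong-≗ {suc period} (λ x → trans
               (∑-only (λ w → 𝟙 (v ↷ toℕ x Fin.≟ w)) (v ↷ toℕ x) (λ w w≢ → 𝟙-no (v ↷ toℕ x Fin.≟ w) (w≢ ∘ sym)))
               (𝟙-yes (v ↷ toℕ x Fin.≟ v ↷ toℕ x) refl)) ⟩
        ∑ {suc period} (λ _ → 1)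
          ≡⟨ trans (∑-constant (suc period) 1) (ℕ.*-identityʳ (suc period)) ⟩
        suc period ∎
        where
        hits : ∀ w b → lookup c w ≡ b → bit b ≡ ∑ {suc period} (λ x → 𝟙 (v ↷ toℕ x Fin.≟ w))
        hits w false e = sym (∑-zero {suc period} _ λ x → 𝟙-no (v ↷ toℕ x Fin.≟ w) λ r →
          case trans (sym e) ([]=⇒lookup (⇐ (f w) (toℕ x , r))) of λ ())
        hits w true e with x , x< , r ← reaches⇒< (⇒ (f w) (lookup⇒[]= w c e)) = sym (trans
          (∑-only {suc period} _ (fromℕ< x<) λ y y≢ → 𝟙-no (v ↷ toℕ y Fin.≟ w) λ r′ → y≢ (Fin.toℕ-injective
            (trans (↷-distinct (Fin.toℕ<n y) x< (trans r′ (sym r))) (sym (Fin.toℕ-fromℕ< x<)))))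
          (𝟙-yes (v ↷ toℕ (fromℕ< x<) Fin.≟ w) (trans (cong (v ↷_) (Fin.toℕ-fromℕ< x<)) r)))

      reaches-sym : ∀ {w} → Reaches π v w → Reaches π w v
      reaches-sym {w} r with x , x< , e ← reaches⇒< r = suc period ∸ x , (begin
        w ↷ (suc period ∸ x)            ≡⟨ cong (_↷ (suc period ∸ x)) e ⟨
        v ↷ x ↷ (suc period ∸ x)        ≡⟨ iterate-+ (π ⟨$⟩ʳ_) v x (suc period ∸ x) ⟨
        v ↷ (x + (suc period ∸ x))      ≡⟨ cong (v ↷_) (ℕ.m+[n∸m]≡n (ℕ.<⇒≤ x<)) ⟩
        v ↷ suc period                  ≡⟨ proj₁ (proj₂ minimal) ⟩
        v                               ∎)

  reaches-trans : ∀ {u v w} → Reaches π u v → Reaches π v w → Reaches π u w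
  reaches-trans {u} (j , refl) (k , e) = j + k , trans (iterate-+ (π ⟨$⟩ʳ_) u j k) e

  cycle≡orbit : ∀ {c v} → IsCycle π c → v ∈ₛ c → c ≡ orbit v
  cycle≡orbit {c} {v} (u , f) v∈ = ⊆-antisym
    (λ {w} w∈ → ⇐ (∈-orbit v w) (reaches-trans (reaches-sym u (⇒ (f v) v∈)) (⇒ (f w) w∈)))
    (λ {w} w∈ → ⇐ (f w) (reaches-trans (⇒ (f v) v∈) (⇒ (∈-orbit v w) w∈)))

-- The realization lists the cycles of each class and `assignment` distributes them over the
-- indices. Points are located through their orbits, since a cycle is the orbit of each of its
-- points.
coordinates : ∀ {d n} {L : Labeling d} {N} (ps : Vec ℕ n) (ss : Vec (Fin d) n) → Realizes L N →
              (∀ p s → N (suc p) s ≡ occurrences ps ss p s) → Coordinates L ps (Vec.map deg ss)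
coordinates {d} {n} {L} {N} ps ss R N≡ = record
  { point          = λ i x → v⟦ base i ↷ x ⟧
  ; point-suc      = λ i x → iterate-suc (σ L ⟨$⟩ʳ_) (base i) x
  ; point-+        = λ i x → subst (λ p → v⟦ base i ↷ suc p + x ⟧ ≡ v⟦ base i ↷ x ⟧)
                       (period≡ i) (↷-period (σ L) (base i) x)
  ; degree         = λ i x → trans (cong deg (proj₂ (proj₂ (cyc i)) _ (point∈ i x))) (sym (lookup-map i deg ss))
  ; index          = index
  ; position       = position
  ; position-<     = λ v → proj₁ (proj₂ (locate v))
  ; surjective     = λ v → proj₂ (proj₂ (locate v))
  ; index-point    = λ i {x} _ → index-point i x
  ; position-point = λ i {x} x< → let w = v⟦ base i ↷ x ⟧ in
      ↷-distinct (σ L) (base i)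
        (subst (λ p → position w < suc p) (sym (trans (period≡ i) (cong (lookup ps) (sym (index-point i x)))))
          (proj₁ (proj₂ (locate w))))
        (subst (λ p → x < suc p) (sym (period≡ i)) x<)
        (subst (λ j → v⟦ base j ↷ position w ⟧ ≡ w) (index-point i x) (proj₂ (proj₂ (locate w))))
  }
  where
  v⟦_↷_⟧ : Fin (size L) → ℕ → Fin (size L)
  v⟦ v ↷ x ⟧ = _↷_ (σ L) v x

  cycles : ℕ → Fin d → List (Subset (size L))
  cycles p s = proj₁ (R (suc p) s)

  ∈-cycles : ∀ p s c → (c List.∈ cycles p s) ⇔ IsCycleOf L (suc p) s c
  ∈-cycles p s = proj₁ (proj₂ (proj₂ (R (suc p) s)))

  assigned : Assignment cycles ps ss
  assigned = assignment cycles ps ss (λ p s → proj₁ (proj₂ (R (suc p) s)))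
    (λ p s → trans (proj₂ (proj₂ (proj₂ (R (suc p) s)))) (N≡ p s))

  cyc : ∀ i → IsCycleOf L (suc (lookup ps i)) (lookup ss i) (assigned .assign i)
  cyc i = ⇒ (∈-cycles _ _ _) (assigned .assign-∈ i)

  base : Fin n → Fin (size L)
  base i = proj₁ (proj₁ (cyc i))

  point∈ : ∀ i x → v⟦ base i ↷ x ⟧ ∈ₛ assigned .assign i
  point∈ i x = ⇐ (proj₂ (proj₁ (cyc i)) _) (x , refl)

  period≡ : ∀ i → period (σ L) (base i) ≡ lookup ps i
  period≡ i = ℕ.suc-injective (trans (sym (∣cycle∣ (σ L) (base i) (assigned .assign i) (proj₂ (proj₁ (cyc i)))))
    (proj₁ (proj₂ (cyc i))))

  orbit-index : ∀ v → ∃ λ i → assigned .assign i ≡ orbit (σ L) v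
  orbit-index v = assigned .covers (period (σ L) v) (ρ L v) (⇐ (∈-cycles _ _ _)
    ( orbit-cycle (σ L) v
    , ∣cycle∣ (σ L) v (orbit (σ L) v) (∈-orbit (σ L) v)
    , λ w w∈ → ρ-constant L _ (orbit-cycle (σ L) v) w v w∈ (⇐ (∈-orbit (σ L) v v) (0 , refl))))

  index : Fin (size L) → Fin n
  index v = proj₁ (orbit-index v)

  locate : ∀ v → ∃ λ x → x < suc (lookup ps (index v)) × v⟦ base (index v) ↷ x ⟧ ≡ v
  locate v with x , x< , e ← reaches⇒< (σ L) (base (index v)) (⇒ (proj₂ (proj₁ (cyc (index v))) v)
                  (subst (v ∈ₛ_) (sym (proj₂ (orbit-index v))) (⇐ (∈-orbit (σ L) v v) (0 , refl)))) =
    x , subst (λ p → x < suc p) (period≡ (index v)) x< , e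

  position : Fin (size L) → ℕ
  position v = proj₁ (locate v)

  -- The orbit of the point is the cycle assigned to `i` and also the one assigned to its index.
  -- Equal cycles have equal length and degree, as `injective` demands.
  index-point : ∀ i x → index v⟦ base i ↷ x ⟧ ≡ i
  index-point i x = assigned .injective j i
    (ℕ.suc-injective (trans (sym (proj₁ (proj₂ (cyc j)))) (trans (cong ∣_∣ same) (proj₁ (proj₂ (cyc i))))))
    (trans (sym (proj₂ (proj₂ (cyc j)) w (subst (w ∈ₛ_) (sym same) (point∈ i x))))
        (proj₂ (proj₂ (cyc i)) w (point∈ i x)))
    same
    where
    w = v⟦ base i ↷ x ⟧
    j = index w
    same : assigned .assign j ≡ assigned .assign i
    same = trans (proj₂ (orbit-index w)) (sym (cycle≡orbit (σ L) (proj₁ (cyc i)) (point∈ i x)))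

-- Peeling off one cycle

-- xᵘ is replaced by F u.
eval : Poly → (ℕ → ℕ) → ℕ
eval []      F = 0
eval (x ∷ p) F = x * F 0 + eval p (F ∘ suc)

eval-cong : ∀ p {F G} → F ≗ G → eval p F ≡ eval p G
eval-cong []      F≗G = refl
eval-cong (x ∷ p) F≗G = cong₂ _+_ (cong (x *_) (F≗G 0)) (eval-cong p (F≗G ∘ suc))

eval-+ₚ : ∀ p q F → eval (p +ₚ q) F ≡ eval p F + eval q F
eval-+ₚ []      q       F = refl
eval-+ₚ (x ∷ p) []      F = sym (ℕ.+-identityʳ _)
eval-+ₚ (x ∷ p) (y ∷ q) F =
  trans (cong ((x + y) * F 0 +_) (eval-+ₚ p q (F ∘ suc))) (eq x y (F 0) _ _)
  where
  eq : ∀ x y z a b → (x + y) * z + (a + b) ≡ x * z + a + (y * z + b)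
  eq = solve-∀

eval-map : ∀ x q F → eval (map (x *_) q) F ≡ x * eval q F
eval-map x []      F = sym (ℕ.*-zeroʳ x)
eval-map x (y ∷ q) F = trans (cong (x * y * F 0 +_) (eval-map x q (F ∘ suc))) (eq x y (F 0) _)
  where
  eq : ∀ x y z a → x * y * z + x * a ≡ x * (y * z + a)
  eq = solve-∀

eval-*ₚ : ∀ p q F → eval (p *ₚ q) F ≡ eval p (λ i → eval q (λ j → F (i + j)))
eval-*ₚ []      q F = refl
eval-*ₚ (x ∷ p) q F = trans (eval-+ₚ (map (x *_) q) (0 ∷ p *ₚ q) F)
  (cong₂ _+_ (eval-map x q F) (eval-*ₚ p q (F ∘ suc)))

eval-coeff : ∀ p n F → (∀ u → n ≤ u → F u ≡ 0) → eval p F ≡ ∑ {n} (λ u → coeff p (toℕ u) * F (toℕ u))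
eval-coeff []      n F F≡0 = sym (∑-zero {n} _ λ _ → refl)
eval-coeff (x ∷ p) zero F F≡0 = cong₂ _+_ (trans (cong (x *_) (F≡0 0 z≤n)) (ℕ.*-zeroʳ x))
  (eval-coeff p zero (F ∘ suc) (λ u _ → F≡0 (suc u) z≤n))
eval-coeff (x ∷ p) (suc n) F F≡0 =
  cong (x * F 0 +_) (eval-coeff p n (F ∘ suc) (λ u n≤u → F≡0 (suc u) (s≤s n≤u)))

∑ᴸ-bools : ∀ {A : Set} (f : A → ℕ) (k : Bool → List A) →
           ∑ᴸ (k true ++ (k false ++ [])) f ≡ ∑ᴸ (k true) f + ∑ᴸ (k false) f
∑ᴸ-bools f k = trans (∑ᴸ-++ (k true) _ f)
  (cong (∑ᴸ (k true) f +_) (trans (∑ᴸ-++ (k false) [] f) (ℕ.+-identityʳ _)))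

∑ᴸ-bitVectors-suc : ∀ {n} (f : Vec Bool (suc n) → ℕ) →
  ∑ᴸ (bitVectors (suc n)) f ≡ ∑ᴸ (bitVectors n) (f ∘ (true ∷_)) + ∑ᴸ (bitVectors n) (f ∘ (false ∷_))
∑ᴸ-bitVectors-suc {n} f = trans (∑ᴸ-bools f (λ b → map (b ∷_) (bitVectors n)))
  (cong₂ _+_ (∑ᴸ-map (true ∷_) (bitVectors n) f) (∑ᴸ-map (false ∷_) (bitVectors n) f))

-- On a cycle with two more points the new bit stands for the differences 1 and -1, and the bits
-- `xs` stand for their old differences up to half the length, raised by one.
loopDegree-∷ : ∀ p x (xs : Loop p) → loopDegree {2 + p} (x ∷ xs) ≡ bit x + bit x + loopDegree {p} xs
loopDegree-∷ p x xs = begin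
  ∑ {suc (suc p)} (λ z → f (suc (toℕ z)))
    ≡⟨ ∑-last (suc p) (f ∘ suc) ⟩
  bit x + ∑ {p} (λ z → f (suc (suc (toℕ z)))) + f (suc (suc p))
    ≡⟨ cong₂ _+_ (cong (bit x +_) (sum-cong-≗ {p} λ z → cong bit (inner z (Fin.toℕ<n z)))) (cong bit last) ⟩
  bit x + ∑ {p} (λ z → bit (loop {p} xs (suc (toℕ z)))) + bit x
    ≡⟨ eq (bit x) _ ⟩
  bit x + bit x + ∑ {p} (λ z → bit (loop {p} xs (suc (toℕ z)))) ∎
  where
  f : ℕ → ℕ
  f z = bit (loop {2 + p} (x ∷ xs) z)
  eq : ∀ x s → x + s + x ≡ x + x + s
  eq = solve-∀
  last : loop {2 + p} (x ∷ xs) (suc (suc p)) ≡ x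
  last rewrite ℕ.m+n∸n≡m 1 p = refl
  inner : ∀ {p} {xs : Loop p} (z : Fin p) → toℕ z < p →
          loop {2 + p} (x ∷ xs) (suc (suc (toℕ z))) ≡ loop {p} xs (suc (toℕ z))
  inner {suc p} {xs} z (s≤s z≤p) rewrite ℕ.+-∸-assoc 2 z≤p | ℕ.+-∸-assoc 1 z≤p = refl

ε-+2 : ∀ a → ε (2 + a) ≡ ε a
ε-+2 a = 𝟙-cong (2 ∣? (2 + a)) (2 ∣? a) (λ 2∣ → ∣m+n∣m⇒∣n 2∣ ∣-refl) (∣m∣n⇒∣m+n ∣-refl)

-- Two more points on the cycle add one opposite pair of differences, hence a factor 1 + x². Length
-- 1 gives 1, and length 2 gives 1 + x, because the difference 1 is its own negative there.
∑ᴸ-loops : ∀ p F → ∑ᴸ (bitVectors ⌊ suc p /2⌋) (λ xs → F (loopDegree {p} xs)) ≡ eval (P (suc p)) F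
∑ᴸ-loops zero          F = eq (F 0)
  where
  eq : ∀ x → x + 0 ≡ 1 * x + 0
  eq = solve-∀
∑ᴸ-loops (suc zero)    F = eq (F 0) (F 1)
  where
  eq : ∀ x y → y + (x + 0) ≡ 1 * x + (1 * y + 0)
  eq = solve-∀
∑ᴸ-loops (suc (suc p)) F = begin
  ∑ᴸ (bitVectors (suc ⌊ suc p /2⌋)) (λ xs → F (loopDegree {2 + p} xs))
    ≡⟨ ∑ᴸ-bitVectors-suc (λ xs → F (loopDegree {2 + p} xs)) ⟩
  ∑ᴸ bvs (λ xs → F (loopDegree {2 + p} (true ∷ xs))) + ∑ᴸ bvs (λ xs → F (loopDegree {2 + p} (false ∷ xs)))
    ≡⟨ cong₂ _+_ (∑ᴸ-cong bvs (λ xs → cong F (loopDegree-∷ p true xs)))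
                 (∑ᴸ-cong bvs (λ xs → cong F (loopDegree-∷ p false xs))) ⟩
  ∑ᴸ bvs (λ xs → F (2 + loopDegree {p} xs)) + ∑ᴸ bvs (λ xs → F (loopDegree {p} xs))
    ≡⟨ cong₂ _+_ (∑ᴸ-loops p (F ∘ (2 +_))) (∑ᴸ-loops p F) ⟩
  eval (P (suc p)) (F ∘ (2 +_)) + eval (P (suc p)) F
    ≡⟨ eq (eval (P (suc p)) F) _ ⟨
  eval (1 ∷ 0 ∷ 1 ∷ []) (λ i → eval (P (suc p)) (λ j → F (i + j)))
    ≡⟨ eval-cong (1 ∷ 0 ∷ 1 ∷ []) (λ i → eval-*ₚ (q ^ₚ (p / 2)) (e (suc p)) (λ j → F (i + j))) ⟩
  eval (1 ∷ 0 ∷ 1 ∷ []) (λ i → eval (q ^ₚ (p / 2)) (λ j → eval (e (suc p)) (λ k → F (i + (j + k)))))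
    ≡⟨ eval-cong (1 ∷ 0 ∷ 1 ∷ []) (λ i → eval-cong (q ^ₚ (p / 2)) λ j → eval-cong (e (suc p))
         λ k → cong F (sym (ℕ.+-assoc i j k))) ⟩
  eval (1 ∷ 0 ∷ 1 ∷ []) (λ i → eval (q ^ₚ (p / 2)) (λ j → eval (e (suc p)) (λ k → F (i + j + k))))
    ≡⟨ eval-*ₚ q (q ^ₚ (p / 2)) _ ⟨
  eval (q ^ₚ suc (p / 2)) (λ i → eval (e (suc p)) (λ k → F (i + k)))
    ≡⟨ eval-*ₚ (q ^ₚ suc (p / 2)) (e (suc p)) F ⟨
  eval (q ^ₚ suc (p / 2) *ₚ e (suc p)) F
    ≡⟨ cong₂ (λ k t → eval (q ^ₚ k *ₚ (1 ∷ 1 ∷ []) ^ₚ t) F)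
         (m/n≡1+[m∸n]/n {2 + p} {2} (s≤s (s≤s z≤n))) (ε-+2 (suc p)) ⟨
  eval (P (3 + p)) F ∎
  where
  bvs = bitVectors ⌊ suc p /2⌋
  q = 1 ∷ 0 ∷ 1 ∷ []
  e : ℕ → Poly
  e a = (1 ∷ 1 ∷ []) ^ₚ ε a
  eq : ∀ x y → 1 * x + (0 + (1 * y + 0)) ≡ y + x
  eq = solve-∀

pascal : ∀ n (F : ℕ → ℕ) → ∑ {2 + n} (λ k → (suc n C toℕ k) * F (toℕ k)) ≡
         ∑ {suc n} (λ k → (n C toℕ k) * F (suc (toℕ k))) + ∑ {suc n} (λ k → (n C toℕ k) * F (toℕ k))
pascal n F = begin
  1 * F 0 + ∑ {suc n} (λ k → (suc n C suc (toℕ k)) * F (suc (toℕ k)))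
    ≡⟨ cong (1 * F 0 +_) (sum-cong-≗ {suc n} λ k → trans
         (cong (_* F (suc (toℕ k))) (sym (nCk+nC[k+1]≡[n+1]C[k+1] n (toℕ k))))
         (ℕ.*-distribʳ-+ (F (suc (toℕ k))) (n C toℕ k) _)) ⟩
  1 * F 0 + ∑ {suc n} (λ k → low (toℕ k) + high (toℕ k))
    ≡⟨ cong (1 * F 0 +_) (∑-distrib-+ {suc n} (low ∘ toℕ) (high ∘ toℕ)) ⟩
  1 * F 0 + (∑ {suc n} (low ∘ toℕ) + ∑ {suc n} (high ∘ toℕ))
    ≡⟨ eq (1 * F 0) (∑ {suc n} (low ∘ toℕ)) _ ⟩
  ∑ {suc n} (low ∘ toℕ) + ∑ {2 + n} (λ k → (n C toℕ k) * F (toℕ k))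
    ≡⟨ cong (∑ {suc n} (low ∘ toℕ) +_) (∑-truncate (λ k → (n C k) * F k) (ℕ.n≤1+n (suc n))
         λ k n<k → cong (_* F k) (k>n⇒nCk≡0 n<k)) ⟩
  ∑ {suc n} (low ∘ toℕ) + ∑ {suc n} (λ k → (n C toℕ k) * F (toℕ k)) ∎
  where
  low high : ℕ → ℕ
  low  k = (n C k) * F (suc k)
  high k = (n C suc k) * F (suc k)
  eq : ∀ x a b → x + (a + b) ≡ a + (x + b)
  eq = solve-∀

∑ᴸ-bitVectors : ∀ n F → ∑ᴸ (bitVectors n) (F ∘ ∥_∥) ≡ ∑ {suc n} (λ k → (n C toℕ k) * F (toℕ k))
∑ᴸ-bitVectors zero    F = eq (F 0)
  where
  eq : ∀ x → x + 0 ≡ 1 * x + 0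
  eq = solve-∀
∑ᴸ-bitVectors (suc n) F = begin
  ∑ᴸ (bitVectors (suc n)) (F ∘ ∥_∥)
    ≡⟨ ∑ᴸ-bitVectors-suc {n} (F ∘ ∥_∥) ⟩
  ∑ᴸ (bitVectors n) (F ∘ suc ∘ ∥_∥) + ∑ᴸ (bitVectors n) (F ∘ ∥_∥)
    ≡⟨ cong₂ _+_ (∑ᴸ-bitVectors n (F ∘ suc)) (∑ᴸ-bitVectors n F) ⟩
  ∑ {suc n} (λ k → (n C toℕ k) * F (suc (toℕ k))) + ∑ {suc n} (λ k → (n C toℕ k) * F (toℕ k))
    ≡⟨ pascal n F ⟨
  ∑ {2 + n} (λ k → (suc n C toℕ k) * F (toℕ k)) ∎

-- Sums over the sizes of the difference sets

K⁺ : ℕ → ℕ → ℕ → ℕ → ℕ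
K⁺ p q r s = K (suc p) (suc q) r s

module _ (p q : ℕ) where

  private
    a = suc p
    b = suc q

    α≢0 : NonZero (α a b)
    α≢0 = ≢-nonZero (n/gcd[m,n]≢0 a b {{_}} {{gcd⁺≢0 p q}})
    β≢0 : NonZero (β a b)
    β≢0 = ≢-nonZero (m/gcd[m,n]≢0 a b {{_}} {{gcd⁺≢0 p q}})

    *≤⇒≤/ : ∀ k m n .(m≢0 : NonZero m) → k * m ≤ n → k ≤ (n / m) {{m≢0}}
    *≤⇒≤/ k m n m≢0 km≤n = subst (_≤ (n / m) {{m≢0}}) (m*n/n≡m k m {{m≢0}}) (/-monoˡ-≤ m {{m≢0}} km≤n)

  ≤K : ∀ {r s k} → k ≤ gcd⁺ p q → k * α a b ≤ r → k * β a b ≤ s → k ≤ K⁺ p q r s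
  ≤K {r} {s} {k} k≤g kα≤r kβ≤s =
    ℕ.⊓-glb (ℕ.⊓-glb k≤g (*≤⇒≤/ k (α a b) r α≢0 kα≤r)) (*≤⇒≤/ k (β a b) s β≢0 kβ≤s)

  K≤gcd : ∀ r s → K⁺ p q r s ≤ gcd⁺ p q
  K≤gcd r s = ℕ.≤-trans (ℕ.m⊓n≤m _ _) (ℕ.m⊓n≤m _ _)

  K*β≤ : ∀ r s {k} → k ≤ K⁺ p q r s → k * β a b ≤ s
  K*β≤ r s {k} k≤K = ℕ.≤-trans
    (ℕ.*-monoˡ-≤ (β a b) (ℕ.≤-trans k≤K (ℕ.m⊓n≤n _ ((s / β a b) {{β≢0}}))))
    (m/n*n≤m s (β a b) {{β≢0}})

  K-0ˡ : ∀ s → K⁺ p q 0 s ≡ 0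
  K-0ˡ s = ℕ.n≤0⇒n≡0 (ℕ.≤-trans (ℕ.m⊓n≤m _ _) (ℕ.≤-trans (ℕ.m⊓n≤n (gcd⁺ p q) _)
    (ℕ.≤-reflexive (0/n≡0 (α a b) {{α≢0}}))))

  K-0ʳ : ∀ r → K⁺ p q r 0 ≡ 0
  K-0ʳ r = ℕ.n≤0⇒n≡0 (ℕ.≤-trans (ℕ.m⊓n≤n _ _) (ℕ.≤-reflexive (0/n≡0 (β a b) {{β≢0}})))

-- Each size is weighted by the number of difference sets of that size. The range ends at `K`, not
-- at the gcd, so that the sizes are indexed exactly like the entries of an allocation.
∑ᴷ : ∀ {n} (p r : ℕ) (qs ss : Vec ℕ n) → (Vec ℕ n → ℕ) → ℕ
∑ᴷ p r []       []       f = f []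
∑ᴷ p r (q ∷ qs) (s ∷ ss) f =
  ∑ {suc (K⁺ p q r s)} (λ k → (gcd⁺ p q C toℕ k) * ∑ᴷ p r qs ss (λ ks → f (toℕ k ∷ ks)))

data Bounded (p r : ℕ) : ∀ {n} → (qs ss ks : Vec ℕ n) → Set where
  []  : Bounded p r [] [] []
  _∷_ : ∀ {n q s k} {qs ss ks : Vec ℕ n} → k ≤ K⁺ p q r s → Bounded p r qs ss ks →
        Bounded p r (q ∷ qs) (s ∷ ss) (k ∷ ks)

∑ᴷ-cong : ∀ {n} p r (qs ss : Vec ℕ n) {f g} → (∀ {ks} → Bounded p r qs ss ks → f ks ≡ g ks) →
          ∑ᴷ p r qs ss f ≡ ∑ᴷ p r qs ss g
∑ᴷ-cong p r []       []       f≗g = f≗g []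
∑ᴷ-cong p r (q ∷ qs) (s ∷ ss) f≗g = sum-cong-≗ {suc (K⁺ p q r s)} λ k → cong ((gcd⁺ p q C toℕ k) *_)
  (∑ᴷ-cong p r qs ss λ b → f≗g (Fin.toℕ≤pred[n] k ∷ b))

-- The truncated subtraction is exact for sizes satisfying `Bounded`, since `K` is at most `s / β`.
residual : ∀ {n} → ℕ → (qs ss ks : Vec ℕ n) → Vec ℕ n
residual p qs ss ks = zipWith _∸_ ss (columnDegrees p qs ks)

data _≼_ : ∀ {n} → Vec ℕ n → Vec ℕ n → Set where
  []  : [] ≼ []
  _∷_ : ∀ {n x y} {xs ys : Vec ℕ n} → x ≤ y → xs ≼ ys → (x ∷ xs) ≼ (y ∷ ys)

bounded⇒≼ : ∀ {n p r} {qs ss ks : Vec ℕ n} → Bounded p r qs ss ks → columnDegrees p qs ks ≼ ss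
bounded⇒≼ []                                  = []
bounded⇒≼ {p = p} {r} {q ∷ _} {s ∷ _} (k≤ ∷ b) = K*β≤ p q r s k≤ ∷ bounded⇒≼ b

≼-zipWith-+ : ∀ {n} (xs ys : Vec ℕ n) → xs ≼ zipWith _+_ xs ys
≼-zipWith-+ []       []       = []
≼-zipWith-+ (x ∷ xs) (y ∷ ys) = ℕ.m≤m+n x y ∷ ≼-zipWith-+ xs ys

zipWith-+∸ : ∀ {n} (xs ys : Vec ℕ n) → zipWith _∸_ (zipWith _+_ xs ys) xs ≡ ys
zipWith-+∸ []       []       = refl
zipWith-+∸ (x ∷ xs) (y ∷ ys) = cong₂ _∷_ (ℕ.m+n∸m≡n x y) (zipWith-+∸ xs ys)

≼⇒zipWith-∸+ : ∀ {n} {xs ys : Vec ℕ n} → xs ≼ ys → zipWith _+_ xs (zipWith _∸_ ys xs) ≡ ys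
≼⇒zipWith-∸+ []         = refl
≼⇒zipWith-∸+ (x≤y ∷ le) = cong₂ _∷_ (ℕ.m+[n∸m]≡n x≤y) (≼⇒zipWith-∸+ le)

∑ᴸ-zero : ∀ {A : Set} (xs : List A) {f} → (∀ x → f x ≡ 0) → ∑ᴸ xs f ≡ 0
∑ᴸ-zero []       f≡0 = refl
∑ᴸ-zero (x ∷ xs) f≡0 = cong₂ _+_ (f≡0 x) (∑ᴸ-zero xs f≡0)

-- Terms with some k above K vanish, because they exceed a degree.
∑ᴸ-links : ∀ {n} p r (qs ss : Vec ℕ n) F →
           (∀ ks → ¬ (rowDegree p qs ks ≤ r × columnDegrees p qs ks ≼ ss) → F ks ≡ 0) →
           ∑ᴸ (allLinks p qs) (F ∘ sizes qs) ≡ ∑ᴷ p r qs ss F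
∑ᴸ-links p r []       []       F F≡0 = ℕ.+-identityʳ (F [])
∑ᴸ-links p r (q ∷ qs) (s ∷ ss) F F≡0 = begin
  ∑ᴸ (cartesianProduct (bitVectors g) (allLinks p qs)) (F ∘ sizes (q ∷ qs))
    ≡⟨ ∑ᴸ-cartesianProduct (bitVectors g) (allLinks p qs) _ ⟩
  ∑ᴸ (bitVectors g) (G ∘ ∥_∥)
    ≡⟨ ∑ᴸ-bitVectors g G ⟩
  ∑ {suc g} (λ k → (g C toℕ k) * G (toℕ k))
    ≡⟨ ∑-truncate (λ k → (g C k) * G k) (s≤s (K≤gcd p q r s)) large ⟩
  ∑ {suc (K⁺ p q r s)} (λ k → (g C toℕ k) * G (toℕ k))
    ≡⟨ sum-cong-≗ {suc (K⁺ p q r s)} (λ k → cong ((g C toℕ k) *_)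
         (∑ᴸ-links p r qs ss (λ ks → F (toℕ k ∷ ks)) λ ks ¬ok → F≡0 (toℕ k ∷ ks)
           λ { (row≤ , _ ∷ cols≼) → ¬ok (ℕ.m+n≤o⇒n≤o (toℕ k * α (suc p) (suc q)) row≤ , cols≼) })) ⟩
  ∑ᴷ p r (q ∷ qs) (s ∷ ss) F ∎
  where
  g = gcd⁺ p q
  G : ℕ → ℕ
  G k = ∑ᴸ (allLinks p qs) (λ Bs → F (k ∷ sizes qs Bs))
  large : ∀ k → K⁺ p q r s < k → (g C k) * G k ≡ 0
  large k K<k with k ≤? g
  ... | no  k≰g = cong (_* G k) (k>n⇒nCk≡0 (ℕ.≰⇒> k≰g))
  ... | yes k≤g = trans (cong ((g C k) *_) (∑ᴸ-zero (allLinks p qs) λ Bs → F≡0 (k ∷ sizes qs Bs)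
        λ { (row≤ , col≤ ∷ _) → ℕ.<⇒≱ K<k (≤K p q k≤g (ℕ.m+n≤o⇒m≤o (k * α (suc p) (suc q)) row≤) col≤) }))
        (ℕ.*-zeroʳ (g C k))

𝟙-× : ∀ {A B C : Set} (a? : Dec A) (b? : Dec B) (c? : Dec C) → (A → B → C) → (C → A × B) →
      𝟙 c? ≡ 𝟙 a? * 𝟙 b?
𝟙-× (yes a) (yes b) c? f g = 𝟙-yes c? (f a b)
𝟙-× (yes a) (no ¬b) c? f g = 𝟙-no c? (¬b ∘ proj₂ ∘ g)
𝟙-× (no ¬a) b?      c? f g = 𝟙-no c? (¬a ∘ proj₁ ∘ g)

count-∷ : ∀ {n} p r (ps rs : Vec ℕ n) → count (p ∷ ps) (r ∷ rs) ≡
  ∑ {suc r} (λ u → I (suc p) (toℕ u) *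
    ∑ᴷ p r ps rs (λ ks → 𝟙 (toℕ u + rowDegree p ps ks ≟ r) * count ps (residual p ps rs ks)))
count-∷ p r ps rs = begin
  count (p ∷ ps) (r ∷ rs)
    ≡⟨ length-filter (λ c → degrees (p ∷ ps) c ≟ᵥ (r ∷ rs)) (codes (p ∷ ps)) ⟩
  ∑ᴸ (codes (p ∷ ps)) (λ c → 𝟙 (degrees (p ∷ ps) c ≟ᵥ (r ∷ rs)))
    ≡⟨ ∑ᴸ-cartesianProduct loops (cartesianProduct (allLinks p ps) (codes ps)) _ ⟩
  ∑ᴸ loops (λ xs → ∑ᴸ (cartesianProduct (allLinks p ps) (codes ps)) _)
    ≡⟨ ∑ᴸ-cong loops (λ xs → ∑ᴸ-cartesianProduct (allLinks p ps) (codes ps) _) ⟩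
  ∑ᴸ loops (λ xs → ∑ᴸ (allLinks p ps) (G (loopDegree {p} xs) ∘ sizes ps))
    ≡⟨ ∑ᴸ-cong loops (λ xs → ∑ᴸ-links p r ps rs (G (loopDegree {p} xs)) (G≡0 (loopDegree {p} xs))) ⟩
  ∑ᴸ loops (λ xs → ∑ᴷ p r ps rs (G (loopDegree {p} xs)))
    ≡⟨ ∑ᴸ-cong loops (λ xs → ∑ᴷ-cong p r ps rs λ {ks} → G≡ (loopDegree {p} xs) ks) ⟩
  ∑ᴸ loops (F ∘ loopDegree {p})
    ≡⟨ ∑ᴸ-loops p F ⟩
  eval (P (suc p)) F
    -- The loop degree alone cannot exceed `r`, so only the coefficients up to `r` contribute.
    ≡⟨ eval-coeff (P (suc p)) (suc r) F F≡0 ⟩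
  ∑ {suc r} (λ u → I (suc p) (toℕ u) * F (toℕ u)) ∎
  where
  loops = bitVectors ⌊ suc p /2⌋
  G : ℕ → Vec ℕ _ → ℕ
  G u ks = ∑ᴸ (codes ps) (λ c →
    𝟙 ((u + rowDegree p ps ks ∷ zipWith _+_ (columnDegrees p ps ks) (degrees ps c)) ≟ᵥ (r ∷ rs)))
  G≡0 : ∀ u ks → ¬ (rowDegree p ps ks ≤ r × columnDegrees p ps ks ≼ rs) → G u ks ≡ 0
  G≡0 u ks ¬ok = ∑ᴸ-zero (codes ps) λ c → 𝟙-no
      ((u + rowDegree p ps ks ∷ zipWith _+_ (columnDegrees p ps ks) (degrees ps c)) ≟ᵥ (r ∷ rs)) λ { refl →
    ¬ok (ℕ.m≤n+m (rowDegree p ps ks) u , ≼-zipWith-+ (columnDegrees p ps ks) (degrees ps c)) }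
  F : ℕ → ℕ
  F u = ∑ᴷ p r ps rs (λ ks → 𝟙 (u + rowDegree p ps ks ≟ r) * count ps (residual p ps rs ks))
  G≡ : ∀ u ks → Bounded p r ps rs ks →
       G u ks ≡ 𝟙 (u + rowDegree p ps ks ≟ r) * count ps (residual p ps rs ks)
  G≡ u ks b = begin
    G u ks
      -- Under the bound, adding and subtracting the column degrees are inverse, so the equation of
      -- degree vectors splits into one for the pivot and one for the other cycles.
      ≡⟨ ∑ᴸ-cong (codes ps) (λ c → 𝟙-× (u + rowDegree p ps ks ≟ r) (degrees ps c ≟ᵥ residual p ps rs ks)
           ((u + rowDegree p ps ks ∷ zipWith _+_ cols (degrees ps c)) ≟ᵥ (r ∷ rs))
           (λ e e′ → cong₂ _∷_ e (trans (cong (zipWith _+_ cols) e′) (≼⇒zipWith-∸+ (bounded⇒≼ b))))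
           (λ e → proj₁ (∷-injective e) , trans (sym (zipWith-+∸ cols (degrees ps c)))
                    (cong (λ xs → zipWith _∸_ xs cols) (proj₂ (∷-injective e))))) ⟩
    ∑ᴸ (codes ps) (λ c → 𝟙 (u + rowDegree p ps ks ≟ r) * 𝟙 (degrees ps c ≟ᵥ residual p ps rs ks))
      ≡⟨ ∑ᴸ-*ˡ (𝟙 (u + rowDegree p ps ks ≟ r)) (codes ps) _ ⟩
    𝟙 (u + rowDegree p ps ks ≟ r) * ∑ᴸ (codes ps) (λ c → 𝟙 (degrees ps c ≟ᵥ residual p ps rs ks))
      ≡⟨ cong (𝟙 (u + rowDegree p ps ks ≟ r) *_)
          (length-filter (λ c → degrees ps c ≟ᵥ residual p ps rs ks) (codes ps)) ⟨
    𝟙 (u + rowDegree p ps ks ≟ r) * count ps (residual p ps rs ks) ∎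
    where cols = columnDegrees p ps ks
  ∑ᴷ-zero : ∀ {n} (ps rs : Vec ℕ n) {f} → (∀ ks → f ks ≡ 0) → ∑ᴷ p r ps rs f ≡ 0
  ∑ᴷ-zero []       []       f≡0 = f≡0 []
  ∑ᴷ-zero (q ∷ qs) (s ∷ ss) f≡0 = ∑-zero {suc (K⁺ p q r s)} _ λ k →
    trans (cong ((gcd⁺ p q C toℕ k) *_) (∑ᴷ-zero qs ss λ ks → f≡0 (toℕ k ∷ ks))) (ℕ.*-zeroʳ (gcd⁺ p q C toℕ k))
  F≡0 : ∀ u → r < u → F u ≡ 0
  F≡0 u r<u = ∑ᴷ-zero ps rs λ ks → cong (_* count ps (residual p ps rs ks))
    (𝟙-no (u + rowDegree p ps ks ≟ r) λ e → ℕ.<⇒≱ r<u (ℕ.m+n≤o⇒m≤o u (ℕ.≤-reflexive e)))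

-- Cycles of residual degree 0

coeff₀-* : ∀ p q → coeff (p *ₚ q) 0 ≡ coeff p 0 * coeff q 0
coeff₀-* []      q       = refl
coeff₀-* (x ∷ p) []      = sym (ℕ.*-zeroʳ x)
coeff₀-* (x ∷ p) (y ∷ q) = ℕ.+-identityʳ (x * y)

I₀ : ∀ a → I a 0 ≡ 1
I₀ a = trans (coeff₀-* ((1 ∷ 0 ∷ 1 ∷ []) ^ₚ ((a ∸ 1) / 2)) _) (cong₂ _*_
  (coeff₀-^ (1 ∷ 0 ∷ 1 ∷ []) refl ((a ∸ 1) / 2)) (coeff₀-^ (1 ∷ 1 ∷ []) refl (ε a)))
  where
  coeff₀-^ : ∀ p → coeff p 0 ≡ 1 → ∀ n → coeff (p ^ₚ n) 0 ≡ 1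
  coeff₀-^ p e zero    = refl
  coeff₀-^ p e (suc n) = trans (coeff₀-* p (p ^ₚ n)) (cong₂ _*_ e (coeff₀-^ p e n))

-- An entry of degree 0 may be omitted but need not be. The relation therefore survives passage to
-- residual degrees, which can create further zeros.
data Omits : ∀ {n m} (ps rs : Vec ℕ n) (ps′ rs′ : Vec ℕ m) → Set where
  []   : Omits [] [] [] []
  keep : ∀ {n m p r} {ps rs : Vec ℕ n} {ps′ rs′ : Vec ℕ m} →
         Omits ps rs ps′ rs′ → Omits (p ∷ ps) (r ∷ rs) (p ∷ ps′) (r ∷ rs′)
  omit : ∀ {n m p} {ps rs : Vec ℕ n} {ps′ rs′ : Vec ℕ m} →
         Omits ps rs ps′ rs′ → Omits (p ∷ ps) (0 ∷ rs) ps′ rs′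

omit-≡ : ∀ {n m p r} {ps rs : Vec ℕ n} {ps′ rs′ : Vec ℕ m} → r ≡ 0 →
         Omits ps rs ps′ rs′ → Omits (p ∷ ps) (r ∷ rs) ps′ rs′
omit-≡ refl = omit

keep-≡ : ∀ {n m p r r′} {ps rs : Vec ℕ n} {ps′ rs′ : Vec ℕ m} → r ≡ r′ →
         Omits ps rs ps′ rs′ → Omits (p ∷ ps) (r ∷ rs) (p ∷ ps′) (r′ ∷ rs′)
keep-≡ refl = keep

-- For a cycle of degree 0 the bound `K` is 0; its only size is 0, with weight 1 and no contribution
-- to the row.
∑ᴷ-omits : ∀ {n m} p r {ps rs : Vec ℕ n} {ps′ rs′ : Vec ℕ m} {f f′} → Omits ps rs ps′ rs′ →
          (∀ ks ks′ → rowDegree p ps ks ≡ rowDegree p ps′ ks′ →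
            Omits ps (residual p ps rs ks) ps′ (residual p ps′ rs′ ks′) → f ks ≡ f′ ks′) →
          ∑ᴷ p r ps rs f ≡ ∑ᴷ p r ps′ rs′ f′
∑ᴷ-omits p r [] f≡f′ = f≡f′ [] [] refl []
∑ᴷ-omits p r {q ∷ _} {s ∷ _} (keep D) f≡f′ = sum-cong-≗ {suc (K⁺ p q r s)} λ k →
  cong ((gcd⁺ p q C toℕ k) *_) (∑ᴷ-omits p r D λ ks ks′ row D′ →
    f≡f′ (toℕ k ∷ ks) (toℕ k ∷ ks′) (cong (toℕ k * α (suc p) (suc q) +_) row) (keep D′))
∑ᴷ-omits p r {q ∷ ps} {_ ∷ rs} {ps′} {rs′} {f} {f′} (omit D) f≡f′ = begin
  ∑ {suc (K⁺ p q r 0)} (term ∘ toℕ)            ≡⟨ cong (λ K → ∑ {suc K} (term ∘ toℕ)) (K-0ʳ p q r) ⟩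
  1 * ∑ᴷ p r ps rs (λ ks → f (0 ∷ ks)) + 0     ≡⟨ trans (ℕ.+-identityʳ _) (ℕ.*-identityˡ _) ⟩
  ∑ᴷ p r ps rs (λ ks → f (0 ∷ ks))             ≡⟨ ∑ᴷ-omits p r D (λ ks ks′ row D′ → f≡f′ (0 ∷ ks) ks′ row (omit D′)) ⟩
  ∑ᴷ p r ps′ rs′ f′                            ∎
  where
  term : ℕ → ℕ
  term k = (gcd⁺ p q C k) * ∑ᴷ p r ps rs (λ ks → f (k ∷ ks))

∑ᴷ-0 : ∀ {n} p (ps rs : Vec ℕ n) f → ∑ᴷ p 0 ps rs f ≡ f (replicate n 0)
∑ᴷ-0 p []       []       f = refl
∑ᴷ-0 {suc n} p (q ∷ ps) (s ∷ rs) f = begin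
  ∑ {suc (K⁺ p q 0 s)} (term ∘ toℕ)            ≡⟨ cong (λ K → ∑ {suc K} (term ∘ toℕ)) (K-0ˡ p q s) ⟩
  1 * ∑ᴷ p 0 ps rs (λ ks → f (0 ∷ ks)) + 0     ≡⟨ trans (ℕ.+-identityʳ _) (ℕ.*-identityˡ _) ⟩
  ∑ᴷ p 0 ps rs (λ ks → f (0 ∷ ks))             ≡⟨ ∑ᴷ-0 p ps rs (λ ks → f (0 ∷ ks)) ⟩
  f (replicate (suc n) 0)                      ∎
  where
  term : ℕ → ℕ
  term k = (gcd⁺ p q C k) * ∑ᴷ p 0 ps rs (λ ks → f (k ∷ ks))

count-0 : ∀ {n} p (ps rs : Vec ℕ n) → count (p ∷ ps) (0 ∷ rs) ≡ count ps rs
count-0 {n} p ps rs = begin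
  count (p ∷ ps) (0 ∷ rs)
    ≡⟨ count-∷ p 0 ps rs ⟩
  I (suc p) 0 * ∑ᴷ p 0 ps rs F + 0
    ≡⟨ trans (ℕ.+-identityʳ _) (cong₂ _*_ (I₀ (suc p)) (∑ᴷ-0 p ps rs F)) ⟩
  1 * (𝟙 (rowDegree p ps (replicate n 0) ≟ 0) * count ps (residual p ps rs (replicate n 0)))
    ≡⟨ trans (ℕ.*-identityˡ _) (cong₂ _*_ (𝟙-yes (rowDegree p ps (replicate n 0) ≟ 0) (row ps))
        (cong (count ps) (res ps rs))) ⟩
  1 * count ps rs
    ≡⟨ ℕ.*-identityˡ _ ⟩
  count ps rs ∎
  where
  F : Vec ℕ n → ℕ
  F ks = 𝟙 (rowDegree p ps ks ≟ 0) * count ps (residual p ps rs ks)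
  row : ∀ {n} (ps : Vec ℕ n) → rowDegree p ps (replicate n 0) ≡ 0
  row []       = refl
  row (q ∷ ps) = row ps
  res : ∀ {n} (ps rs : Vec ℕ n) → residual p ps rs (replicate n 0) ≡ rs
  res []       []       = refl
  res (q ∷ ps) (r ∷ rs) = cong (r ∷_) (res ps rs)

-- The induction is on the vector of lengths and not on the derivation: in the case `keep` the first
-- cycle is peeled off on both sides, and `D′` relates residual degrees that do not occur in `D`.
count-omits : ∀ {n m} {ps rs : Vec ℕ n} {ps′ rs′ : Vec ℕ m} → Omits ps rs ps′ rs′ → count ps rs ≡ count ps′ rs′
count-omits [] = refl
count-omits {ps = p ∷ ps} {_ ∷ rs} (omit D) = trans (count-0 p ps rs) (count-omits D)
count-omits {ps = p ∷ ps} {r ∷ rs} {_ ∷ ps′} {_ ∷ rs′} (keep D) = begin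
  count (p ∷ ps) (r ∷ rs)
    ≡⟨ count-∷ p r ps rs ⟩
  ∑ {suc r} (λ u → I (suc p) (toℕ u) *
    ∑ᴷ p r ps rs (λ ks → 𝟙 (toℕ u + rowDegree p ps ks ≟ r) * count ps (residual p ps rs ks)))
    ≡⟨ sum-cong-≗ {suc r} (λ u → cong (I (suc p) (toℕ u) *_) (∑ᴷ-omits p r D λ ks ks′ row D′ →
         cong₂ (λ t c → 𝟙 (toℕ u + t ≟ r) * c) row (count-omits D′))) ⟩
  ∑ {suc r} (λ u → I (suc p) (toℕ u) *
    ∑ᴷ p r ps′ rs′ (λ ks → 𝟙 (toℕ u + rowDegree p ps′ ks ≟ r) * count ps′ (residual p ps′ rs′ ks)))
    ≡⟨ count-∷ p r ps′ rs′ ⟨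
  count (p ∷ ps′) (r ∷ rs′) ∎

-- Sums over families and multinomial coefficients

infixr 5 _◂_
_◂_ : ∀ {n} {A : Fin (suc n) → Set} → A zero → (∀ i → A (suc i)) → ∀ i → A i
(x ◂ f) zero    = x
(x ◂ f) (suc i) = f i

*-comm-middle : ∀ x y z → x * (y * z) ≡ y * (x * z)
*-comm-middle = solve-∀

*-distribˡ-weighted : ∀ c {n} (w x : Fin n → ℕ) → c * ∑ (λ k → w k * x k) ≡ ∑ (λ k → w k * (c * x k))
*-distribˡ-weighted c w x =
  trans (*-distribˡ-sum c (λ k → w k * x k)) (sum-cong-≗ λ k → *-comm-middle c (w k) (x k))

-- `T` plays the role of a finite weighted sum over `A`. Abstracting from the list of summands lets
-- sums over lists and `multinomial` be treated alike.
record IsLinear {A : Set} (T : (A → ℕ) → ℕ) : Set where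
  field
    T-cong : ∀ {φ ψ} → φ ≗ ψ → T φ ≡ T ψ
    T-∑    : ∀ {n} (w : Fin n → ℕ) (φ : Fin n → A → ℕ) → T (λ x → ∑ λ k → w k * φ k x) ≡ ∑ λ k → w k * T (φ k)

open IsLinear

-- The tensor product of the functionals `T i`, with index `zero` outermost; an iterated sum if
-- every `T i` is a sum.
sumΠ : ∀ {n} {A : Fin n → Set} → (∀ i → (A i → ℕ) → ℕ) → ((∀ i → A i) → ℕ) → ℕ
sumΠ {zero}  T f = f λ ()
sumΠ {suc n} T f = T zero (λ x → sumΠ (T ∘ suc) (λ g → f (x ◂ g)))

sumΠ-linear : ∀ {n} {A : Fin n → Set} {T : ∀ i → (A i → ℕ) → ℕ} → (∀ i → IsLinear (T i)) → IsLinear (sumΠ T)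
sumΠ-linear {zero}  L .T-cong f≗g = f≗g _
sumΠ-linear {suc n} L .T-cong f≗g = L zero .T-cong λ x → sumΠ-linear (L ∘ suc) .T-cong λ g → f≗g (x ◂ g)
sumΠ-linear {zero}  L .T-∑ w φ = refl
sumΠ-linear {suc n} L .T-∑ w φ = trans
  (L zero .T-cong λ x → sumΠ-linear (L ∘ suc) .T-∑ w (λ k g → φ k (x ◂ g)))
  (L zero .T-∑ w _)

Extensional : {A : Set} → Rel A _ → (A → ℕ) → Set
Extensional _≈_ φ = ∀ {x y} → x ≈ y → φ x ≡ φ y

module _ {n} {A : Fin n → Set} (_≈_ : ∀ {i} → A i → A i → Set) where

  Pointwise : Rel (∀ i → A i) _
  Pointwise f g = ∀ i → f i ≈ g i

module _ {n} {A : Fin (suc n) → Set} {_≈_ : ∀ {i} → A i → A i → Set} (≈-refl : ∀ {i} {x : A i} → x ≈ x)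
         {f : (∀ i → A i) → ℕ} (f-ext : Extensional (Pointwise _≈_) f) where

  ext-tail : ∀ x → Extensional (Pointwise (λ {i} → _≈_ {suc i})) (λ g → f (x ◂ g))
  ext-tail x g≈ = f-ext λ { zero → ≈-refl ; (suc i) → g≈ i }

  ext-head : {T : ∀ i → (A i → ℕ) → ℕ} → (∀ i → IsLinear (T i)) →
             Extensional (_≈_ {zero}) (λ x → sumΠ (T ∘ suc) (λ g → f (x ◂ g)))
  ext-head L x≈ = sumΠ-linear (L ∘ suc) .T-cong λ g → f-ext λ { zero → x≈ ; (suc i) → ≈-refl }

sumΠ-cong : ∀ {n} {A : Fin n → Set} {_≈_ : ∀ {i} → A i → A i → Set} (≈-refl : ∀ {i} {x : A i} → x ≈ x)
            {T T′ : ∀ i → (A i → ℕ) → ℕ} → (∀ i → IsLinear (T i)) → (∀ i → IsLinear (T′ i)) →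
            (∀ i φ → Extensional _≈_ φ → T i φ ≡ T′ i φ) →
            ∀ f → Extensional (Pointwise _≈_) f → sumΠ T f ≡ sumΠ T′ f
sumΠ-cong {zero}  ≈-refl L L′ T≡ f f-ext = refl
sumΠ-cong {suc n} {_≈_ = _≈_} ≈-refl L L′ T≡ f f-ext = trans
  (T≡ zero _ (ext-head {_≈_ = _≈_} ≈-refl f-ext L))
  (L′ zero .T-cong λ x → sumΠ-cong {_≈_ = _≈_} ≈-refl (L ∘ suc) (L′ ∘ suc) (T≡ ∘ suc) _
      (ext-tail {_≈_ = _≈_} ≈-refl f-ext x))

sumΠ-point : ∀ {n} {A : Fin n → Set} {_≈_ : ∀ {i} → A i → A i → Set} (≈-refl : ∀ {i} {x : A i} → x ≈ x)
             {T : ∀ i → (A i → ℕ) → ℕ} → (∀ i → IsLinear (T i)) → (z : ∀ i → A i) →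
             (∀ i φ → Extensional _≈_ φ → T i φ ≡ φ (z i)) →
             ∀ f → Extensional (Pointwise _≈_) f → sumΠ T f ≡ f z
sumΠ-point {zero}  ≈-refl L z T≡ f f-ext = f-ext λ ()
sumΠ-point {suc n} {_≈_ = _≈_} ≈-refl L z T≡ f f-ext = trans
  (T≡ zero _ (ext-head {_≈_ = _≈_} ≈-refl f-ext L))
  (trans (sumΠ-point {_≈_ = _≈_} ≈-refl (L ∘ suc) (z ∘ suc) (T≡ ∘ suc) _ (ext-tail {_≈_ = _≈_} ≈-refl f-ext (z zero)))
         (f-ext λ { zero → ≈-refl ; (suc i) → ≈-refl }))

-- Only the factor at `i₀` changes, and linearity of the factors before it moves its weighted sum to
-- the front. `act` is defined in every coordinate, though trivial up to `≈` away from `i₀`, so that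
-- it can be an insertion into a whole allocation.
sumΠ-act : ∀ {n} {A : Fin n → Set} {_≈_ : ∀ {i} → A i → A i → Set} (≈-refl : ∀ {i} {x : A i} → x ≈ x)
           {T T′ : ∀ i → (A i → ℕ) → ℕ} → (∀ i → IsLinear (T i)) → (∀ i → IsLinear (T′ i)) →
           ∀ {m} (w : Fin m → ℕ) (act : Fin m → ∀ i → A i → A i) i₀ →
           (∀ k i x → i ≢ i₀ → act k i x ≈ x) →
           (∀ i φ → i ≢ i₀ → Extensional _≈_ φ → T′ i φ ≡ T i φ) →
           (∀ φ → Extensional _≈_ φ → T′ i₀ φ ≡ ∑ λ k → w k * T i₀ (φ ∘ act k i₀)) →
           ∀ f → Extensional (Pointwise _≈_) f →
           sumΠ T′ f ≡ ∑ λ k → w k * sumΠ T (λ ν → f (λ i → act k i (ν i)))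
sumΠ-act {_≈_ = _≈_} ≈-refl {T} {T′} L L′ w act zero act≈ T≡ T₀ f f-ext = begin
  T′ zero (λ x → sumΠ (T′ ∘ suc) (λ g → f (x ◂ g)))
    ≡⟨ T₀ _ (ext-head {_≈_ = _≈_} ≈-refl f-ext L′) ⟩
  ∑ (λ k → w k * T zero (λ x → sumΠ (T′ ∘ suc) (λ g → f (act k zero x ◂ g))))
    ≡⟨ sum-cong-≗ (λ k → cong (w k *_) (L zero .T-cong λ x → trans
         (sumΠ-cong {_≈_ = _≈_} ≈-refl (L′ ∘ suc) (L ∘ suc) (λ i φ → T≡ (suc i) φ λ ()) _
             (ext-tail {_≈_ = _≈_} ≈-refl f-ext _))
         (sumΠ-linear (L ∘ suc) .T-cong λ g → sym (f-ext λ where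
           zero    → ≈-refl
           (suc i) → act≈ k (suc i) (g i) λ ())))) ⟩
  ∑ (λ k → w k * sumΠ T (λ ν → f (λ i → act k i (ν i)))) ∎
sumΠ-act {_≈_ = _≈_} ≈-refl {T} {T′} L L′ w act (suc i₀) act≈ T≡ T₀ f f-ext = begin
  T′ zero (λ x → sumΠ (T′ ∘ suc) (λ g → f (x ◂ g)))
    ≡⟨ T≡ zero _ (λ ()) (ext-head {_≈_ = _≈_} ≈-refl f-ext L′) ⟩
  T zero (λ x → sumΠ (T′ ∘ suc) (λ g → f (x ◂ g)))
    ≡⟨ L zero .T-cong (λ x → sumΠ-act {_≈_ = _≈_} ≈-refl (L ∘ suc) (L′ ∘ suc) w (λ k i → act k (suc i)) i₀
         (λ k i x i≢ → act≈ k (suc i) x (i≢ ∘ Fin.suc-injective))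
         (λ i φ i≢ → T≡ (suc i) φ (i≢ ∘ Fin.suc-injective)) T₀ _ (ext-tail {_≈_ = _≈_} ≈-refl f-ext x)) ⟩
  T zero (λ x → ∑ λ k → w k * sumΠ (T ∘ suc) (λ g → f (x ◂ λ i → act k (suc i) (g i))))
    ≡⟨ L zero .T-∑ w _ ⟩
  ∑ (λ k → w k * T zero (λ x → sumΠ (T ∘ suc) (λ g → f (x ◂ λ i → act k (suc i) (g i)))))
    ≡⟨ sum-cong-≗ (λ k → cong (w k *_) (L zero .T-cong λ x → sumΠ-linear (L ∘ suc) .T-cong λ g → sym (f-ext λ where
         zero    → act≈ k zero x λ ()
         (suc i) → ≈-refl))) ⟩
  ∑ (λ k → w k * sumΠ T (λ ν → f (λ i → act k i (ν i)))) ∎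

∑ᴸ-families-suc : ∀ {n} {A : Fin (suc n) → Set} (xs : ∀ i → List (A i)) F → Extensional (Pointwise _≡_) F →
  ∑ᴸ (families xs) F ≡ ∑ᴸ (xs zero) (λ x → ∑ᴸ (families (xs ∘ suc)) (λ g → F (x ◂ g)))
∑ᴸ-families-suc xs F F-ext = trans (∑ᴸ-concatMap _ (xs zero) F)
  (∑ᴸ-cong (xs zero) λ x → trans (∑ᴸ-map _ (families (xs ∘ suc)) F)
    (∑ᴸ-cong (families (xs ∘ suc)) λ g → F-ext λ { zero → refl ; (suc i) → refl }))

∑ᴸ-families : ∀ {n} {A : Fin n → Set} (xs : ∀ i → List (A i)) (W : ∀ i → A i → ℕ) f →
  Extensional (Pointwise _≡_) f →
  ∑ᴸ (families xs) (λ ν → ∏ (λ i → W i (ν i)) * f ν) ≡ sumΠ (λ i φ → ∑ᴸ (xs i) (λ x → W i x * φ x)) f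
∑ᴸ-families {zero}  xs W f f-ext = trans (ℕ.+-identityʳ _) (trans (ℕ.*-identityˡ _) (f-ext λ ()))
∑ᴸ-families {suc n} xs W f f-ext = begin
  ∑ᴸ (families xs) (λ ν → ∏ (λ i → W i (ν i)) * f ν)
    ≡⟨ ∑ᴸ-families-suc xs (λ ν → ∏ (λ i → W i (ν i)) * f ν)
        (λ eq → cong₂ _*_ (∏-cong λ i → cong (W i) (eq i)) (f-ext eq)) ⟩
  ∑ᴸ (xs zero) (λ x → ∑ᴸ (families (xs ∘ suc)) (λ g → W zero x * ∏ (λ i → W (suc i) (g i)) * f (x ◂ g)))
    ≡⟨ ∑ᴸ-cong (xs zero) (λ x → trans (∑ᴸ-cong (families (xs ∘ suc)) λ g → ℕ.*-assoc (W zero x) _ (f (x ◂ g)))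
         (∑ᴸ-*ˡ (W zero x) (families (xs ∘ suc)) _)) ⟩
  ∑ᴸ (xs zero) (λ x → W zero x * ∑ᴸ (families (xs ∘ suc)) (λ g → ∏ (λ i → W (suc i) (g i)) * f (x ◂ g)))
    ≡⟨ ∑ᴸ-cong (xs zero) (λ x → cong (W zero x *_) (∑ᴸ-families (xs ∘ suc) (W ∘ suc) (λ g → f (x ◂ g))
         (ext-tail {_≈_ = _≡_} refl f-ext x))) ⟩
  sumΠ (λ i φ → ∑ᴸ (xs i) (λ x → W i x * φ x)) f ∎

∑ᴸ-linear : ∀ {A : Set} (xs : List A) (W : A → ℕ) → IsLinear (λ φ → ∑ᴸ xs (λ x → W x * φ x))
∑ᴸ-linear xs W .T-cong φ≗ψ = ∑ᴸ-cong xs λ x → cong (W x *_) (φ≗ψ x)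
∑ᴸ-linear xs W .T-∑ w φ = begin
  ∑ᴸ xs (λ x → W x * ∑ (λ k → w k * φ k x))
    ≡⟨ ∑ᴸ-cong xs (λ x → *-distribˡ-weighted (W x) w (λ k → φ k x)) ⟩
  ∑ᴸ xs (λ x → ∑ (λ k → w k * (W x * φ k x)))
    ≡⟨ ∑ᴸ-∑-comm xs (λ x k → w k * (W x * φ k x)) ⟩
  ∑ (λ k → ∑ᴸ xs (λ x → w k * (W x * φ k x)))
    ≡⟨ sum-cong-≗ (λ k → ∑ᴸ-*ˡ (w k) xs _) ⟩
  ∑ (λ k → w k * ∑ᴸ xs (λ x → W x * φ k x)) ∎

-- The sum of f over the vectors of multiplicities of the words of length h,
-- a word having the product of the weights of its letters as weight.
multinomial : ∀ {n} → (Fin n → ℕ) → ℕ → ((Fin n → ℕ) → ℕ) → ℕ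
multinomial {zero}  w zero    f = f λ ()
multinomial {zero}  w (suc h) f = 0
multinomial {suc n} w h       f =
  ∑ {suc h} λ j → (h C toℕ j) * (w zero ^ toℕ j * multinomial (w ∘ suc) (h ∸ toℕ j) (λ ν → f (toℕ j ◂ ν)))

multinomial-linear : ∀ {n} (w : Fin n → ℕ) h → IsLinear (multinomial w h)
multinomial-linear {zero}  w zero    .T-cong φ≗ψ = φ≗ψ _
multinomial-linear {zero}  w (suc h) .T-cong φ≗ψ = refl
multinomial-linear {suc n} w h       .T-cong φ≗ψ = sum-cong-≗ {suc h} λ j
    → cong (λ t → (h C toℕ j) * (w zero ^ toℕ j * t))
  (multinomial-linear (w ∘ suc) (h ∸ toℕ j) .T-cong λ ν → φ≗ψ (toℕ j ◂ ν))
multinomial-linear {zero}  w zero    .T-∑ v φ = refl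
multinomial-linear {zero}  w (suc h) .T-∑ v φ = sym (∑-zero _ λ k → ℕ.*-zeroʳ (v k))
multinomial-linear {suc n} w h       .T-∑ {m} v φ = begin
  ∑ {suc h} (λ j → c j * (e j * multinomial (w ∘ suc) (h ∸ toℕ j) (λ ν → ∑ λ k → v k * φ k (toℕ j ◂ ν))))
    ≡⟨ sum-cong-≗ {suc h} (λ j → trans
         (cong (λ t → c j * (e j * t)) {y = ∑ λ k → v k * X k j}
           (multinomial-linear (w ∘ suc) (h ∸ toℕ j) .T-∑ v (λ k ν → φ k (toℕ j ◂ ν))))
         (trans (cong (c j *_) (*-distribˡ-weighted (e j) v (λ k → X k j)))
                (*-distribˡ-weighted (c j) v (λ k → e j * X k j)))) ⟩
  ∑ {suc h} (λ j → ∑ λ k → v k * term k j)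
    ≡⟨ ∑-comm {suc h} (λ j k → v k * term k j) ⟩
  ∑ (λ k → ∑ {suc h} λ j → v k * term k j)
    ≡⟨ sum-cong-≗ (λ k → *-distribˡ-sum (v k) (term k)) ⟨
  ∑ (λ k → v k * multinomial w h (φ k)) ∎
  where
  c e : Fin (suc h) → ℕ
  c j = h C toℕ j
  e j = w zero ^ toℕ j
  X term : Fin m → Fin (suc h) → ℕ
  X    k j = multinomial (w ∘ suc) (h ∸ toℕ j) (λ ν → φ k (toℕ j ◂ ν))
  term k j = c j * (e j * X k j)

increment : ∀ {n} → ℕ → (Fin n → ℕ) → Fin n → ℕ
increment k ν k′ = 𝟙 (k ≟ toℕ k′) + ν k′

multinomial-zero : ∀ {n} (w : Fin n → ℕ) f → Extensional _≗_ f → multinomial w 0 f ≡ f (λ _ → 0)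
multinomial-zero {zero}  w f f-ext = f-ext λ ()
multinomial-zero {suc n} w f f-ext = begin
  1 * (1 * multinomial (w ∘ suc) 0 (λ ν → f (0 ◂ ν))) + 0   ≡⟨ eq _ ⟩
  multinomial (w ∘ suc) 0 (λ ν → f (0 ◂ ν))                 ≡⟨ multinomial-zero (w ∘ suc) _
                                                                 (λ ν≗ → f-ext λ { zero → refl ; (suc i) → ν≗ i }) ⟩
  f (0 ◂ λ _ → 0)                                           ≡⟨ f-ext (λ { zero → refl ; (suc i) → refl }) ⟩
  f (λ _ → 0)                                               ∎
  where
  eq : ∀ x → 1 * (1 * x) + 0 ≡ x
  eq = solve-∀

-- The first letter of the word is split off. Pascal's rule for the places of the letter `zero`
-- separates the words that start with it (`head`) from those that start with another letter
-- (`tail`).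
multinomial-suc : ∀ {n} (w : Fin n → ℕ) h f → Extensional _≗_ f →
                  multinomial w (suc h) f ≡ ∑ λ k → w k * multinomial w h (f ∘ increment (toℕ k))
multinomial-suc {zero}  w h f f-ext = refl
multinomial-suc {suc n} w h f f-ext = begin
  ∑ {2 + h} (λ j → (suc h C toℕ j) * G (toℕ j))
    ≡⟨ pascal h G ⟩
  ∑ {suc h} (λ j → (h C toℕ j) * G (suc (toℕ j))) + ∑ {suc h} (λ j → (h C toℕ j) * G (toℕ j))
    ≡⟨ cong₂ _+_ head tail ⟩
  w zero * multinomial w h (f ∘ increment 0) + ∑ (λ k → w (suc k) * multinomial w h (f ∘ increment (toℕ (suc k)))) ∎
  where
  M : ℕ → ((Fin n → ℕ) → ℕ) → ℕ
  M = multinomial (w ∘ suc)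
  G : ℕ → ℕ
  G j = w zero ^ j * M (suc h ∸ j) (λ ν → f (j ◂ ν))
  eq : ∀ c x y z → c * (x * y * z) ≡ x * (c * (y * z))
  eq = solve-∀
  head : ∑ {suc h} (λ j → (h C toℕ j) * G (suc (toℕ j))) ≡ w zero * multinomial w h (f ∘ increment 0)
  head = begin
    ∑ {suc h} (λ j → (h C toℕ j) * G (suc (toℕ j)))
      ≡⟨ sum-cong-≗ {suc h} (λ j → trans (eq (h C toℕ j) (w zero) (w zero ^ toℕ j) _)
           (cong (λ t → w zero * ((h C toℕ j) * (w zero ^ toℕ j * t)))
             (multinomial-linear (w ∘ suc) (h ∸ toℕ j) .T-cong λ ν →
               f-ext {suc (toℕ j) ◂ ν} {increment 0 (toℕ j ◂ ν)} λ { zero → refl ; (suc i) → refl }))) ⟩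
    ∑ {suc h} (λ j → w zero * first j)
      ≡⟨ *-distribˡ-sum {suc h} (w zero) first ⟨
    w zero * multinomial w h (f ∘ increment 0) ∎
    where
    first : Fin (suc h) → ℕ
    first j = (h C toℕ j) * (w zero ^ toℕ j * M (h ∸ toℕ j) (λ ν → f (increment 0 (toℕ j ◂ ν))))
  tail : ∑ {suc h} (λ j → (h C toℕ j) * G (toℕ j)) ≡
         ∑ (λ k → w (suc k) * multinomial w h (f ∘ increment (toℕ (suc k))))
  tail = begin
    ∑ {suc h} (λ j → (h C toℕ j) * G (toℕ j))
      ≡⟨ sum-cong-≗ {suc h} (λ j → cong (λ t → (h C toℕ j) * (w zero ^ toℕ j * t)) (begin
           M (suc h ∸ toℕ j) (λ ν → f (toℕ j ◂ ν))
             -- `pascal` has shortened the range to `j ≤ h`, so at least one letter other than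
             -- `zero` remains.
             ≡⟨ cong (λ t → M t (λ ν → f (toℕ j ◂ ν))) (ℕ.+-∸-assoc 1 (Fin.toℕ≤pred[n] j)) ⟩
           M (suc (h ∸ toℕ j)) (λ ν → f (toℕ j ◂ ν))
             ≡⟨ multinomial-suc (w ∘ suc) (h ∸ toℕ j) _ (λ ν≗ → f-ext λ { zero → refl ; (suc i) → ν≗ i }) ⟩
           ∑ (λ k → w (suc k) * M (h ∸ toℕ j) (λ ν → f (toℕ j ◂ increment (toℕ k) ν)))
             ≡⟨ sum-cong-≗ (λ k → cong (w (suc k) *_) (multinomial-linear (w ∘ suc) (h ∸ toℕ j) .T-cong λ ν →
                  f-ext {toℕ j ◂ increment (toℕ k) ν} {increment (suc (toℕ k)) (toℕ j ◂ ν)}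
                    λ { zero → refl ; (suc i) → refl })) ⟩
           ∑ (λ k → w (suc k) * term k j) ∎)) ⟩
    ∑ {suc h} (λ j → (h C toℕ j) * (w zero ^ toℕ j * ∑ (λ k → w (suc k) * term k j)))
      ≡⟨ sum-cong-≗ {suc h} (λ j → trans
           (cong ((h C toℕ j) *_) (*-distribˡ-weighted (w zero ^ toℕ j) (w ∘ suc) (λ k → term k j)))
           (*-distribˡ-weighted (h C toℕ j) (w ∘ suc) (λ k → w zero ^ toℕ j * term k j))) ⟩
    ∑ {suc h} (λ j → ∑ λ k → w (suc k) * ((h C toℕ j) * (w zero ^ toℕ j * term k j)))
      ≡⟨ ∑-comm {suc h} (λ j k → w (suc k) * ((h C toℕ j) * (w zero ^ toℕ j * term k j))) ⟩
    ∑ (λ k → ∑ {suc h} λ j → w (suc k) * ((h C toℕ j) * (w zero ^ toℕ j * term k j)))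
      ≡⟨ sum-cong-≗ (λ k → *-distribˡ-sum {suc h} (w (suc k)) (λ j → (h C toℕ j) * (w zero ^ toℕ j * term k j))) ⟨
    ∑ (λ k → w (suc k) * multinomial w h (f ∘ increment (toℕ (suc k)))) ∎
    where
    term : Fin n → Fin (suc h) → ℕ
    term k j = M (h ∸ toℕ j) (λ ν → f (increment (toℕ (suc k)) (toℕ j ◂ ν)))

-- Multinomial coefficients

∏!≢0 : ∀ {n} (ν : Fin n → ℕ) → NonZero (∏ (λ k → ν k !))
∏!≢0 ν = ∏-nonZero (λ k → ν k !) (λ k → ν k !≢0)

-- The multinomial coefficient as a product of binomial coefficients, which follows the recursion of
-- `multinomial`; `weight` has it as a quotient of factorials.
arrangements : ∀ {n} → ℕ → (Fin n → ℕ) → ℕ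
arrangements {zero}  h ν = 1
arrangements {suc n} h ν = (h C ν zero) * arrangements (h ∸ ν zero) (ν ∘ suc)

binomial-! : ∀ {h j} → j ≤ h → (h C j) * (j ! * (h ∸ j) !) ≡ h !
binomial-! {h} {j} j≤h = trans (cong (_* (j ! * (h ∸ j) !)) (nCk≡n!/k![n-k]! j≤h))
  (m/n*n≡m {{m*n≢0 (j !) ((h ∸ j) !) {{j !≢0}} {{(h ∸ j) !≢0}}}} (k![n∸k]!∣n! j≤h))

arrangements-! : ∀ {n} h (ν : Fin n → ℕ) → ∑ ν ≡ h → arrangements h ν * ∏ (λ k → ν k !) ≡ h !
arrangements-! {zero}  h ν refl = refl
arrangements-! {suc n} h ν refl = begin
  (h C ν zero) * arrangements (h ∸ ν zero) (ν ∘ suc) * (ν zero ! * ∏ (λ k → ν (suc k) !))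
    ≡⟨ eq (h C ν zero) _ (ν zero !) _ ⟩
  (h C ν zero) * (ν zero ! * (arrangements (h ∸ ν zero) (ν ∘ suc) * ∏ (λ k → ν (suc k) !)))
    ≡⟨ cong (λ t → (h C ν zero) * (ν zero ! * t))
         (arrangements-! (h ∸ ν zero) (ν ∘ suc) (sym (ℕ.m+n∸m≡n (ν zero) (∑ (ν ∘ suc))))) ⟩
  (h C ν zero) * (ν zero ! * (h ∸ ν zero) !)
    ≡⟨ binomial-! (ℕ.m≤m+n (ν zero) (∑ (ν ∘ suc))) ⟩
  h ! ∎
  where
  eq : ∀ a b c d → a * b * (c * d) ≡ a * (c * (b * d))
  eq = solve-∀

!/∏! : ∀ {n} h (ν : Fin n → ℕ) → ∑ ν ≡ h → ((h !) / ∏ (λ k → ν k !)) {{∏!≢0 ν}} ≡ arrangements h ν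
!/∏! h ν eq = trans (cong (λ t → (t / ∏ (λ k → ν k !)) {{∏!≢0 ν}}) (sym (arrangements-! h ν eq)))
  (m*n/n≡m (arrangements h ν) (∏ (λ k → ν k !)) {{∏!≢0 ν}})

arrangements-cong : ∀ {n} h {ν ν′ : Fin n → ℕ} → ν ≗ ν′ → arrangements h ν ≡ arrangements h ν′
arrangements-cong {zero}  h ν≗ = refl
arrangements-cong {suc n} h {ν} {ν′} ν≗ rewrite ν≗ zero =
  cong ((h C ν′ zero) *_) (arrangements-cong (h ∸ ν′ zero) (ν≗ ∘ suc))

-- The side `H` of the box stays fixed while `h` decreases in the recursion; entries above `h` are
-- removed by the indicator.
∑ᴸ-arrangements : ∀ {n} (w : Fin n → ℕ) {h H} → h ≤ H → ∀ f → Extensional _≗_ f →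
  ∑ᴸ (families λ (_ : Fin n) → upTo (suc H))
     (λ ν → 𝟙 (∑ ν ≟ h) * (arrangements h ν * ∏ (λ k → w k ^ ν k)) * f ν) ≡ multinomial w h f
∑ᴸ-arrangements {zero}  w {zero}  h≤H f f-ext = trans (eq _) (f-ext λ ())
  where
  eq : ∀ x → 1 * x + 0 ≡ x
  eq = solve-∀
∑ᴸ-arrangements {zero}  w {suc h} h≤H f f-ext = refl
∑ᴸ-arrangements {suc n} w {h} {H} h≤H f f-ext = begin
  ∑ᴸ (families λ (_ : Fin (suc n)) → upTo (suc H)) F
    ≡⟨ ∑ᴸ-families-suc (λ _ → upTo (suc H)) F (λ {ν} {ν′} ν≗ → cong₂ _*_ (cong₂ _*_
         (cong (λ t → 𝟙 (t ≟ h)) (sum-cong-≗ ν≗))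
         (cong₂ _*_ (arrangements-cong h ν≗) (∏-cong λ k → cong (w k ^_) (ν≗ k)))) (f-ext ν≗)) ⟩
  ∑ᴸ (upTo (suc H)) G
    ≡⟨ ∑ᴸ-upTo (suc H) G ⟩
  ∑ {suc H} (G ∘ toℕ)
    ≡⟨ ∑-truncate G (s≤s h≤H) large ⟩
  ∑ {suc h} (G ∘ toℕ)
    ≡⟨ sum-cong-≗ {suc h} (λ j → small (toℕ j) (Fin.toℕ≤pred[n] j)) ⟩
  multinomial w h f ∎
  where
  rest : List (Fin n → ℕ)
  rest = families λ _ → upTo (suc H)
  F : (Fin (suc n) → ℕ) → ℕ
  F ν = 𝟙 (∑ ν ≟ h) * (arrangements h ν * ∏ (λ k → w k ^ ν k)) * f ν
  G : ℕ → ℕ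
  G j = ∑ᴸ rest (λ ν → F (j ◂ ν))
  large : ∀ j → h < j → G j ≡ 0
  large j h<j = ∑ᴸ-zero rest λ ν → cong (λ t → t * (arrangements h (j ◂ ν) * ∏ (λ k → w k ^ (j ◂ ν) k)) * f (j ◂ ν))
    (𝟙-no (j + ∑ ν ≟ h) λ e → ℕ.<⇒≱ h<j (ℕ.m+n≤o⇒m≤o j (ℕ.≤-reflexive e)))
  eq : ∀ i c a x y z → i * (c * a * (x * y)) * z ≡ c * x * (i * (a * y) * z)
  eq = solve-∀
  small : ∀ j → j ≤ h → G j ≡ (h C j) * (w zero ^ j * multinomial (w ∘ suc) (h ∸ j) (λ ν → f (j ◂ ν)))
  small j j≤h = begin
    G j
      ≡⟨ ∑ᴸ-cong rest (λ ν → trans (eq (𝟙 (j + ∑ ν ≟ h)) (h C j) (arrangements (h ∸ j) ν) (w zero ^ j) _ (f (j ◂ ν)))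
           (cong (λ t → (h C j) * w zero ^ j * (t * (arrangements (h ∸ j) ν * ∏ (λ k → w (suc k) ^ ν k)) * f (j ◂ ν)))
             (𝟙-cong (j + ∑ ν ≟ h) (∑ ν ≟ h ∸ j) (λ { refl → sym (ℕ.m+n∸m≡n j (∑ ν)) })
               (λ e → trans (cong (j +_) e) (ℕ.m+[n∸m]≡n j≤h))))) ⟩
    ∑ᴸ rest (λ ν → (h C j) * w zero ^ j * (𝟙 (∑ ν ≟ h ∸ j) *
        (arrangements (h ∸ j) ν * ∏ (λ k → w (suc k) ^ ν k)) * f (j ◂ ν)))
      ≡⟨ ∑ᴸ-*ˡ ((h C j) * w zero ^ j) rest _ ⟩
    (h C j) * w zero ^ j * ∑ᴸ rest (λ ν → 𝟙 (∑ ν ≟ h ∸ j) * (arrangements (h ∸ j) ν * ∏ (λ k → w (suc k) ^ ν k))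
        * f (j ◂ ν))
      ≡⟨ cong ((h C j) * w zero ^ j *_) (∑ᴸ-arrangements (w ∘ suc) (ℕ.≤-trans (ℕ.m∸n≤m h j) h≤H) (λ ν → f (j ◂ ν))
           (λ ν≗ → f-ext λ { zero → refl ; (suc i) → ν≗ i })) ⟩
    (h C j) * w zero ^ j * multinomial (w ∘ suc) (h ∸ j) (λ ν → f (j ◂ ν))
      ≡⟨ ℕ.*-assoc (h C j) (w zero ^ j) _ ⟩
    (h C j) * (w zero ^ j * multinomial (w ∘ suc) (h ∸ j) (λ ν → f (j ◂ ν))) ∎

∑ᴸ-weight : ∀ g {n} h f → Extensional _≗_ f →
  ∑ᴸ (families λ (_ : Fin n) → upTo (suc h)) (λ ν → 𝟙 (∑ ν ≟ h) * weight g h ν * f ν) ≡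
  multinomial (λ k → g C toℕ k) h f
∑ᴸ-weight g {n} h f f-ext = trans
  (∑ᴸ-cong (families λ (_ : Fin n) → upTo (suc h)) λ ν → cong (_* f ν) (case ν (∑ ν ≟ h)))
  (∑ᴸ-arrangements {n} (λ k → g C toℕ k) ℕ.≤-refl f f-ext)
  where
  -- The quotient is identified only where the entries sum to `h`; elsewhere the indicator makes
  -- both sides 0.
  case : ∀ ν (q? : Dec (∑ ν ≡ h)) →
         𝟙 q? * weight g h ν ≡ 𝟙 q? * (arrangements h ν * ∏ (λ k → (g C toℕ k) ^ ν k))
  case ν (yes eq) = cong (λ t → 1 * (t * ∏ (λ k → (g C toℕ k) ^ ν k))) (!/∏! h ν eq)
  case ν (no _)   = refl

-- The recurrence

𝟙-if : ∀ {Q : Set} (q? : Dec Q) x → (if does q? then x else 0) ≡ 𝟙 q? * x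
𝟙-if (yes _) x = sym (ℕ.*-identityˡ x)
𝟙-if (no _)  x = refl

tally : ∀ {m d n} → Vec (Fin m) n → Vec (Fin d) n → Fin m → Fin d → ℕ
tally []       []       b′ s′ = 0
tally (b ∷ bs) (s ∷ ss) b′ s′ = 𝟙 ((b Fin.≟ b′) ×-dec (s Fin.≟ s′)) + tally bs ss b′ s′

-- A listing of the cycles by class, in arbitrary order; equality is required only of the
-- multiplicities.
record Keys {m d} (h : Fin m → Fin d → ℕ) : Set where
  constructor keys
  field
    {number} : ℕ
    lengths  : Vec (Fin m) number
    values   : Vec (Fin d) number
    tally≡   : ∀ b s → tally lengths values b s ≡ h b s

tally-++ : ∀ {m d n n′} (bs : Vec (Fin m) n) (ss : Vec (Fin d) n) (bs′ : Vec (Fin m) n′) ss′ b s →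
           tally (bs Vec.++ bs′) (ss Vec.++ ss′) b s ≡ tally bs ss b s + tally bs′ ss′ b s
tally-++ []       []       bs′ ss′ b s = refl
tally-++ (c ∷ bs) (t ∷ ss) bs′ ss′ b s =
  trans (cong (𝟙 ((c Fin.≟ b) ×-dec (t Fin.≟ s)) +_) (tally-++ bs ss bs′ ss′ b s))
      (sym (ℕ.+-assoc (𝟙 ((c Fin.≟ b) ×-dec (t Fin.≟ s))) (tally bs ss b s) (tally bs′ ss′ b s)))

keys-∑ : ∀ {m d n} {h : Fin n → Fin m → Fin d → ℕ} → (∀ i → Keys (h i)) → Keys (λ b s → ∑ λ i → h i b s)
keys-∑ {n = zero}  k = keys [] [] λ _ _ → refl
keys-∑ {n = suc n} k with k zero | keys-∑ (k ∘ suc)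
... | keys bs ss eq | keys bs′ ss′ eq′ = keys (bs Vec.++ bs′) (ss Vec.++ ss′) λ b s →
  trans (tally-++ bs ss bs′ ss′ b s) (cong₂ _+_ (eq b s) (eq′ b s))

every : ∀ {m d} (h : Fin m → Fin d → ℕ) → Keys h
every h with keys-∑ (λ b → keys-∑ λ s → keys-∑ {n = h b s} λ _ → keys (b ∷ []) (s ∷ []) λ b′ s′ → refl)
... | keys bs ss eq = keys bs ss λ b s → begin
  tally bs ss b s
    ≡⟨ eq b s ⟩
  ∑ (λ b′ → ∑ λ s′ → ∑ {h b′ s′} λ _ → single b′ s′ b s)
    ≡⟨ ∑-only _ b (λ b′ b′≢ → ∑-zero _ λ s′ → ∑-zero {h b′ s′} _ λ _ →
         cong (_+ 0) (𝟙-no (at? b′ s′ b s) λ (e , _) → b′≢ e)) ⟩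
  ∑ (λ s′ → ∑ {h b s′} λ _ → single b s′ b s)
    ≡⟨ ∑-only _ s (λ s′ s′≢ → ∑-zero {h b s′} _ λ _ →
         cong (_+ 0) (𝟙-no (at? b s′ b s) λ (_ , e) → s′≢ e)) ⟩
  ∑ {h b s} (λ _ → single b s b s)
    ≡⟨ ∑-constant (h b s) _ ⟩
  h b s * single b s b s
    ≡⟨ cong (λ t → h b s * (t + 0)) (𝟙-yes (at? b s b s) (refl , refl)) ⟩
  h b s * 1
    ≡⟨ ℕ.*-identityʳ (h b s) ⟩
  h b s ∎
  where
  at? : ∀ b′ s′ b s → Dec (b′ ≡ b × s′ ≡ s)
  at? b′ s′ b s = (b′ Fin.≟ b) ×-dec (s′ Fin.≟ s)
  single : _ → _ → _ → _ → ℕ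
  single b′ s′ b s = 𝟙 (at? b′ s′ b s) + 0

module _ {d} (H : State d) where

  occurrences-tally : ∀ {n} (bs : Vec (Fin (bound H)) n) (ss : Vec (Fin d) n) b s →
                      occurrences (Vec.map toℕ bs) ss (toℕ b) s ≡ tally bs ss b s
  occurrences-tally []       []       b s = refl
  occurrences-tally (c ∷ bs) (t ∷ ss) b s = cong₂ _+_
    (𝟙-cong ((toℕ c ≟ toℕ b) ×-dec (t Fin.≟ s)) ((c Fin.≟ b) ×-dec (t Fin.≟ s))
      (λ (e , e′) → Fin.toℕ-injective e , e′) (λ (e , e′) → cong toℕ e , e′))
    (occurrences-tally bs ss b s)

  occurrences-beyond : ∀ {n} (bs : Vec (Fin (bound H)) n) (ss : Vec (Fin d) n) {p} s → ¬ p < bound H →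
                       occurrences (Vec.map toℕ bs) ss p s ≡ 0
  occurrences-beyond []       []           s p≮ = refl
  occurrences-beyond (c ∷ bs) (t ∷ ss) {p} s p≮ = cong₂ _+_
    (𝟙-no ((toℕ c ≟ p) ×-dec (t Fin.≟ s)) λ (e , _) → p≮ (subst (_< bound H) e (Fin.toℕ<n c)))
    (occurrences-beyond bs ss s p≮)

  count-realization : (k : Keys (mult H)) (R : Realization H) →
    length (completions (proj₁ R)) ≡ count (Vec.map toℕ (Keys.lengths k)) (Vec.map deg (Keys.values k))
  count-realization (keys bs ss tally≡) (L , R) = length-completions {L = L} {Vec.map toℕ bs} {Vec.map deg ss}
    (coordinates {N = entry H} (Vec.map toℕ bs) ss R entry≡)
    where
    entry≡ : ∀ p s → entry H (suc p) s ≡ occurrences (Vec.map toℕ bs) ss p s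
    entry≡ p s with p <? bound H
    ... | no  p≮ = sym (occurrences-beyond bs ss s p≮)
    ... | yes p< = trans (sym (tally≡ (fromℕ< p<) s)) (trans (sym (occurrences-tally bs ss (fromℕ< p<) s))
      (cong (λ p → occurrences (Vec.map toℕ bs) ss p s) (Fin.toℕ-fromℕ< p<)))

  realization-independent : (R : Realization H) → length (completions (proj₁ R)) ≡ Φ H
  realization-independent R = trans (count-realization (every (mult H)) R)
    (sym (count-realization (every (mult H)) (realization H)))

  Φ-count : (k : Keys (mult H)) → Φ H ≡ count (Vec.map toℕ (Keys.lengths k)) (Vec.map deg (Keys.values k))
  Φ-count k = count-realization k (realization H)

  Φ-zero : IsZero H → Φ H ≡ 1
  Φ-zero H≡0 = Φ-count (keys [] [] λ b s → sym (H≡0 b s))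

-- Allocations as histograms of choices

module Choices {d} (H : State d) (a : Fin (bound H)) (r : Fin d) where

  open Pivot H a r hiding (expansion)

  m : ℕ
  m = bound H

  slots : Fin m → Fin d → ℕ
  slots b s = suc (K (len a) (len b) (deg r) (deg s))

  w : ∀ b s → Fin (slots b s) → ℕ
  w b s k = gcd⁺ (toℕ a) (toℕ b) C toℕ k

  _≈_ : ∀ {b} (x y : ∀ s → Fin (slots b s) → ℕ) → Set
  _≈_ = Pointwise _≗_

  Ext : (Allocation → ℕ) → Set
  Ext = Extensional (Pointwise _≈_)

  hit? : (b : Fin m) (s : Fin d) (k : ℕ) (b′ : Fin m) (s′ : Fin d) (k′ : ℕ) → Dec ((b ≡ b′ × s ≡ s′) × k ≡ k′)
  hit? b s k b′ s′ k′ = ((b Fin.≟ b′) ×-dec (s Fin.≟ s′)) ×-dec (k ≟ k′)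

  -- `k` is a plain number because the index type varies with the slot; a `k` out of range would
  -- insert nothing.
  insert : Fin m → Fin d → ℕ → Allocation → Allocation
  insert b s k ν b′ s′ k′ = 𝟙 (hit? b s k b′ s′ (toℕ k′)) + ν b′ s′ k′

  histogram : ∀ {n} → Vec (Fin m) n → Vec (Fin d) n → Vec ℕ n → Allocation
  histogram []       []       []       = λ _ _ _ → 0
  histogram (b ∷ bs) (s ∷ ss) (k ∷ ks) = insert b s k (histogram bs ss ks)

  Tˢ : (h : Fin m → Fin d → ℕ) → ∀ b s → ((Fin (slots b s) → ℕ) → ℕ) → ℕ
  Tˢ h b s = multinomial (w b s) (h b s)

  Tᵇ : (h : Fin m → Fin d → ℕ) → ∀ b → ((∀ s → Fin (slots b s) → ℕ) → ℕ) → ℕ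
  Tᵇ h b = sumΠ (Tˢ h b)

  Tˢ-linear : ∀ h b s → IsLinear (Tˢ h b s)
  Tˢ-linear h b s = multinomial-linear (w b s) (h b s)

  Tᵇ-linear : ∀ h b → IsLinear (Tᵇ h b)
  Tᵇ-linear h b = sumΠ-linear (Tˢ-linear h b)

  allocationSum : (Fin m → Fin d → ℕ) → (Allocation → ℕ) → ℕ
  allocationSum h = sumΠ (Tᵇ h)

  allocationSum-cong : ∀ {h h′} → (∀ b s → h b s ≡ h′ b s) → ∀ f → Ext f →
                       allocationSum h f ≡ allocationSum h′ f
  allocationSum-cong {h} {h′} h≗ f f-ext = sumΠ-cong {_≈_ = _≈_} (λ _ _ → refl) (Tᵇ-linear h) (Tᵇ-linear h′)
    (λ b φ φ-ext → sumΠ-cong {_≈_ = _≗_} (λ _ → refl) (Tˢ-linear h b) (Tˢ-linear h′ b)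
      (λ s ψ _ → cong (λ t → multinomial (w b s) t ψ) (h≗ b s)) φ φ-ext) f f-ext

  allocationSum-zero : ∀ f → Ext f → allocationSum (λ _ _ → 0) f ≡ f (λ _ _ _ → 0)
  allocationSum-zero f f-ext = sumΠ-point {_≈_ = _≈_} (λ _ _ → refl) (Tᵇ-linear _) _
    (λ b φ φ-ext → sumΠ-point {_≈_ = _≗_} (λ _ → refl) (Tˢ-linear _ b) _
      (λ s ψ ψ-ext → multinomial-zero (w b s) ψ ψ-ext) φ φ-ext) f f-ext

  -- One more cycle of class `(b , s)` changes a single multinomial factor. `sumΠ-act` is applied
  -- twice, for the length and inside it for the degree, down to `multinomial-suc`.
  allocationSum-suc : ∀ b s h f → Ext f →
    allocationSum (λ b′ s′ → 𝟙 ((b Fin.≟ b′) ×-dec (s Fin.≟ s′)) + h b′ s′) f ≡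
    ∑ λ k → w b s k * allocationSum h (f ∘ insert b s (toℕ k))
  allocationSum-suc b s h f f-ext = sumΠ-act {_≈_ = _≈_} (λ _ _ → refl) (Tᵇ-linear h) (Tᵇ-linear h⁺) (w b s)
    (λ k b′ → act (toℕ k) b′) b
    (λ k b′ x b′≢ s′ k′ → cong (_+ x s′ k′) (𝟙-no (hit? b s (toℕ k) b′ s′ (toℕ k′)) λ ((e , _) , _) → b′≢ (sym e)))
    (λ b′ φ b′≢ φ-ext → sumΠ-cong {_≈_ = _≗_} (λ _ → refl) (Tˢ-linear h⁺ b′) (Tˢ-linear h b′)
      (λ s′ ψ _ → cong (λ t → multinomial (w b′ s′) (t + h b′ s′) ψ) (𝟙-no (at? b′ s′) λ (e , _) → b′≢ (sym e)))
          φ φ-ext)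
    (λ φ φ-ext → sumΠ-act {_≈_ = _≗_} (λ _ → refl) (Tˢ-linear h b) (Tˢ-linear h⁺ b) (w b s)
      (λ k s′ x k′ → 𝟙 (hit? b s (toℕ k) b s′ (toℕ k′)) + x k′) s
      (λ k s′ x s′≢ k′ → cong (_+ x k′) (𝟙-no (hit? b s (toℕ k) b s′ (toℕ k′)) λ ((_ , e) , _) → s′≢ (sym e)))
      (λ s′ ψ s′≢ _ → cong (λ t → multinomial (w b s′) (t + h b s′) ψ) (𝟙-no (at? b s′) λ (_ , e) → s′≢ (sym e)))
      (λ ψ ψ-ext → begin
        multinomial (w b s) (𝟙 (at? b s) + h b s) ψ
          ≡⟨ cong (λ t → multinomial (w b s) (t + h b s) ψ) (𝟙-yes (at? b s) (refl , refl)) ⟩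
        multinomial (w b s) (suc (h b s)) ψ
          ≡⟨ multinomial-suc (w b s) (h b s) ψ ψ-ext ⟩
        ∑ (λ k → w b s k * multinomial (w b s) (h b s) (ψ ∘ increment (toℕ k)))
          ≡⟨ sum-cong-≗ (λ k → cong (w b s k *_) (multinomial-linear (w b s) (h b s) .IsLinear.T-cong λ x →
               ψ-ext λ k′ → cong (_+ x k′) (𝟙-cong (toℕ k ≟ toℕ k′) (hit? b s (toℕ k) b s (toℕ k′))
                 (λ e → (refl , refl) , e) proj₂))) ⟩
        ∑ (λ k → w b s k * multinomial (w b s) (h b s) (λ x → ψ (λ k′ → 𝟙 (hit? b s (toℕ k) b s (toℕ k′)) + x k′))) ∎)
      φ φ-ext)
    f f-ext
    where
    at? : ∀ b′ s′ → Dec (b ≡ b′ × s ≡ s′)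
    at? b′ s′ = (b Fin.≟ b′) ×-dec (s Fin.≟ s′)
    h⁺ : Fin m → Fin d → ℕ
    h⁺ b′ s′ = 𝟙 (at? b′ s′) + h b′ s′
    act : ℕ → ∀ b′ → (∀ s′ → Fin (slots b′ s′) → ℕ) → ∀ s′ → Fin (slots b′ s′) → ℕ
    act k b′ x s′ k′ = 𝟙 (hit? b s k b′ s′ (toℕ k′)) + x s′ k′

  -- The size chosen for the first cycle moves into `f` as an insertion, which matches
  -- `allocationSum-suc`.
  ∑ᴷ-histogram : ∀ {n} (bs : Vec (Fin m) n) (ss : Vec (Fin d) n) f → Ext f →
    ∑ᴷ (toℕ a) (deg r) (Vec.map toℕ bs) (Vec.map deg ss) (f ∘ histogram bs ss) ≡ allocationSum (tally bs ss) f
  ∑ᴷ-histogram []       []       f f-ext = sym (allocationSum-zero f f-ext)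
  ∑ᴷ-histogram (b ∷ bs) (s ∷ ss) f f-ext = begin
    ∑ (λ k → w b s k * ∑ᴷ (toℕ a) (deg r) (Vec.map toℕ bs) (Vec.map deg ss)
        (f ∘ insert b s (toℕ k) ∘ histogram bs ss))
      ≡⟨ sum-cong-≗ (λ k → cong (w b s k *_) (∑ᴷ-histogram bs ss (f ∘ insert b s (toℕ k))
           λ ν≈ → f-ext λ b′ s′ k′ → cong (𝟙 (hit? b s (toℕ k) b′ s′ (toℕ k′)) +_) (ν≈ b′ s′ k′))) ⟩
    ∑ (λ k → w b s k * allocationSum (tally bs ss) (f ∘ insert b s (toℕ k)))
      ≡⟨ allocationSum-suc b s (tally bs ss) f f-ext ⟨
    allocationSum (tally (b ∷ bs) (s ∷ ss)) f ∎

  BoundedBy : ∀ {n} → Vec (Fin m) n → Vec (Fin d) n → Vec ℕ n → Set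
  BoundedBy bs ss ks = Bounded (toℕ a) (deg r) (Vec.map toℕ bs) (Vec.map deg ss) ks

  -- The coefficient `c` is the contribution to the degree of the pivot in one application and the
  -- indicator of a residual degree in the other.
  ∑-insert : ∀ b s k (c : Fin d → ℕ → ℕ) ν b′ → k < slots b s →
    ∑ (λ s′ → ∑ λ k′ → c s′ (toℕ k′) * insert b s k ν b′ s′ k′) ≡
    𝟙 (b Fin.≟ b′) * c s k + ∑ (λ s′ → ∑ λ k′ → c s′ (toℕ k′) * ν b′ s′ k′)
  ∑-insert b s k c ν b′ k< = begin
    ∑ (λ s′ → ∑ λ k′ → c s′ (toℕ k′) * insert b s k ν b′ s′ k′)
      ≡⟨ sum-cong-≗ (λ s′ → trans (sum-cong-≗ λ k′ → ℕ.*-distribˡ-+ (c s′ (toℕ k′)) (δ s′ k′) (ν b′ s′ k′))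
           (∑-distrib-+ (λ k′ → c s′ (toℕ k′) * δ s′ k′) (λ k′ → c s′ (toℕ k′) * ν b′ s′ k′))) ⟩
    ∑ (λ s′ → ∑ (λ k′ → c s′ (toℕ k′) * δ s′ k′) + ∑ (λ k′ → c s′ (toℕ k′) * ν b′ s′ k′))
      ≡⟨ ∑-distrib-+ (λ s′ → ∑ λ k′ → c s′ (toℕ k′) * δ s′ k′) (λ s′ → ∑ λ k′ → c s′ (toℕ k′) * ν b′ s′ k′) ⟩
    ∑ (λ s′ → ∑ λ k′ → c s′ (toℕ k′) * δ s′ k′) + ∑ (λ s′ → ∑ λ k′ → c s′ (toℕ k′) * ν b′ s′ k′)
      ≡⟨ cong (_+ ∑ (λ s′ → ∑ λ k′ → c s′ (toℕ k′) * ν b′ s′ k′)) (only (b Fin.≟ b′)) ⟩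
    𝟙 (b Fin.≟ b′) * c s k + ∑ (λ s′ → ∑ λ k′ → c s′ (toℕ k′) * ν b′ s′ k′) ∎
    where
    δ : ∀ s′ → Fin (slots b′ s′) → ℕ
    δ s′ k′ = 𝟙 (hit? b s k b′ s′ (toℕ k′))
    δ-no : ∀ s′ k′ → ¬ ((b ≡ b′ × s ≡ s′) × k ≡ toℕ k′) → c s′ (toℕ k′) * δ s′ k′ ≡ 0
    δ-no s′ k′ ¬hit = trans (cong (c s′ (toℕ k′) *_) (𝟙-no (hit? b s k b′ s′ (toℕ k′)) ¬hit))
        (ℕ.*-zeroʳ (c s′ (toℕ k′)))
    only : (b≟ : Dec (b ≡ b′)) → ∑ (λ s′ → ∑ λ k′ → c s′ (toℕ k′) * δ s′ k′) ≡ 𝟙 b≟ * c s k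
    only (no b≢) = ∑-zero _ λ s′ → ∑-zero _ λ k′ → δ-no s′ k′ λ ((e , _) , _) → b≢ e
    only (yes refl) = begin
      ∑ (λ s′ → ∑ λ k′ → c s′ (toℕ k′) * δ s′ k′)
        ≡⟨ ∑-only _ s (λ s′ s′≢ → ∑-zero _ λ k′ → δ-no s′ k′ λ ((_ , e) , _) → s′≢ (sym e)) ⟩
      ∑ (λ k′ → c s (toℕ k′) * δ s k′)
        ≡⟨ ∑-only _ (fromℕ< k<) (λ k′ k′≢ → δ-no s k′ λ (_ , e) → k′≢ (Fin.toℕ-injective (trans (sym e) (sym k≡)))) ⟩
      c s (toℕ (fromℕ< k<)) * δ s (fromℕ< k<)
        ≡⟨ cong₂ _*_ (cong (c s) k≡) (𝟙-yes (hit? b s k b s (toℕ (fromℕ< k<))) ((refl , refl) , sym k≡)) ⟩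
      c s k * 1
        ≡⟨ ℕ.*-comm (c s k) 1 ⟩
      1 * c s k ∎
      where
      k≡ : toℕ (fromℕ< k<) ≡ k
      k≡ = Fin.toℕ-fromℕ< k<

  pivotDegree : Allocation → ℕ
  pivotDegree ν = ∑ λ b → ∑ λ s → ∑ λ k → toℕ k * α (len a) (len b) * ν b s k

  pivotDegree-histogram : ∀ {n} (bs : Vec (Fin m) n) (ss : Vec (Fin d) n) {ks} → BoundedBy bs ss ks →
    pivotDegree (histogram bs ss ks) ≡ rowDegree (toℕ a) (Vec.map toℕ bs) ks
  pivotDegree-histogram []       []       []       =
    ∑-zero {m} _ λ b → ∑-zero {d} _ λ s → ∑-zero {slots b s} (λ k → toℕ k * α (len a) (len b) * 0)
      λ k → ℕ.*-zeroʳ (toℕ k * α (len a) (len b))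
  pivotDegree-histogram (b ∷ bs) (s ∷ ss) {k ∷ ks} (k≤ ∷ ks≤) = begin
    ∑ (λ b′ → ∑ λ s′ → ∑ λ k′ → toℕ k′ * α (len a) (len b′) * insert b s k ν b′ s′ k′)
      ≡⟨ sum-cong-≗ (λ b′ → ∑-insert b s k (λ _ k′ → k′ * α (len a) (len b′)) ν b′ (s≤s k≤)) ⟩
    ∑ (λ b′ → 𝟙 (b Fin.≟ b′) * (k * α (len a) (len b′)) +
        ∑ (λ s′ → ∑ λ k′ → toℕ k′ * α (len a) (len b′) * ν b′ s′ k′))
      ≡⟨ ∑-distrib-+ (λ b′ → 𝟙 (b Fin.≟ b′) * (k * α (len a) (len b′)))
           (λ b′ → ∑ λ s′ → ∑ λ k′ → toℕ k′ * α (len a) (len b′) * ν b′ s′ k′) ⟩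
    ∑ (λ b′ → 𝟙 (b Fin.≟ b′) * (k * α (len a) (len b′))) + pivotDegree ν
      ≡⟨ cong₂ _+_ (trans
           (∑-only _ b (λ b′ b′≢ → cong (_* (k * α (len a) (len b′))) (𝟙-no (b Fin.≟ b′) (b′≢ ∘ sym))))
           (trans (cong (_* (k * α (len a) (len b))) (𝟙-yes (b Fin.≟ b) refl)) (ℕ.*-identityˡ _)))
           (pivotDegree-histogram bs ss ks≤) ⟩
    k * α (len a) (len b) + rowDegree (toℕ a) (Vec.map toℕ bs) ks ∎
    where
    ν = histogram bs ss ks

  -- Residual degrees are at most d, so the nonzero ones are degrees of a state.
  record Residual {n} (bs : Vec (Fin m) n) (ss : Vec (Fin d) n) (ks : Vec ℕ n) : Set where
    field
      next-keys : Keys (mult (next (histogram bs ss ks)))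
      drops     : Omits (Vec.map toℕ bs) (residual (toℕ a) (Vec.map toℕ bs) (Vec.map deg ss) ks)
                        (Vec.map toℕ (Keys.lengths next-keys)) (Vec.map deg (Keys.values next-keys))

  mult-next : ∀ ν b t → mult (next ν) b t ≡
              ∑ λ s → ∑ λ k → 𝟙 (deg s ∸ toℕ k * β (len a) (len b) ≟ deg t) * ν b s k
  mult-next ν b t = sum-cong-≗ λ s → sum-cong-≗ λ k → 𝟙-if (deg s ∸ toℕ k * β (len a) (len b) ≟ deg t) (ν b s k)

  mult-next-insert : ∀ b s k ν b′ t → k < slots b s → mult (next (insert b s k ν)) b′ t ≡
    𝟙 (b Fin.≟ b′) * 𝟙 (deg s ∸ k * β (len a) (len b′) ≟ deg t) + mult (next ν) b′ t
  mult-next-insert b s k ν b′ t k< = trans (mult-next (insert b s k ν) b′ t)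
    (trans (∑-insert b s k (λ s′ k′ → 𝟙 (deg s′ ∸ k′ * β (len a) (len b′) ≟ deg t)) ν b′ k<)
      (cong (𝟙 (b Fin.≟ b′) * 𝟙 (deg s ∸ k * β (len a) (len b′) ≟ deg t) +_) (sym (mult-next ν b′ t))))

  -- The residual degree is a variable `t` so that it can be split: 0 equals no `deg`, hence the
  -- next state does not count the cycle; a positive value is at most `deg s` and thus the degree of
  -- some `s′`.
  residual-keys-∷ : ∀ {n} b s k (bs : Vec (Fin m) n) (ss : Vec (Fin d) n) {ks} t →
    deg s ∸ k * β (len a) (len b) ≡ t → k < slots b s → Residual bs ss ks → Residual (b ∷ bs) (s ∷ ss) (k ∷ ks)
  residual-keys-∷ b s k bs ss {ks} zero eq k< record { next-keys = keys bs′ ss′ tally≡ ; drops = D } = record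
    { next-keys = keys bs′ ss′ λ b′ t → trans (tally≡ b′ t) (sym (trans (mult-next-insert b s k ν b′ t k<)
        (cong (_+ mult (next ν) b′ t) (gone b′ t (b Fin.≟ b′)))))
    ; drops = omit-≡ eq D }
    where
    ν = histogram bs ss ks
    gone : ∀ b′ t (b≟ : Dec (b ≡ b′)) → 𝟙 b≟ * 𝟙 (deg s ∸ k * β (len a) (len b′) ≟ deg t) ≡ 0
    gone b′ t (no _)     = refl
    gone b′ t (yes refl) = cong (1 *_) (𝟙-no (deg s ∸ k * β (len a) (len b) ≟ deg t) λ e → ℕ.0≢1+n (trans (sym eq) e))
  residual-keys-∷ b s k bs ss {ks} (suc t₀) eq k< record { next-keys = keys bs′ ss′ tally≡ ; drops = D } = record
    { next-keys = keys (b ∷ bs′) (s′ ∷ ss′) λ b′ t → sym (trans (mult-next-insert b s k ν b′ t k<)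
        (cong₂ _+_ (kept b′ t (b Fin.≟ b′)) (sym (tally≡ b′ t))))
    ; drops = keep-≡ (trans eq (sym degs′)) D }
    where
    ν = histogram bs ss ks
    t₀<d : t₀ < d
    t₀<d = ℕ.≤-trans (subst (_≤ deg s) eq (ℕ.m∸n≤m (deg s) (k * β (len a) (len b)))) (Fin.toℕ<n s)
    s′ : Fin d
    s′ = fromℕ< t₀<d
    degs′ : deg s′ ≡ suc t₀
    degs′ = cong suc (Fin.toℕ-fromℕ< t₀<d)
    kept : ∀ b′ t (b≟ : Dec (b ≡ b′)) → 𝟙 b≟ * 𝟙 (deg s ∸ k * β (len a) (len b′) ≟ deg t) ≡
           𝟙 (b≟ ×-dec (s′ Fin.≟ t))
    kept b′ t (no _)     = refl
    kept b′ t (yes refl) = trans (ℕ.*-identityˡ (𝟙 (deg s ∸ k * β (len a) (len b) ≟ deg t)))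
      (𝟙-cong (deg s ∸ k * β (len a) (len b) ≟ deg t) (s′ Fin.≟ t)
        (λ e → Fin.toℕ-injective (ℕ.suc-injective (trans degs′ (trans (sym eq) e))))
        (λ { refl → trans eq (sym degs′) }))

  residual-keys : ∀ {n} (bs : Vec (Fin m) n) (ss : Vec (Fin d) n) {ks} → BoundedBy bs ss ks → Residual bs ss ks
  residual-keys []       []       []       = record
    { next-keys = keys [] [] λ b t → sym (trans (mult-next (λ _ _ _ → 0) b t)
        (∑-zero {d} _ λ s → ∑-zero {slots b s} (λ k → 𝟙 (deg s ∸ toℕ k * β (len a) (len b) ≟ deg t) * 0)
          λ k → ℕ.*-zeroʳ (𝟙 (deg s ∸ toℕ k * β (len a) (len b) ≟ deg t))))
    ; drops = [] }
  residual-keys (b ∷ bs) (s ∷ ss) {k ∷ ks} (k≤ ∷ ks≤) =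
    residual-keys-∷ b s k bs ss _ refl (s≤s k≤) (residual-keys bs ss ks≤)

-- Ψ stands for Φ, whose definition (a count over a realization) must not be
-- unfolded here.
module _ {d} (Ψ : State d → ℕ)
         (Ψ-count : (H : State d) (k : Keys (mult H)) →
                    Ψ H ≡ count (Vec.map toℕ (Keys.lengths k)) (Vec.map deg (Keys.values k)))
         (H : State d) (a : Fin (bound H)) (r : Fin d) where

  open Pivot H a r hiding (expansion)
  open Choices H a r

  count-residual : ∀ {n} (bs : Vec (Fin m) n) (ss : Vec (Fin d) n) {ks} → BoundedBy bs ss ks →
    count (Vec.map toℕ bs) (residual (toℕ a) (Vec.map toℕ bs) (Vec.map deg ss) ks) ≡ Ψ (next (histogram bs ss ks))
  count-residual bs ss ks≤ = trans (count-omits drops) (sym (Ψ-count (next (histogram bs ss _)) next-keys))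
    where open Residual (residual-keys bs ss ks≤)

  -- Pointwise equal allocations may lead to different states as terms, but a listing of the cycles
  -- of one is a listing for the other, and `Ψ-count` depends on nothing else.
  Ψ-next-extensional : Ext (λ ν → Ψ (next ν))
  Ψ-next-extensional {ν} {ν′} ν≈ = trans (Ψ-count (next ν) k)
    (sym (Ψ-count (next ν′) (keys (Keys.lengths k) (Keys.values k) λ b t → trans (Keys.tally≡ k b t)
      (trans (mult-next ν b t) (trans (sum-cong-≗ λ s → sum-cong-≗ λ k →
        cong (𝟙 (deg s ∸ toℕ k * β (len a) (len b) ≟ deg t) *_) (ν≈ b s k)) (sym (mult-next ν′ b t)))))))
    where k = every (mult (next ν))

  term : ℕ → Allocation → ℕ
  term u ν = 𝟙 (u + pivotDegree ν ≟ deg r) * Ψ (next ν)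

  term-extensional : ∀ u → Ext (term u)
  term-extensional u {ν} {ν′} ν≈ = cong₂ (λ t x → 𝟙 (u + t ≟ deg r) * x)
    (sum-cong-≗ λ b → sum-cong-≗ λ s → sum-cong-≗ λ k → cong (toℕ k * α (len a) (len b) *_) (ν≈ b s k))
    (Ψ-next-extensional ν≈)

  𝟙-all : ∀ {n} {Q : Fin n → Set} (q? : ∀ i → Dec (Q i)) → 𝟙 (Fin.all? q?) ≡ ∏ (λ i → 𝟙 (q? i))
  𝟙-all {zero}  q? = 𝟙-yes (Fin.all? q?) λ ()
  𝟙-all {suc n} q? = trans
    (𝟙-× (q? zero) (Fin.all? (q? ∘ suc)) (Fin.all? q?)
      (λ { q qs zero → q ; q qs (suc i) → qs i }) (λ qs → qs zero , qs ∘ suc))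
    (cong (𝟙 (q? zero) *_) (𝟙-all (q? ∘ suc)))

  -- The conditions on the sums concern single slots and join the weights in `V`; the degree
  -- equation links the slots and joins `Ψ` in `term`. The sum then factors over lengths and degrees
  -- into multinomial sums.
  ∑ᴸ-allocations : ∀ u → ∑ᴸ (allocations u) (λ ν → ∏ (λ b → ∏ λ s → W ν b s) * Ψ (next ν)) ≡ allocationSum h (term u)
  ∑ᴸ-allocations u = begin
    ∑ᴸ (allocations u) (λ ν → ∏ (λ b → ∏ λ s → W ν b s) * Ψ (next ν))
      ≡⟨ ∑ᴸ-filter (isAllocation? u) box _ ⟩
    ∑ᴸ box (λ ν → 𝟙 (isAllocation? u ν) * (∏ (λ b → ∏ λ s → W ν b s) * Ψ (next ν)))
      ≡⟨ ∑ᴸ-cong box weights ⟩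
    ∑ᴸ box (λ ν → ∏ (λ b → ∏ λ s → V b s (ν b s)) * term u ν)
      ≡⟨ ∑ᴸ-families row (λ b x → ∏ λ s → V b s (x s)) (term u)
           (λ ν≡ → term-extensional u λ b s k → cong (λ x → x s k) (ν≡ b)) ⟩
    sumΠ (λ b φ → ∑ᴸ (row b) (λ x → ∏ (λ s → V b s (x s)) * φ x)) (term u)
      ≡⟨ sumΠ-cong {_≈_ = _≈_} (λ _ _ → refl) (λ b → ∑ᴸ-linear (row b) (λ x → ∏ λ s → V b s (x s)))
          (Tᵇ-linear h) (λ b φ φ-ext → begin
           ∑ᴸ (row b) (λ x → ∏ (λ s → V b s (x s)) * φ x)
             ≡⟨ ∑ᴸ-families (cell b) (V b) φ (λ x≡ → φ-ext λ s k → cong (λ y → y k) (x≡ s)) ⟩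
           sumΠ (λ s ψ → ∑ᴸ (cell b s) (λ y → V b s y * ψ y)) φ
             ≡⟨ sumΠ-cong {_≈_ = _≗_} (λ _ → refl) (λ s → ∑ᴸ-linear (cell b s) (V b s)) (Tˢ-linear h b)
                  (λ s ψ ψ-ext → ∑ᴸ-weight (gcd⁺ (toℕ a) (toℕ b)) (h b s) ψ ψ-ext) φ φ-ext ⟩
           sumΠ (Tˢ h b) φ ∎) (term u) (term-extensional u) ⟩
    allocationSum h (term u) ∎
    where
    cell : ∀ b s → List (Fin (slots b s) → ℕ)
    cell b s = families λ k → upTo (suc (h b s))
    row : ∀ b → List (∀ s → Fin (slots b s) → ℕ)
    row b = families (cell b)
    box : List Allocation
    box = families row
    V : ∀ b s → (Fin (slots b s) → ℕ) → ℕ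
    V b s y = 𝟙 (∑ y ≟ h b s) * weight (gcd⁺ (toℕ a) (toℕ b)) (h b s) y
    eq : ∀ x y z t → x * y * (z * t) ≡ x * z * (y * t)
    eq = solve-∀
    weights : ∀ ν → 𝟙 (isAllocation? u ν) * (∏ (λ b → ∏ λ s → W ν b s) * Ψ (next ν)) ≡
              ∏ (λ b → ∏ λ s → V b s (ν b s)) * term u ν
    weights ν = begin
      𝟙 (isAllocation? u ν) * (∏ (λ b → ∏ λ s → W ν b s) * Ψ (next ν))
        ≡⟨ cong (_* (∏ (λ b → ∏ λ s → W ν b s) * Ψ (next ν))) (trans
             (𝟙-× (Fin.all? λ b → Fin.all? λ s → sum≟ b s) (u + pivotDegree ν ≟ deg r) (isAllocation? u ν) _,_ id)
             (cong (_* 𝟙 (u + pivotDegree ν ≟ deg r)) (trans (𝟙-all λ b → Fin.all? λ s → sum≟ b s)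
               (∏-cong λ b → 𝟙-all (sum≟ b))))) ⟩
      ∏ (λ b → ∏ λ s → 𝟙 (sum≟ b s)) * 𝟙 (u + pivotDegree ν ≟ deg r) * (∏ (λ b → ∏ λ s → W ν b s) * Ψ (next ν))
        ≡⟨ eq (∏ (λ b → ∏ λ s → 𝟙 (sum≟ b s))) _ _ _ ⟩
      ∏ (λ b → ∏ λ s → 𝟙 (sum≟ b s)) * ∏ (λ b → ∏ λ s → W ν b s) * term u ν
        ≡⟨ cong (_* term u ν) (trans (∏-cong λ b → ∏-distrib-* (λ s → 𝟙 (sum≟ b s)) (W ν b))
             (∏-distrib-* (λ b → ∏ λ s → 𝟙 (sum≟ b s)) (λ b → ∏ λ s → W ν b s))) ⟨
      ∏ (λ b → ∏ λ s → V b s (ν b s)) * term u ν ∎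
      where
      sum≟ : ∀ b s → Dec (∑ (ν b s) ≡ h b s)
      sum≟ b s = ∑ (ν b s) ≟ h b s

  module _ (occupied : 0 < mult H a r) where

    pivot-tally : ∀ b s → 𝟙 ((a Fin.≟ b) ×-dec (r Fin.≟ s)) + h b s ≡ mult H b s
    pivot-tally b s = go ((b Fin.≟ a) ×-dec (s Fin.≟ r))
      where
      go : (q? : Dec (b ≡ a × s ≡ r)) → 𝟙 ((a Fin.≟ b) ×-dec (r Fin.≟ s)) +
           (if does q? then mult H b s ∸ 1 else mult H b s) ≡ mult H b s
      go (yes (refl , refl)) = trans
        (cong (_+ (mult H a r ∸ 1)) (𝟙-yes ((a Fin.≟ a) ×-dec (r Fin.≟ r)) (refl , refl))) (ℕ.m+[n∸m]≡n occupied)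
      go (no ¬e) = cong (_+ mult H b s) (𝟙-no ((a Fin.≟ b) ×-dec (r Fin.≟ s)) λ (e , e′) → ¬e (sym e , sym e′))

    recurrence : Ψ H ≡ expansion H a r Ψ
    recurrence = begin
      Ψ H
        ≡⟨ Ψ-count H (keys (a ∷ bs) (r ∷ ss) λ b s
            → trans (cong (𝟙 ((a Fin.≟ b) ×-dec (r Fin.≟ s)) +_) (tally≡ b s)) (pivot-tally b s)) ⟩
      count (toℕ a ∷ ps) (deg r ∷ rs)
        ≡⟨ count-∷ (toℕ a) (deg r) ps rs ⟩
      ∑ {suc (deg r)} (λ u → I (len a) (toℕ u) *
        ∑ᴷ (toℕ a) (deg r) ps rs (λ ks → 𝟙 (toℕ u + rowDegree (toℕ a) ps ks ≟ deg r) * count ps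
            (residual (toℕ a) ps rs ks)))
        ≡⟨ sum-cong-≗ {suc (deg r)} (λ u → cong (I (len a) (toℕ u) *_) (pivot (toℕ u))) ⟩
      expansion H a r Ψ ∎
      where
      open Keys (every h) renaming (lengths to bs; values to ss)
      ps = Vec.map toℕ bs
      rs = Vec.map deg ss
      pivot : ∀ u → ∑ᴷ (toℕ a) (deg r) ps rs (λ ks →
                      𝟙 (u + rowDegree (toℕ a) ps ks ≟ deg r) * count ps (residual (toℕ a) ps rs ks)) ≡
                    ∑ᴸ (allocations u) (λ ν → ∏ (λ b → ∏ λ s → W ν b s) * Ψ (next ν))
      pivot u = begin
        ∑ᴷ (toℕ a) (deg r) ps rs (λ ks → 𝟙 (u + rowDegree (toℕ a) ps ks ≟ deg r) * count ps
            (residual (toℕ a) ps rs ks))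
          ≡⟨ ∑ᴷ-cong (toℕ a) (deg r) ps rs (λ {ks} ks≤ → cong₂ (λ t c → 𝟙 (u + t ≟ deg r) * c)
               (sym (pivotDegree-histogram bs ss ks≤)) (count-residual bs ss ks≤)) ⟩
        ∑ᴷ (toℕ a) (deg r) ps rs (term u ∘ histogram bs ss)
          ≡⟨ ∑ᴷ-histogram bs ss (term u) (term-extensional u) ⟩
        allocationSum (tally bs ss) (term u)
          ≡⟨ allocationSum-cong tally≡ (term u) (term-extensional u) ⟩
        allocationSum h (term u)
          ≡⟨ ∑ᴸ-allocations u ⟨
        ∑ᴸ (allocations u) (λ ν → ∏ (λ b → ∏ λ s → W ν b s) * Ψ (next ν)) ∎

-- Uniqueness of the solution of the recurrence

total : ∀ {d} → State d → ℕ
total H = ∑ λ b → ∑ λ s → mult H b s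

∑-mono-≤ : ∀ {n} {f g : Fin n → ℕ} → (∀ i → f i ≤ g i) → ∑ f ≤ ∑ g
∑-mono-≤ {zero}  f≤g = z≤n
∑-mono-≤ {suc n} f≤g = ℕ.+-mono-≤ (f≤g zero) (∑-mono-≤ (f≤g ∘ suc))

∑-mono-< : ∀ {n} {f g : Fin n → ℕ} → (∀ i → f i ≤ g i) → ∀ i → f i < g i → ∑ f < ∑ g
∑-mono-< f≤g zero    f<g = ℕ.+-mono-<-≤ f<g (∑-mono-≤ (f≤g ∘ suc))
∑-mono-< f≤g (suc i) f<g = ℕ.+-mono-≤-< (f≤g zero) (∑-mono-< (f≤g ∘ suc) i f<g)

-- At most one degree index fits `x`, and none does if `x` is 0 or exceeds `d`.
∑-𝟙-≤ : ∀ {d} x y → ∑ {d} (λ t → 𝟙 (x ≟ deg t) * y) ≤ y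
∑-𝟙-≤ {d} x y with Fin.any? (λ (t : Fin d) → x ≟ deg t)
... | no ¬e = ℕ.≤-trans (ℕ.≤-reflexive (∑-zero {d} _ λ t → cong (_* y) (𝟙-no (x ≟ deg t) (¬e ∘ (t ,_))))) z≤n
... | yes (t , refl) = ℕ.≤-reflexive (trans
  (∑-only {d} _ t λ t′ t′≢ → cong (_* y) (𝟙-no (deg t ≟ deg t′)
    (λ e → t′≢ (sym (Fin.toℕ-injective (ℕ.suc-injective e))))))
  (trans (cong (_* y) (𝟙-yes (deg t ≟ deg t) refl)) (ℕ.*-identityˡ y)))

module _ {d} (H : State d) (a : Fin (bound H)) (r : Fin d) (occupied : 0 < mult H a r) where

  open Pivot H a r hiding (expansion)

  h≤mult : ∀ b s → h b s ≤ mult H b s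
  h≤mult b s = go ((b Fin.≟ a) ×-dec (s Fin.≟ r))
    where
    go : (q? : Dec (b ≡ a × s ≡ r)) → (if does q? then mult H b s ∸ 1 else mult H b s) ≤ mult H b s
    go (yes _) = ℕ.m∸n≤m (mult H b s) 1
    go (no  _) = ℕ.≤-refl

  h<mult : h a r < mult H a r
  h<mult = go ((a Fin.≟ a) ×-dec (r Fin.≟ r))
    where
    go : (q? : Dec (a ≡ a × r ≡ r)) → (if does q? then mult H a r ∸ 1 else mult H a r) < mult H a r
    go (yes _) = ℕ.≤-reflexive (ℕ.m+[n∸m]≡n occupied)
    go (no ¬e) = contradiction (refl , refl) ¬e

  -- Each remaining cycle passes to at most one residual degree, so no new cycles arise; the removed
  -- pivot makes the inequality strict.
  total-next : ∀ {u ν} → IsAllocation u ν → total (next ν) < total H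
  total-next {u} {ν} (sums , _) = ℕ.≤-<-trans (∑-mono-≤ row)
    (∑-mono-< (λ b → ∑-mono-≤ (h≤mult b)) a (∑-mono-< (h≤mult a) r h<mult))
    where
    moved : ∀ b s → Fin (suc (K (len a) (len b) (deg r) (deg s))) → Fin d → ℕ
    moved b s k t = 𝟙 (deg s ∸ toℕ k * β (len a) (len b) ≟ deg t) * ν b s k
    row : ∀ b → ∑ (λ t → mult (next ν) b t) ≤ ∑ (h b)
    row b = ℕ.≤-trans (ℕ.≤-reflexive (begin
        ∑ (mult (next ν) b)
          ≡⟨ sum-cong-≗ (Choices.mult-next H a r ν b) ⟩
        ∑ (λ t → ∑ λ s → ∑ λ k → moved b s k t)
          ≡⟨ ∑-comm (λ t s → ∑ λ k → moved b s k t) ⟩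
        ∑ (λ s → ∑ λ t → ∑ λ k → moved b s k t)
          ≡⟨ sum-cong-≗ (λ s → ∑-comm (λ t k → moved b s k t)) ⟩
        ∑ (λ s → ∑ λ k → ∑ λ t → moved b s k t) ∎))
      (∑-mono-≤ λ s → ℕ.≤-trans
        (∑-mono-≤ {f = λ k → ∑ (moved b s k)} {ν b s} λ k → ∑-𝟙-≤ {d} (deg s ∸ toℕ k * β (len a) (len b)) (ν b s k))
        (ℕ.≤-reflexive (sums b s)))

  expansion-cong : ∀ {F G : State d → ℕ} → (∀ H′ → total H′ < total H → F H′ ≡ G H′) →
                   expansion H a r F ≡ expansion H a r G
  expansion-cong {F} {G} F≡G = sum-cong-≗ {suc (deg r)} λ u → cong (I (len a) (toℕ u) *_)
    (∑ᴸ-cong-∈ (allocations (toℕ u)) λ {ν} ν∈ → cong (∏ (λ b → ∏ λ s → W ν b s) *_)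
      (F≡G (next ν) (total-next {toℕ u} {ν} (proj₂ (∈-filter⁻ (isAllocation? (toℕ u)) {xs = box} ν∈)))))
    where
    box : List Allocation
    box = families λ b → families λ s → families λ k → upTo (suc (h b s))
    ∑ᴸ-cong-∈ : ∀ {A : Set} (xs : List A) {f g : A → ℕ} → (∀ {x} → x List.∈ xs → f x ≡ g x) →
                ∑ᴸ xs f ≡ ∑ᴸ xs g
    ∑ᴸ-cong-∈ []       f≡g = refl
    ∑ᴸ-cong-∈ (x ∷ xs) f≡g = cong₂ _+_ (f≡g (here refl)) (∑ᴸ-cong-∈ xs (f≡g ∘ there))

isZero? : ∀ {d} (H : State d) → Dec (IsZero H)
isZero? H = Fin.all? λ b → Fin.all? λ s → mult H b s ≟ 0

module _ {d} (F : State d → ℕ) (F-zero : (H : State d) → IsZero H → F H ≡ 1)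
         (F-recurrence : (H : State d) → ¬ IsZero H → ∃ λ a → ∃ λ r → 0 < mult H a r × F H ≡ expansion H a r F) where

  -- `F` may choose its own pivot at each state. Since `Φ` satisfies the recurrence for every
  -- occupied pivot, the pivot of `F` can be used for both, and induction on the number of cycles
  -- applies.
  Φ-unique : (H : State d) → Acc _<_ (total H) → Φ H ≡ F H
  Φ-unique H (acc rec) = by-zero (isZero? H)
    where
    by-recurrence : (∃ λ a → ∃ λ r → 0 < mult H a r × F H ≡ expansion H a r F) → Φ H ≡ F H
    by-recurrence (a , r , occupied , eq) = begin
      Φ H                   ≡⟨ recurrence Φ Φ-count H a r occupied ⟩
      expansion H a r Φ     ≡⟨ expansion-cong H a r occupied {Φ} {F} (λ H′ H′< → Φ-unique H′ (rec H′<)) ⟩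
      expansion H a r F     ≡⟨ eq ⟨
      F H                   ∎
    by-zero : Dec (IsZero H) → Φ H ≡ F H
    by-zero (yes H≡0) = trans (Φ-zero H H≡0) (sym (F-zero H H≡0))
    by-zero (no  H≢0) = by-recurrence (F-recurrence H H≢0)

theorem4p1 : (d : ℕ) → 1 ≤ d →
    ((H : State d) → IsZero H → Φ H ≡ 1)
    × ((H : State d) → ¬ IsZero H →
    ∀ a r → 0 < mult H a r → Φ H ≡ expansion H a r Φ)
    × ((F : State d → ℕ) →
    ((H : State d) → IsZero H → F H ≡ 1) →
    ((H : State d) → ¬ IsZero H →
    ∃ λ a → ∃ λ r → 0 < mult H a r × F H ≡ expansion H a r F) →
    (H : State d) (R : Realization H) → length (completions (proj₁ R)) ≡ F H)
theorem4p1 d _ =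
    Φ-zero
  , (λ H _ a r occupied → recurrence Φ Φ-count H a r occupied)
  , (λ F F-zero F-recurrence H R →
      trans (realization-independent H R) (Φ-unique F F-zero F-recurrence H (<-wellFounded (total H))))
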